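{- For any $\lambda\in\mathcal{P}^k$ and $1\le t\le k$, \[ \widetilde{g}^{(k)}_{R_t\cup\lambda}=\widetilde{g}^{(k)}_{R_t}\,\widetilde{g}^{(k)}_{\lambda}. \]
   Context: Fix a positive integer $k$. Let $I=\mathbb{Z}/(k+1)\mathbb{Z}=\{0,1,\dots,k\}$ and let $W=\tilde S_{k+1}$ be the affine symmetric group with Coxeter generators $s_i$ ($i\in I$), relations $s_i^2=1$, $s_is_{i+1}s_i=s_{i+1}s_is_{i+1}$, and $s_is_j=s_js_i$ when $i-j\not\equiv 0,\pm1 \pmod{k+1}$. Let $l$ be the length function and $\le$ the strong (Bruhat) order. Let $W^\circ\subset W$ be the set of affine Grassmannian elements, i.e. $w$ with $ws_i>w$ for all $i\in\{1,\dots,k\}$. For $A\subsetneq I$, $d_A=s_{i_1}\cdots s_{i_m}$ where $A=\{i_1,\dots,i_m\}$ and the word $i_1\cdots i_m$ is cyclically decreasing (distinct letters, and no $j$ occurs to the left of $j+1$, indices mod $k+1$). $\mathcal{P}^k$ is the set of partitions $\lambda$ with $\lambda_1\le k$. The residue of the cell in row $i$, column $j$ is $j-i \bmod (k+1)$. For $\lambda\in\mathcal{P}^k$, $w_\lambda=s_{i_1}\cdots s_{i_l}$ where $(i_1,\dots,i_l)$ are the residues of the cells of $\lambda$ read from the shortest row to the longest, each row from right to left; $\lambda\mapsto w_\lambda$ is a bijection $\mathcal{P}^k\to W^\circ$, and $\mathcal P^k$ carries the strong order $\mu\le\lambda\iff w_\mu\le w_\lambda$. The $k$-rectangle is $R_t=(t^{k+1-t})=(t,\dots,t)$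 ($k+1-t$ parts), and $R_t\cup\lambda$ is the partition obtained by concatenating the parts of $R_t$ and $\lambda$ and sorting them in weakly decreasing order. Demazure action: for $s=s_i$, $\phi_s(x)=sx$ if $sx>x$ and $\phi_s(x)=x$ otherwise; for $x=t_1\cdots t_n$ reduced, $x*y=\phi_{t_1}\cdots\phi_{t_n}(y)$. Let $h_r$ be the complete homogeneous symmetric functions and $\Lambda^{(k)}=\mathbb{Z}[h_1,\dots,h_k]$. The $K$-$k$-Schur functions $\{g^{(k)}_w\}_{w\in W^\circ}$ are the family (a basis of $\Lambda^{(k)}$) determined by $g^{(k)}_e=1$ and, for $w\in W^\circ$ and $1\le r\le k$, $h_r\,g^{(k)}_w=\sum (-1)^{r+l(w)-l(d_A*w)} g^{(k)}_{d_A*w}$, summed over $A\subsetneq I$ with $|A|=r$ and $d_A*w\in W^\circ$. Write $g^{(k)}_\lambda=g^{(k)}_{w_\lambda}$ and $\widetilde{g}^{(k)}_{\lambda}=\sum_{\mu\in\mathcal{P}^k,\ \mu\le\lambda} g^{(k)}_{\mu}$. -}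

module Defs where

open import Data.Bool.ListAction using (any)
open import Data.Bool using (Bool; true; false; if_then_else_; _∧_; not; T)
open import Data.Nat as ℕ using (ℕ; zero; suc; _∸_; _≤_; _<_; _<ᵇ_; _≡ᵇ_; NonZero)
import Data.Nat.Properties as ℕP
open import Data.Nat.DivMod using (_mod_)
open import Data.Integer as ℤ using (ℤ; +_)
open import Data.Integer.DivMod using (_%ℕ_)
import Data.Integer.Properties as ℤP
open import Data.Fin as Fin using (Fin; toℕ)
import Data.Fin.Properties as FinP
open import Data.Vec as Vec using (Vec; []; _∷_; tabulate; replicate; zipWith)
import Data.Vec.Properties as VecP
open import Data.List as List using (List; []; _∷_; _++_; map; concatMap; filter; upTo; length; reverse; foldr; applyDownFrom)
open import Data.List.Membership.Propositional using (_∈_)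
open import Data.List.Relation.Unary.Unique.Propositional using (Unique)
open import Data.List.Relation.Unary.Linked using (Linked)
open import Data.List.Relation.Unary.All using (All)
open import Data.Product using (_×_; _,_; proj₁; proj₂; ∃-syntax)
open import Relation.Binary.PropositionalEquality using (_≡_)
open import Relation.Nullary using (Dec; yes; no; ¬_)
open import Relation.Nullary.Decidable using (⌊_⌋)

-- Λ^(k) = ℤ[h₁,…,h_k]: polynomials in k commuting indeterminates.
-- A polynomial is a finite formal sum of terms c·h^m (m an exponent
-- vector); two polynomials are equal (≈) iff all coefficients agree.

Mono : ℕ → Set
Mono k = Vec ℕ k

Poly : ℕ → Set
Poly k = List (ℤ × Mono k)

coeff : ∀ {k} → Poly k → Mono k → ℤ
coeff []              m = + 0
coeff ((c , m′) ∷ p)  m =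
  if ⌊ VecP.≡-dec ℕ._≟_ m′ m ⌋ then c ℤ.+ coeff p m else coeff p m

infix 4 _≈_
_≈_ : ∀ {k} → Poly k → Poly k → Set
p ≈ q = ∀ m → coeff p m ≡ coeff q m

infixl 6 _⊕_
_⊕_ : ∀ {k} → Poly k → Poly k → Poly k
p ⊕ q = p ++ q

infixl 7 _⊗_
_⊗_ : ∀ {k} → Poly k → Poly k → Poly k
p ⊗ q = concatMap (λ t → map (λ u → (proj₁ t ℤ.* proj₁ u , zipWith ℕ._+_ (proj₂ t) (proj₂ u))) q) p

neg : ∀ {k} → Poly k → Poly k
neg = map (λ t → (ℤ.- proj₁ t , proj₂ t))

one : ∀ {k} → Poly k
one {k} = (+ 1 , replicate k 0) ∷ []

Σ-list : ∀ {k} → List (Poly k) → Poly k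
Σ-list = foldr _⊕_ []

h : (k r : ℕ) → Poly k
h k r = (+ 1 , tabulate (λ j → if suc (toℕ j) ≡ᵇ r then 1 else 0)) ∷ []

sgn : ∀ {k} → ℕ → Poly k → Poly k
sgn zero          p = p
sgn (suc zero)    p = neg p
sgn (suc (suc e)) p = sgn e p

-- The affine symmetric group W = S̃_{k+1}, n = k+1, realised as the
-- group of affine permutations f : ℤ → ℤ (f(m+n) = f(m)+n, Σ f(1..n) =
-- Σ 1..n) with s_i acting on values by swapping the classes i, i+1 mod n.
-- An element is given by a word i₁⋯i_m (meaning s_{i₁}⋯s_{i_m}); two words
-- denote the same element iff their windows [f(1),…,f(n)] coincide.

Word : ℕ → Set
Word k = List (Fin (suc k))

sAct : ∀ {k} → Fin (suc k) → ℤ → ℤ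
sAct {k} i m =
  if (m %ℕ suc k) ≡ᵇ toℕ i then m ℤ.+ + 1
  else if (m %ℕ suc k) ≡ᵇ ((suc (toℕ i)) ℕ.% suc k) then m ℤ.- + 1
  else m

act : ∀ {k} → Word k → ℤ → ℤ
act []      m = m
act (i ∷ u) m = sAct i (act u m)

window : ∀ {k} → Word k → Vec ℤ (suc k)
window u = tabulate (λ p → act u (+ suc (toℕ p)))

infix 4 _≡W_
_≡W_ : ∀ {k} → Word k → Word k → Set
u ≡W v = window u ≡ window v

_≟W_ : ∀ {k} (u v : Word k) → Dec (u ≡W v)
u ≟W v = VecP.≡-dec ℤ._≟_ (window u) (window v)

allWords : ∀ k → ℕ → List (Word k)
allWords k zero    = [] ∷ []
allWords k (suc m) = concatMap (λ i → map (i ∷_) (allWords k m)) (List.allFin (suc k))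

hasWordOfLength : ∀ {k} → Word k → ℕ → Bool
hasWordOfLength {k} u m = any (λ v → ⌊ v ≟W u ⌋) (allWords k m)

-- Coxeter length: the least m such that the element is a product of m
-- generators (the search over m ≤ |u| suffices since u itself is a word).
len : ∀ {k} → Word k → ℕ
len u = first (upTo (suc (length u)))
  where
  first : List ℕ → ℕ
  first []       = length u
  first (m ∷ ms) = if hasWordOfLength u m then m else first ms

-- Strong (Bruhat) order: reflexive–transitive closure of x → x·t with t
-- a reflection (conjugate u s_i u⁻¹ of a simple reflection) and
-- l(x) < l(x·t).

infix 4 _≤B_
data _≤B_ {k : ℕ} : Word k → Word k → Set where
  ≤B-refl : ∀ {x y} → x ≡W y → x ≤B y
  ≤B-step : ∀ {x y z} (u : Word k) (i : Fin (suc k)) →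
            x ≤B y → z ≡W (y ++ u ++ i ∷ reverse u) → len y < len z → x ≤B z

-- Affine Grassmannian elements: w s_i > w for all i ∈ {1,…,k}.
-- (For a simple reflection s, ws > w in Bruhat order iff l(ws) > l(w).)

Grass : ∀ {k} → Word k → Set
Grass {k} w = (i : Fin k) → len w < len (w ++ Fin.suc i ∷ [])

grass? : ∀ {k} (w : Word k) → Dec (Grass w)
grass? {k} w = FinP.all? (λ i → len w ℕ.<? len (w ++ Fin.suc i ∷ []))

φ : ∀ {k} → Fin (suc k) → Word k → Word k
φ i x = if len x <ᵇ len (i ∷ x) then i ∷ x else x

-- x * y = φ_{t₁}⋯φ_{t_m}(y) for a (reduced) word t₁⋯t_m of x
demazure : ∀ {k} → Word k → Word k → Word k
demazure x y = foldr φ y x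

Subset : ℕ → Set
Subset k = Vec Bool (suc k)

allVecs : ∀ n → List (Vec Bool n)
allVecs zero    = [] ∷ []
allVecs (suc n) = concatMap (λ b → map (b ∷_) (allVecs n)) (true ∷ false ∷ [])

card : ∀ {n} → Vec Bool n → ℕ
card []           = 0
card (true ∷ v)   = suc (card v)
card (false ∷ v)  = card v

-- first element of I not in A (0 if none; only used for proper A)
missing : ∀ {k} → Subset k → Fin (suc k)
missing {k} A = go (List.allFin (suc k))
  where
  go : List (Fin (suc k)) → Fin (suc k)
  go []       = Fin.zero
  go (j ∷ js) = if Vec.lookup A j then go js else j

-- cyclically decreasing word for A ⊊ I: with j ∉ A, list the elements
-- of A in the order j-1, j-2, …, j+1 (mod k+1).
dword : ∀ {k} → Subset k → Word k
dword {k} A =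
  List.filterᵇ (Vec.lookup A)
    (map (λ d → (toℕ (missing A) ℕ.+ suc k ∸ d) mod suc k) (List.applyUpTo suc k))

dA : ∀ {k} → Subset k → Word k
dA = dword

pieriSum : ∀ {k} → (Word k → Poly k) → ℕ → Word k → Poly k
pieriSum {k} g r w =
  Σ-list (map (λ A → sgn ((r ℕ.+ len w) ∸ len (demazure (dA A) w)) (g (demazure (dA A) w)))
              (List.filterᵇ (λ A → (card A <ᵇ suc k) ∧ (card A ≡ᵇ r)
                                    ∧ ⌊ grass? (demazure (dA A) w) ⌋)
                            (allVecs (suc k))))

record IsKkSchur (k : ℕ) (g : Word k → Poly k) : Set where
  field
    respects : ∀ u v → Grass u → u ≡W v → g u ≈ g v
    unit     : g [] ≈ one
    pieri    : ∀ w → Grass w → ∀ r → 1 ≤ r → r ≤ k → h k r ⊗ g w ≈ pieriSum g r w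

IsPk : ℕ → List ℕ → Set
IsPk k λ′ = Linked ℕ._≥_ λ′ × All (λ x → 1 ≤ x × x ≤ k) λ′

residue : ∀ k → ℕ → ℕ → Fin (suc k)
residue k i j = ((+ j ℤ.- + i) %ℕ suc k) mod suc k

-- row i of length c read right to left: residues of columns c, c-1, …, 1
rowWord : ∀ k → ℕ → ℕ → Word k
rowWord k i c = map (residue k i) (applyDownFrom suc c)

-- rows numbered 1,2,…; read from the last (shortest) row to the first
wordFrom : ∀ k → ℕ → List ℕ → Word k
wordFrom k i []       = []
wordFrom k i (c ∷ cs) = wordFrom k (suc i) cs ++ rowWord k i c

wλ : ∀ k → List ℕ → Word k
wλ k = wordFrom k 1

infix 4 _≤S_
_≤S_ : ∀ {k} → List ℕ → List ℕ → Set
_≤S_ {k} μ λ′ = wλ k μ ≤B wλ k λ′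

rect : ℕ → ℕ → List ℕ
rect k t = List.replicate (suc k ∸ t) t

insertDesc : ℕ → List ℕ → List ℕ
insertDesc x []       = x ∷ []
insertDesc x (y ∷ ys) = if y <ᵇ x then x ∷ y ∷ ys else y ∷ insertDesc x ys

sortDesc : List ℕ → List ℕ
sortDesc = foldr insertDesc []

_∪P_ : List ℕ → List ℕ → List ℕ
μ ∪P λ′ = sortDesc (μ ++ λ′)

IsLowerEnum : ∀ k → List ℕ → List (List ℕ) → Set
IsLowerEnum k λ′ L =
  Unique L × (∀ μ → (μ ∈ L → IsPk k μ × _≤S_ {k} μ λ′) × (IsPk k μ × _≤S_ {k} μ λ′ → μ ∈ L))

-- Σ_{μ ∈ L} g_μ ; with L as above this is g̃_λ
gsum : ∀ {k} → (Word k → Poly k) → List (List ℕ) → Poly k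
gsum {k} g L = Σ-list (map (λ μ → g (wλ k μ)) L)

{-# OPTIONS --safe #-}

-- Words act on ℤ as affine permutations, n = k + 1.  An affine Grassmannian element w increases on
-- each block of positions (l n, l n + n], so it is governed by the blocks b(x) of w⁻¹(x): the
-- truncated Demazure operator D i exchanges b(i) and b(i+1) exactly when b(i) < b(i+1), a bubble sort.
-- By the lifting property, the Bruhat ideal of D i w arises from that of w by replacing v with
-- v + s_i v, v or 0 according to the sign of b(i+1) − b(i).  Hence, with g̃(u) the sum over the ideal
-- of D_u(e), the Pieri rule becomes h_r g̃(u) = Σ_{|A| = r} Σ_{B ⊆ A} (−1)^{r−|B|} g̃(d_B u).  The map
-- Θ : w ↦ (rotation of w by t) · w_{R_t} satisfies D (i+t) Θ = Θ (D i), and Θ (w_λ) = w_{R_t ∪ λ}, so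
-- both u ↦ g̃(Θ u) and u ↦ g̃_{R_t} g̃(u) satisfy this rule, and they agree at the identity.  The rule
-- determines its solutions: each w ≠ e is the leading term for a shorter μ, w = d_B μ, while any other
-- A with |A| = |B| gives a shorter element or one with a larger top window entry.
module Submission where

open import Defs
open import Data.Bool using (Bool; true; false; if_then_else_; _∧_; _∨_; not; T)
open import Data.Bool.ListAction using (any)
open import Data.Nat as ℕ using (ℕ; zero; suc; _∸_; _≤_; _<_; _<ᵇ_; _≡ᵇ_; z≤n; s≤s)
import Data.Bool
import Data.Nat.Properties as ℕP
open import Data.Nat.DivMod using (_mod_; m<n⇒m%n≡m; n%n≡0)
open import Data.Integer as ℤ using (ℤ; +_; -[1+_]; +≤+; _%ℕ_; _/ℕ_) renaming (_≤_ to _≤ᶻ_; _<_ to _<ᶻ_; _+_ to _+ᶻ_; _-_ to _-ᶻ_; _*_ to _*ᶻ_; -_ to -ᶻ_)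
open import Data.Integer.DivMod using (n%ℕd<d; a≡a%ℕn+[a/ℕn]*n)
import Data.Integer.Properties as ℤP
import Data.Integer.Tactic.RingSolver as ZR
open import Data.Fin as Fin using (Fin; toℕ; fromℕ<)
import Data.Fin.Properties as FinP
open import Data.Vec as Vec using (Vec; []; _∷_)
import Data.Vec.Properties as VecP
open import Data.List as List using (List; []; _∷_; _++_; map; concatMap; length; reverse; foldr; applyUpTo)
import Data.List.Properties as ListP
open import Data.List.Relation.Unary.All as All using (All; []; _∷_)
import Data.List.Relation.Unary.All.Properties as AllP
open import Data.List.Relation.Unary.Any as Any using (Any; here; there)
import Data.List.Relation.Unary.Any.Properties as AnyP
open import Data.List.Relation.Unary.AllPairs using (AllPairs; []; _∷_)
open import Data.List.Relation.Unary.Linked as Linked using (Linked; []; [-]; _∷_)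
open import Data.List.Membership.Propositional using (_∈_; find; lose)
import Data.List.Membership.Propositional.Properties as MemP
open import Data.Maybe using (Maybe; just; nothing)
open import Data.Product using (_×_; _,_; proj₁; proj₂; ∃-syntax)
open import Data.Sum using (_⊎_; inj₁; inj₂; [_,_]′)
open import Data.Empty using (⊥; ⊥-elim)
open import Data.Unit using (tt)
open import Function using (_∘_; id)
open import Relation.Binary.PropositionalEquality using (_≡_; _≢_; refl; sym; trans; cong; cong₂; subst; subst₂; module ≡-Reasoning)
open import Relation.Binary.Definitions using (tri<; tri≈; tri>)
open import Relation.Nullary using (Dec; yes; no; ¬_; contradiction)
open import Relation.Nullary.Decidable using (⌊_⌋)

-- A term of the Pieri rule carries a sign depending on lengths and a Grassmannian condition on a
-- Demazure product; neither is evidently compatible with `Θ`. Letter by letter, however, sign and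
-- condition together are one operator T_i - 1, where T_i replaces v by v + s_i v, v or 0. On ideal
-- sums T_i is simply g̃(u) ↦ g̃(iu), so there the rule depends on `D` alone. That `Θ` intertwines
-- `D` has this reason: the block of x + t in `Θ w` is that of x in w, plus one if x stands among
-- the first t positions of its block. As w increases on blocks, this correction never changes
-- whether b(x) < b(x+1). Rotation also moves the starting point of a cyclically decreasing word;
-- this is harmless because the T_i - 1 of non-adjacent letters commute. Polynomials are tested
-- against arbitrary functionals. Multiplication by h_r then becomes a translation of the
-- functional, and uniqueness is an induction on integer-valued functions of words, without appeal
-- to a basis of Λ^(k).

filterᵇ-All : ∀ {A : Set} {P : A → Set} (p : A → Bool) {xs} → All P xs → All P (List.filterᵇ p xs)
filterᵇ-All p []  = []
filterᵇ-All p {x ∷ xs} (a ∷ as) with p x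
... | true  = a ∷ filterᵇ-All p as
... | false = filterᵇ-All p as

map-All : ∀ {A B : Set} {P : A → Set} {Q : B → Set} (f : A → B) → (∀ x → P x → Q (f x)) → ∀ {xs} → All P xs → All Q (map f xs)
map-All f h as = AllP.map⁺ (All.map (λ {x} → h x) as)

concatMap-All : ∀ {A B : Set} {P : A → Set} {Q : B → Set} (f : A → List B) → (∀ x → P x → All Q (f x)) → ∀ {xs} → All P xs → All Q (concatMap f xs)
concatMap-All f h []       = []
concatMap-All f h (a ∷ as) = AllP.++⁺ (h _ a) (concatMap-All f h as)

-- Linear arithmetic over ℤ, by Fourier–Motzkin elimination.  A form in Vec ℤ (suc m)
-- lists the coefficients of m atoms followed by the constant term.

module LinearArithmetic where

  private
    value : ∀ {m} → Vec ℤ m → Vec ℤ (suc m) → ℤ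
    value []      (c ∷ []) = c
    value (x ∷ ρ) (a ∷ f)  = a *ᶻ x +ᶻ value ρ f

    ev : ∀ {m} → Vec ℤ (suc m) → Vec ℤ m → ℤ
    ev f ρ = value ρ f

    addF : ∀ {m} → Vec ℤ m → Vec ℤ m → Vec ℤ m
    addF = Vec.zipWith _+ᶻ_

    scaleF : ∀ {m} → ℤ → Vec ℤ m → Vec ℤ m
    scaleF c = Vec.map (c *ᶻ_)

    add-step : ∀ a b x u v → (a +ᶻ b) *ᶻ x +ᶻ (u +ᶻ v) ≡ a *ᶻ x +ᶻ u +ᶻ (b *ᶻ x +ᶻ v)
    add-step = ZR.solve-∀

    scale-step : ∀ c a x u → (c *ᶻ a) *ᶻ x +ᶻ c *ᶻ u ≡ c *ᶻ (a *ᶻ x +ᶻ u)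
    scale-step = ZR.solve-∀

    ev-add : ∀ {m} (f g : Vec ℤ (suc m)) ρ → ev (addF f g) ρ ≡ ev f ρ +ᶻ ev g ρ
    ev-add (c ∷ []) (d ∷ []) [] = refl
    ev-add (a ∷ f) (b ∷ g) (x ∷ ρ) =
      trans (cong ((a +ᶻ b) *ᶻ x +ᶻ_) (ev-add f g ρ)) (add-step a b x (ev f ρ) (ev g ρ))

    ev-scale : ∀ {m} c (f : Vec ℤ (suc m)) ρ → ev (scaleF c f) ρ ≡ c *ᶻ ev f ρ
    ev-scale c (d ∷ []) [] = refl
    ev-scale c (a ∷ f) (x ∷ ρ) =
      trans (cong ((c *ᶻ a) *ᶻ x +ᶻ_) (ev-scale c f ρ)) (scale-step c a x (ev f ρ))

    zeroF : ∀ {m} → Vec ℤ m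
    zeroF = Vec.replicate _ (+ 0)

    ev-zero : ∀ {m} (ρ : Vec ℤ m) → ev zeroF ρ ≡ + 0
    ev-zero []      = refl
    ev-zero {suc m} (x ∷ ρ) = trans (ℤP.+-identityˡ _) (ev-zero ρ)

    -- On a nonzero leading coefficient the answer is the zero form, which satisfies both `≡ 0` and
    -- `≥ 0`. So `drop-eq` and `drop-≥` hold for every form, and soundness does not hinge on leading
    -- terms having cancelled.
    dropF : ∀ {m} → Vec ℤ (suc (suc m)) → Vec ℤ (suc m)
    dropF (+ zero ∷ f) = f
    dropF (_      ∷ f) = zeroF

    drop-eq : ∀ {m} (f : Vec ℤ (suc (suc m))) x ρ → ev f (x ∷ ρ) ≡ + 0 → ev (dropF f) ρ ≡ + 0
    drop-eq (+ zero    ∷ f) x ρ e = trans (sym (ℤP.+-identityˡ _)) e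
    drop-eq (+ suc _   ∷ f) x ρ e = ev-zero ρ
    drop-eq (-[1+ _ ]  ∷ f) x ρ e = ev-zero ρ

    drop-≥ : ∀ {m} (f : Vec ℤ (suc (suc m))) x ρ → + 0 ≤ᶻ ev f (x ∷ ρ) → + 0 ≤ᶻ ev (dropF f) ρ
    drop-≥ (+ zero    ∷ f) x ρ e = subst (+ 0 ≤ᶻ_) (ℤP.+-identityˡ _) e
    drop-≥ (+ suc _   ∷ f) x ρ e = ℤP.≤-reflexive (sym (ev-zero ρ))
    drop-≥ (-[1+ _ ]  ∷ f) x ρ e = ℤP.≤-reflexive (sym (ev-zero ρ))

    combF : ∀ {m} → ℕ → ℤ → Vec ℤ m → Vec ℤ m → Vec ℤ m
    combF p q f g = addF (scaleF (+ p) f) (scaleF q g)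

    ev-comb : ∀ {m} p q (f g : Vec ℤ (suc m)) ρ → ev (combF p q f g) ρ ≡ + p *ᶻ ev f ρ +ᶻ q *ᶻ ev g ρ
    ev-comb p q f g ρ = trans (ev-add (scaleF (+ p) f) (scaleF q g) ρ) (cong₂ _+ᶻ_ (ev-scale (+ p) f ρ) (ev-scale q g ρ))

    ≥-scale : ∀ p x → + 0 ≤ᶻ x → + 0 ≤ᶻ + p *ᶻ x
    ≥-scale p x h = subst (_≤ᶻ + p *ᶻ x) (ℤP.*-zeroʳ (+ p)) (ℤP.*-monoˡ-≤-nonNeg (+ p) h)

    Forms : ℕ → Set
    Forms m = List (Vec ℤ (suc m))

    Eqs Ineqs : ∀ {m} → Vec ℤ m → Forms m → Set
    Eqs   ρ = All (λ f → ev f ρ ≡ + 0)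
    Ineqs ρ = All (λ f → + 0 ≤ᶻ ev f ρ)

    -- Chosen so that `∣a∣ * b + multiplier a b * a = 0`. The form being reduced is scaled by
    -- `∣a∣ ≥ 0`, so inequalities keep their direction.
    multiplier : ℤ → ℤ → ℤ
    multiplier (+ _)      b = -ᶻ b
    multiplier -[1+ _ ] b = b

    substF : ∀ {m} → Vec ℤ (suc (suc m)) → Vec ℤ (suc (suc m)) → Vec ℤ (suc m)
    substF e f = dropF (combF ℤ.∣ Vec.head e ∣ (multiplier (Vec.head e) (Vec.head f)) f e)

    pivot : ∀ {m} → Forms (suc m) → Maybe (Vec ℤ (suc (suc m)))
    pivot []                  = nothing
    pivot ((+ zero ∷ _) ∷ fs) = pivot fs
    pivot (f ∷ fs)            = just f

    positive negative : ∀ {m} → Vec ℤ (suc (suc m)) → Bool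
    positive (+ suc _ ∷ _)   = true
    positive _               = false
    negative (-[1+ _ ] ∷ _)  = true
    negative _               = false

    pairF : ∀ {m} → Vec ℤ (suc (suc m)) → Vec ℤ (suc (suc m)) → Vec ℤ (suc m)
    pairF f g = dropF (combF ℤ.∣ Vec.head g ∣ (+ ℤ.∣ Vec.head f ∣) f g)

    eliminate : ∀ {m} → Forms (suc m) → Forms m
    eliminate fs = map dropF (List.filterᵇ (λ f → not (positive f ∨ negative f)) fs)
                ++ concatMap (λ f → map (pairF f) (List.filterᵇ negative fs)) (List.filterᵇ positive fs)

    negᵇ nonzeroᵇ : Vec ℤ 1 → Bool
    negᵇ (-[1+ _ ] ∷ [])  = true
    negᵇ _                = false
    nonzeroᵇ (+ zero ∷ []) = false
    nonzeroᵇ _             = true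

    -- An equation containing the atom eliminates it by substitution; only in the absence of one are
    -- lower and upper bounds paired, which is the step that multiplies the number of inequalities.
    refute : ∀ m → Forms m → Forms m → Bool
    refute zero    es is = any nonzeroᵇ es ∨ any negᵇ is
    refute (suc m) es is with pivot es
    ... | just e  = refute m (map (substF e) es) (map (substF e) is)
    ... | nothing = refute m (map dropF es) (eliminate is)

    any-sound : ∀ {A : Set} (p : A → Bool) xs → T (any p xs) → Any (T ∘ p) xs
    any-sound p (x ∷ xs) t with p x in eq
    ... | true  = here (subst T (sym eq) tt)
    ... | false = there (any-sound p xs t)

    pivot-sound : ∀ {m} (fs : Forms (suc m)) {e} {P : Vec ℤ (suc (suc m)) → Set} → pivot fs ≡ just e → All P fs → P e
    pivot-sound ((+ zero   ∷ _) ∷ fs) q (_ ∷ as) = pivot-sound fs q as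
    pivot-sound ((+ suc _  ∷ _) ∷ fs) refl (a ∷ _) = a
    pivot-sound ((-[1+ _ ] ∷ _) ∷ fs) refl (a ∷ _) = a

    subst-value : ∀ {m} p q (f e : Vec ℤ (suc (suc m))) ρ → ev e ρ ≡ + 0 → ev (combF p q f e) ρ ≡ + p *ᶻ ev f ρ
    subst-value p q f e ρ z =
      trans (ev-comb p q f e ρ) (trans (cong (λ t → + p *ᶻ ev f ρ +ᶻ q *ᶻ t) z)
        (trans (cong (+ p *ᶻ ev f ρ +ᶻ_) (ℤP.*-zeroʳ q)) (ℤP.+-identityʳ _)))

    refute-sound : ∀ m (es is : Forms m) → T (refute m es is) → ∀ ρ → Eqs ρ es → Ineqs ρ is → ⊥
    refute-sound zero es is t [] ae ai with any nonzeroᵇ es in eq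
    ... | true  = lookupE es ae (any-sound nonzeroᵇ es (subst T (sym eq) tt))
      where
      lookupE : ∀ es → Eqs [] es → Any (T ∘ nonzeroᵇ) es → ⊥
      lookupE ((+ zero ∷ []) ∷ _) (_ ∷ _) (here ())
      lookupE ((+ suc _ ∷ []) ∷ _) (() ∷ _) (here _)
      lookupE ((-[1+ _ ] ∷ []) ∷ _) (() ∷ _) (here _)
      lookupE (_ ∷ es) (_ ∷ ae) (there i) = lookupE es ae i
    ... | false = lookupI is ai (any-sound negᵇ is t)
      where
      lookupI : ∀ is → Ineqs [] is → Any (T ∘ negᵇ) is → ⊥
      lookupI ((+ _ ∷ []) ∷ _) (_ ∷ _) (here ())
      lookupI ((-[1+ _ ] ∷ []) ∷ _) (() ∷ _) (here _)
      lookupI (_ ∷ is) (_ ∷ ai) (there i) = lookupI is ai i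
    refute-sound (suc m) es is t (x ∷ ρ) ae ai with pivot es in eq
    ... | just e  = refute-sound m _ _ t ρ
        (map-All (substF e) (λ f h → drop-eq (combF ℤ.∣ Vec.head e ∣ (multiplier (Vec.head e) (Vec.head f)) f e) x ρ
          (trans (subst-value ℤ.∣ Vec.head e ∣ (multiplier (Vec.head e) (Vec.head f)) f e (x ∷ ρ) ze) (trans (cong (+ ℤ.∣ Vec.head e ∣ *ᶻ_) h) (ℤP.*-zeroʳ (+ ℤ.∣ Vec.head e ∣))))) ae)
        (map-All (substF e) (λ f h → drop-≥ (combF ℤ.∣ Vec.head e ∣ (multiplier (Vec.head e) (Vec.head f)) f e) x ρ
          (subst (+ 0 ≤ᶻ_) (sym (subst-value ℤ.∣ Vec.head e ∣ (multiplier (Vec.head e) (Vec.head f)) f e (x ∷ ρ) ze)) (≥-scale ℤ.∣ Vec.head e ∣ _ h))) ai)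
      where
      ze = pivot-sound es {P = λ f → ev f (x ∷ ρ) ≡ + 0} eq ae
    ... | nothing = refute-sound m _ _ t ρ
        (map-All dropF (λ f → drop-eq f x ρ) ae)
        (AllP.++⁺ (map-All dropF (λ f → drop-≥ f x ρ) (filterᵇ-All _ ai))
          (concatMap-All _ (λ f hf → map-All (pairF f) (λ g hg → drop-≥ (combF ℤ.∣ Vec.head g ∣ (+ ℤ.∣ Vec.head f ∣) f g) x ρ
            (subst (+ 0 ≤ᶻ_) (sym (ev-comb ℤ.∣ Vec.head g ∣ (+ ℤ.∣ Vec.head f ∣) f g (x ∷ ρ)))
              (ℤP.+-mono-≤ (≥-scale ℤ.∣ Vec.head g ∣ _ hf) (≥-scale ℤ.∣ Vec.head f ∣ _ hg)))) (filterᵇ-All negative ai)) (filterᵇ-All positive ai)))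

  infixl 6 _⊞_ _⊟_
  infix 4 _≼_ _≺_ _≐_

  data Exp : Set where
    #_      : ℕ → Exp
    atom    : ℕ → Exp
    _⊞_ _⊟_ : Exp → Exp → Exp

  pattern α = atom 0
  pattern β = atom 1
  pattern γ = atom 2
  pattern ζ = atom 3
  pattern η = atom 4
  pattern θ = atom 5
  pattern ξ = atom 6
  pattern ω = atom 7

  data Rel : Set where
    _≼_ _≺_ _≐_ : Exp → Exp → Rel
    ff          : Rel

  private
    at : ∀ {m} → Vec ℤ m → ℕ → ℤ
    at []      _       = + 0
    at (x ∷ ρ) zero    = x
    at (x ∷ ρ) (suc i) = at ρ i

    ⟦_⟧ₑ : ∀ {m} → Exp → Vec ℤ m → ℤ
    ⟦ # c ⟧ₑ    ρ = + c
    ⟦ atom i ⟧ₑ ρ = at ρ i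
    ⟦ e ⊞ f ⟧ₑ  ρ = ⟦ e ⟧ₑ ρ +ᶻ ⟦ f ⟧ₑ ρ
    ⟦ e ⊟ f ⟧ₑ  ρ = ⟦ e ⟧ₑ ρ -ᶻ ⟦ f ⟧ₑ ρ

    ⟦_⟧ : ∀ {m} → Rel → Vec ℤ m → Set
    ⟦ e ≼ f ⟧ ρ = ⟦ e ⟧ₑ ρ ≤ᶻ ⟦ f ⟧ₑ ρ
    ⟦ e ≺ f ⟧ ρ = ⟦ e ⟧ₑ ρ <ᶻ ⟦ f ⟧ₑ ρ
    ⟦ e ≐ f ⟧ ρ = ⟦ e ⟧ₑ ρ ≡ ⟦ f ⟧ₑ ρ
    ⟦ ff ⟧    ρ = ⊥

    ⟦_⊢_⟧ : ∀ {m} → List Rel → Rel → Vec ℤ m → Set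
    ⟦ []     ⊢ g ⟧ ρ = ⟦ g ⟧ ρ
    ⟦ r ∷ rs ⊢ g ⟧ ρ = ⟦ r ⟧ ρ → ⟦ rs ⊢ g ⟧ ρ

    constF : ∀ m → ℤ → Vec ℤ (suc m)
    constF zero    c = c ∷ []
    constF (suc m) c = + 0 ∷ constF m c

    unitF : ∀ m → ℕ → Vec ℤ (suc m)
    unitF zero    _       = + 0 ∷ []
    unitF (suc m) zero    = + 1 ∷ zeroF
    unitF (suc m) (suc i) = + 0 ∷ unitF m i

    form : ∀ m → Exp → Vec ℤ (suc m)
    form m (# c)    = constF m (+ c)
    form m (atom i) = unitF m i
    form m (e ⊞ f)  = addF (form m e) (form m f)
    form m (e ⊟ f)  = addF (form m e) (scaleF (-ᶻ (+ 1)) (form m f))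

    ev-const : ∀ m c (ρ : Vec ℤ m) → ev (constF m c) ρ ≡ c
    ev-const zero    c []      = refl
    ev-const (suc m) c (x ∷ ρ) = trans (ℤP.+-identityˡ _) (ev-const m c ρ)

    ev-unit : ∀ m i (ρ : Vec ℤ m) → ev (unitF m i) ρ ≡ at ρ i
    ev-unit zero    i       []      = refl
    ev-unit (suc m) zero    (x ∷ ρ) = trans (cong₂ _+ᶻ_ (ℤP.*-identityˡ x) (ev-zero ρ)) (ℤP.+-identityʳ x)
    ev-unit (suc m) (suc i) (x ∷ ρ) = trans (ℤP.+-identityˡ _) (ev-unit m i ρ)

    ev-form : ∀ {m} e (ρ : Vec ℤ m) → ev (form m e) ρ ≡ ⟦ e ⟧ₑ ρ
    ev-form (# c)    ρ = ev-const _ (+ c) ρ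
    ev-form (atom i) ρ = ev-unit _ i ρ
    ev-form (e ⊞ f)  ρ = trans (ev-add (form _ e) _ ρ) (cong₂ _+ᶻ_ (ev-form e ρ) (ev-form f ρ))
    ev-form (e ⊟ f)  ρ = trans (ev-add (form _ e) _ ρ)
      (cong₂ _+ᶻ_ (ev-form e ρ) (trans (ev-scale (-ᶻ (+ 1)) (form _ f) ρ)
        (trans (ℤP.-1*i≡-i _) (cong -ᶻ_ (ev-form f ρ)))))

    equations inequalities : ∀ m → List Rel → Forms m
    equations m []             = []
    equations m ((e ≐ f) ∷ rs) = form m (e ⊟ f) ∷ equations m rs
    equations m (_ ∷ rs)       = equations m rs
    inequalities m []             = []
    inequalities m ((e ≼ f) ∷ rs) = form m (f ⊟ e) ∷ inequalities m rs
    inequalities m ((e ≺ f) ∷ rs) = form m (f ⊟ (e ⊞ # 1)) ∷ inequalities m rs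
    inequalities m (ff ∷ rs)      = form m (# 0 ⊟ # 1) ∷ inequalities m rs
    inequalities m (_ ∷ rs)       = inequalities m rs

    inconsistent : ∀ m → List Rel → Bool
    inconsistent m rs = refute m (equations m rs) (inequalities m rs)

    -- Goals are proved by refuting their negations, an equation having two strict inequalities as
    -- its negation. A strict inequality enters as `e + 1 ≤ f`, which makes the procedure sharper
    -- over ℤ than over ℚ.
    provable : ∀ m → List Rel → Rel → Bool
    provable m rs (e ≼ f) = inconsistent m ((f ≺ e) ∷ rs)
    provable m rs (e ≺ f) = inconsistent m ((f ≼ e) ∷ rs)
    provable m rs (e ≐ f) = inconsistent m ((e ≺ f) ∷ rs) ∧ inconsistent m ((f ≺ e) ∷ rs)
    provable m rs ff      = inconsistent m rs

    0≤i-j : ∀ {i j} → j ≤ᶻ i → + 0 ≤ᶻ i -ᶻ j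
    0≤i-j = ℤP.i≤j⇒0≤j-i

    equations-hold : ∀ {m} rs (ρ : Vec ℤ m) → All (λ r → ⟦ r ⟧ ρ) rs → Eqs ρ (equations m rs)
    equations-hold []             ρ []       = []
    equations-hold ((e ≐ f) ∷ rs) ρ (a ∷ as) = trans (ev-form (e ⊟ f) ρ) (ℤP.i≡j⇒i-j≡0 a) ∷ equations-hold rs ρ as
    equations-hold ((e ≼ f) ∷ rs) ρ (a ∷ as) = equations-hold rs ρ as
    equations-hold ((e ≺ f) ∷ rs) ρ (a ∷ as) = equations-hold rs ρ as
    equations-hold (ff ∷ rs)      ρ (() ∷ as)

    inequalities-hold : ∀ {m} rs (ρ : Vec ℤ m) → All (λ r → ⟦ r ⟧ ρ) rs → Ineqs ρ (inequalities m rs)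
    inequalities-hold []             ρ []       = []
    inequalities-hold ((e ≐ f) ∷ rs) ρ (a ∷ as) = inequalities-hold rs ρ as
    inequalities-hold ((e ≼ f) ∷ rs) ρ (a ∷ as) = subst (+ 0 ≤ᶻ_) (sym (ev-form (f ⊟ e) ρ)) (0≤i-j a) ∷ inequalities-hold rs ρ as
    inequalities-hold ((e ≺ f) ∷ rs) ρ (a ∷ as) = subst (+ 0 ≤ᶻ_) (sym (ev-form (f ⊟ (e ⊞ # 1)) ρ))
      (0≤i-j (subst (_≤ᶻ ⟦ f ⟧ₑ ρ) (ℤP.+-comm (+ 1) (⟦ e ⟧ₑ ρ)) (ℤP.i<j⇒suc[i]≤j a))) ∷ inequalities-hold rs ρ as
    inequalities-hold (ff ∷ rs)      ρ (() ∷ as)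

    inconsistent-sound : ∀ {m} rs (ρ : Vec ℤ m) → T (inconsistent m rs) → All (λ r → ⟦ r ⟧ ρ) rs → ⊥
    inconsistent-sound rs ρ t as = refute-sound _ _ _ t ρ (equations-hold rs ρ as) (inequalities-hold rs ρ as)

    ∧-left : ∀ a b → T (a ∧ b) → T a
    ∧-left true _ _ = tt

    ∧-right : ∀ a b → T (a ∧ b) → T b
    ∧-right true _ t = t

    provable-sound : ∀ {m} rs g (ρ : Vec ℤ m) → T (provable m rs g) → All (λ r → ⟦ r ⟧ ρ) rs → ⟦ g ⟧ ρ
    provable-sound rs (e ≼ f) ρ t as = ℤP.≮⇒≥ λ lt → inconsistent-sound ((f ≺ e) ∷ rs) ρ t (lt ∷ as)
    provable-sound rs (e ≺ f) ρ t as = ℤP.≰⇒> λ le → inconsistent-sound ((f ≼ e) ∷ rs) ρ t (le ∷ as)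
    provable-sound {m} rs (e ≐ f) ρ t as with ℤP.<-cmp (⟦ e ⟧ₑ ρ) (⟦ f ⟧ₑ ρ)
    ... | tri< lt _ _ = ⊥-elim (inconsistent-sound ((e ≺ f) ∷ rs) ρ (∧-left (inconsistent m ((e ≺ f) ∷ rs)) (inconsistent m ((f ≺ e) ∷ rs)) t) (lt ∷ as))
    ... | tri≈ _ q _  = q
    ... | tri> _ _ gt = ⊥-elim (inconsistent-sound ((f ≺ e) ∷ rs) ρ (∧-right (inconsistent m ((e ≺ f) ∷ rs)) (inconsistent m ((f ≺ e) ∷ rs)) t) (gt ∷ as))
    provable-sound rs ff      ρ t as = inconsistent-sound rs ρ t as

    curryAll : ∀ {m} rs {g} (ρ : Vec ℤ m) → (All (λ r → ⟦ r ⟧ ρ) rs → ⟦ g ⟧ ρ) → ⟦ rs ⊢ g ⟧ ρ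
    curryAll []       ρ h   = h []
    curryAll (r ∷ rs) ρ h a = curryAll rs ρ (λ as → h (a ∷ as))

  -- The atoms α, β, γ, … stand for the entries of ρ in this order.
  lin : ∀ {m} (ρ : Vec ℤ m) rs g {_ : T (provable m rs g)} → ⟦ rs ⊢ g ⟧ ρ
  lin ρ rs g {t} = curryAll rs ρ (provable-sound rs g ρ t)

open LinearArithmetic public

module _ (k : ℕ) (1≤k : 1 ≤ k) where

  -- Residues modulo n and the action of a letter

  N : ℤ
  N = + suc k

  1<N : + 1 <ᶻ N
  1<N = ℤ.+<+ (s≤s 1≤k)

  infixl 7 _∙N

  opaque
    -- Opaque, so that multiples of n are rigid atoms; what `lin` has to know about them (`N-add`,
    -- `N-one`, `N-gap`) is passed as hypotheses.
    _∙N : ℤ → ℤ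
    l ∙N = l *ᶻ N

    N-add : ∀ l m → (l +ᶻ m) ∙N ≡ l ∙N +ᶻ m ∙N
    N-add l m = ℤP.*-distribʳ-+ N l m

    N-one : + 1 ∙N ≡ N
    N-one = ℤP.*-identityˡ N

    N-zero : + 0 ∙N ≡ + 0
    N-zero = refl

    N-sub : ∀ l m → (l -ᶻ m) ∙N ≡ l ∙N -ᶻ m ∙N
    N-sub l m = trans (N-add l (-ᶻ m)) (cong (l ∙N +ᶻ_) (sym (ℤP.neg-distribˡ-* m N)))

    N-mono : ∀ {l m} → l ≤ᶻ m → l ∙N ≤ᶻ m ∙N
    N-mono = ℤP.*-monoʳ-≤-nonNeg N

  N-suc : ∀ l → (l +ᶻ + 1) ∙N ≡ l ∙N +ᶻ N
  N-suc l = trans (N-add l (+ 1)) (cong (l ∙N +ᶻ_) N-one)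

  N-gap : ∀ {l m} → l <ᶻ m → l ∙N +ᶻ N ≤ᶻ m ∙N
  N-gap {l} {m} l<m = subst (_≤ᶻ m ∙N) (N-suc l) (N-mono (lin (l ∷ m ∷ []) ((α ≺ β) ∷ []) (α ⊞ # 1 ≼ β) l<m))

  division-unique : ∀ {a b l m} → + 0 ≤ᶻ a → a <ᶻ N → + 0 ≤ᶻ b → b <ᶻ N →
                    a +ᶻ l ∙N ≡ b +ᶻ m ∙N → l ≡ m
  division-unique {a} {b} {l} {m} a₀ a₁ b₀ b₁ eq with ℤP.<-cmp l m
  ... | tri≈ _ q _ = q
  ... | tri< l<m _ _ = ⊥-elim (lin (a ∷ b ∷ l ∙N ∷ m ∙N ∷ N ∷ [])
          ((# 0 ≼ β) ∷ (α ≺ η) ∷ (α ⊞ γ ≐ β ⊞ ζ) ∷ (γ ⊞ η ≼ ζ) ∷ []) ff b₀ a₁ eq (N-gap l<m))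
  ... | tri> _ _ m<l = ⊥-elim (lin (a ∷ b ∷ l ∙N ∷ m ∙N ∷ N ∷ [])
          ((# 0 ≼ α) ∷ (β ≺ η) ∷ (α ⊞ γ ≐ β ⊞ ζ) ∷ (ζ ⊞ η ≼ γ) ∷ []) ff a₀ b₁ eq (N-gap m<l))

  opaque
    unfolding _∙N

    rem : ℤ → ℕ
    rem x = x %ℕ suc k

    quo : ℤ → ℤ
    quo x = x /ℕ suc k

    rem-quo : ∀ x → x ≡ + rem x +ᶻ quo x ∙N
    rem-quo x = a≡a%ℕn+[a/ℕn]*n x (suc k)

    rem<n : ∀ x → rem x < suc k
    rem<n x = n%ℕd<d x (suc k)

  rem<N : ∀ x → + rem x <ᶻ N
  rem<N x = ℤ.+<+ (rem<n x)

  0≤+ : ∀ n → + 0 ≤ᶻ + n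
  0≤+ n = +≤+ z≤n

  rem-unique : ∀ {x r q} → r < suc k → x ≡ + r +ᶻ q ∙N → rem x ≡ r
  rem-unique {x} {r} {q} r<n eq = ℤP.+-injective (lin (+ rem x ∷ + r ∷ quo x ∙N ∷ []) ((α ⊞ γ ≐ β ⊞ γ) ∷ []) (α ≐ β)
    (trans (sym (rem-quo x)) (trans eq (cong (λ t → + r +ᶻ t ∙N) (sym same)))))
    where
    same : quo x ≡ q
    same = division-unique (0≤+ _) (rem<N x) (0≤+ r) (ℤ.+<+ r<n) (trans (sym (rem-quo x)) eq)

  rem-shift : ∀ x l → rem (x +ᶻ l ∙N) ≡ rem x
  rem-shift x l = rem-unique (rem<n x) (trans (cong (_+ᶻ l ∙N) (rem-quo x))
    (trans (ℤP.+-assoc (+ rem x) (quo x ∙N) (l ∙N)) (cong (+ rem x +ᶻ_) (sym (N-add (quo x) l)))))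

  infix 4 _∼_
  record _∼_ (y x : ℤ) : Set where
    constructor _,_
    field
      turns : ℤ
      equal : y ≡ x +ᶻ turns ∙N

  rem-cong : ∀ {x y} → rem y ≡ rem x → y ∼ x
  rem-cong {x} {y} e = quo y -ᶻ quo x , lin (x ∷ y ∷ + rem x ∷ + rem y ∷ quo x ∙N ∷ quo y ∙N ∷ (quo y -ᶻ quo x) ∙N ∷ [])
      ((α ≐ γ ⊞ η) ∷ (β ≐ ζ ⊞ θ) ∷ (ζ ≐ γ) ∷ (ξ ≐ θ ⊟ η) ∷ []) (β ≐ α ⊞ ξ)
      (rem-quo x) (rem-quo y) (cong +_ e) (N-sub (quo y) (quo x))

  rem-+1 : ∀ x → rem (x +ᶻ + 1) ≡ suc (rem x) ℕ.% suc k
  rem-+1 x with ℕP.m≤n⇒m<n∨m≡n (rem<n x)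
  ... | inj₁ lt = trans (rem-unique {q = quo x} lt
          (lin (x ∷ + rem x ∷ quo x ∙N ∷ []) ((α ≐ β ⊞ γ) ∷ []) (α ⊞ # 1 ≐ # 1 ⊞ β ⊞ γ) (rem-quo x)))
        (sym (m<n⇒m%n≡m lt))
  ... | inj₂ eq = trans (rem-unique {q = quo x +ᶻ + 1} (s≤s z≤n)
          (lin (x ∷ + rem x ∷ quo x ∙N ∷ N ∷ (quo x +ᶻ + 1) ∙N ∷ []) ((α ≐ β ⊞ γ) ∷ (# 1 ⊞ β ≐ ζ) ∷ (η ≐ γ ⊞ ζ) ∷ []) (α ⊞ # 1 ≐ # 0 ⊞ η)
            (rem-quo x) (cong +_ eq) (N-suc (quo x))))
        (sym (trans (cong (ℕ._% suc k) eq) (n%n≡0 (suc k))))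

  ∼⇒rem : ∀ {x y} → y ∼ x → rem y ≡ rem x
  ∼⇒rem {x} (l , refl) = rem-shift x l

  ∼-sym : ∀ {x y} → y ∼ x → x ∼ y
  ∼-sym p = rem-cong (sym (∼⇒rem p))

  ∼-trans : ∀ {x y z} → x ∼ y → y ∼ z → x ∼ z
  ∼-trans p q = rem-cong (trans (∼⇒rem p) (∼⇒rem q))

  ∼-+ : ∀ {x y} c → y ∼ x → y +ᶻ c ∼ x +ᶻ c
  ∼-+ {x} c (l , refl) = l , lin (x ∷ c ∷ l ∙N ∷ []) [] (α ⊞ γ ⊞ β ≐ α ⊞ β ⊞ γ)

  ∼-refl : ∀ {x} → x ∼ x
  ∼-refl = rem-cong refl

  _∼?_ : ∀ y x → Dec (y ∼ x)
  y ∼? x with rem y ℕ.≟ rem x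
  ... | yes e = yes (rem-cong e)
  ... | no ne = no (λ p → ne (∼⇒rem p))

  +1≁ : ∀ x → ¬ (x +ᶻ + 1 ∼ x)
  +1≁ x (l , e) = absurd (ℤP.<-cmp l (+ 0))
    where
    absurd : _ → ⊥
    absurd (tri< l<0 _ _) = lin (x ∷ l ∙N ∷ N ∷ + 0 ∙N ∷ []) ((α ⊞ # 1 ≐ α ⊞ β) ∷ (β ⊞ γ ≼ ζ) ∷ (# 1 ≺ γ) ∷ (ζ ≐ # 0) ∷ []) ff e (N-gap l<0) 1<N N-zero
    absurd (tri≈ _ l≡0 _) = lin (x ∷ l ∙N ∷ []) ((α ⊞ # 1 ≐ α ⊞ β) ∷ (β ≐ # 0) ∷ []) ff e (trans (cong _∙N l≡0) N-zero)
    absurd (tri> _ _ 0<l) = lin (x ∷ l ∙N ∷ N ∷ + 0 ∙N ∷ []) ((α ⊞ # 1 ≐ α ⊞ β) ∷ (ζ ⊞ γ ≼ β) ∷ (# 1 ≺ γ) ∷ (ζ ≐ # 0) ∷ []) ff e (N-gap 0<l) 1<N N-zero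

  ∼-+-cancel : ∀ {x y} c → y +ᶻ c ∼ x +ᶻ c → y ∼ x
  ∼-+-cancel {x} {y} c (l , e) = l , lin (x ∷ y ∷ c ∷ l ∙N ∷ []) ((β ⊞ γ ≐ α ⊞ γ ⊞ ζ) ∷ []) (β ≐ α ⊞ ζ) e

  fin : ℤ → Fin (suc k)
  fin x = (x %ℕ suc k) mod suc k

  opaque
    unfolding rem

    toℕ-fin : ∀ x → toℕ (fin x) ≡ rem x
    toℕ-fin x = trans (FinP.toℕ-fromℕ< _) (m<n⇒m%n≡m (rem<n x))

    rem-small : ∀ {m} → m < suc k → rem (+ m) ≡ m
    rem-small = m<n⇒m%n≡m

  fin-cong : ∀ {x y} → x ∼ y → fin x ≡ fin y
  fin-cong p = FinP.toℕ-injective (trans (toℕ-fin _) (trans (∼⇒rem p) (sym (toℕ-fin _))))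

  fin-inj : ∀ {x y} → fin x ≡ fin y → x ∼ y
  fin-inj {x} {y} e = rem-cong (trans (sym (toℕ-fin x)) (trans (cong toℕ e) (toℕ-fin y)))

  ι : Fin (suc k) → ℤ
  ι i = + toℕ i

  fin-ι : ∀ i → fin (ι i) ≡ i
  fin-ι i = FinP.toℕ-injective (trans (toℕ-fin (ι i)) (rem-small (FinP.toℕ<n i)))

  ι-fin : ∀ x → ι (fin x) ∼ x
  ι-fin x = fin-inj (fin-ι (fin x))

  opaque
    -- Letters are indexed by integers rather than residues: the classes exchanged are those of x
    -- and x + 1 with no special case for the wrap from k to 0, and letters can be translated
    -- (`s-translate`).
    s : ℤ → ℤ → ℤ
    s x = sAct (fin x)

    s-def : ∀ x m → sAct (fin x) m ≡ s x m
    s-def x m = refl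

  data View (x m : ℤ) : Set where
    up   : ∀ l → m ≡ x +ᶻ l ∙N → s x m ≡ m +ᶻ + 1 → View x m
    down : ∀ l → m ≡ x +ᶻ + 1 +ᶻ l ∙N → s x m ≡ m -ᶻ + 1 → View x m
    stay : ¬ (m ∼ x) → ¬ (m ∼ x +ᶻ + 1) → s x m ≡ m → View x m

  ≡ᵇ-true : ∀ {m n} → m ≡ n → (m ≡ᵇ n) ≡ true
  ≡ᵇ-true {m} refl with m ≡ᵇ m | ℕP.≡⇒≡ᵇ m m refl
  ... | true | _ = refl

  ≡ᵇ-false : ∀ {m n} → m ≢ n → (m ≡ᵇ n) ≡ false
  ≡ᵇ-false {m} {n} ne with m ≡ᵇ n | ℕP.≡ᵇ⇒≡ m n
  ... | true  | h = ⊥-elim (ne (h tt))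
  ... | false | _ = refl

  next-class : ∀ x → suc (toℕ (fin x)) ℕ.% suc k ≡ rem (x +ᶻ + 1)
  next-class x = trans (cong (λ t → suc t ℕ.% suc k) (toℕ-fin x)) (sym (rem-+1 x))

  opaque
    unfolding rem s

    private
      s-then : ∀ x m → rem m ≡ rem x → s x m ≡ m +ᶻ + 1
      s-then x m e rewrite ≡ᵇ-true {rem m} {toℕ (fin x)} (trans e (sym (toℕ-fin x))) = refl

      s-else : ∀ x m → rem m ≢ rem x → s x m ≡ (if rem m ≡ᵇ suc (toℕ (fin x)) ℕ.% suc k then m -ᶻ + 1 else m)
      s-else x m ne rewrite ≡ᵇ-false {rem m} {toℕ (fin x)} (λ q → ne (trans q (toℕ-fin x))) = refl

      if-true : ∀ {a b : ℤ} {m n} → m ≡ n → (if m ≡ᵇ n then a else b) ≡ a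
      if-true {a} {b} {m} {n} e = cong (λ t → if t then a else b) (≡ᵇ-true {m} {n} e)

      if-false : ∀ {a b : ℤ} {m n} → m ≢ n → (if m ≡ᵇ n then a else b) ≡ b
      if-false {a} {b} {m} {n} e = cong (λ t → if t then a else b) (≡ᵇ-false {m} {n} e)

  view : ∀ x m → View x m
  view x m with m ∼? x
  ... | yes p@(l , e) = up l e (s-then x m (∼⇒rem p))
  ... | no ≁x with m ∼? (x +ᶻ + 1)
  ...   | yes p@(l , e) = down l e (trans (s-else x m (≁x ∘ rem-cong)) (if-true (trans (∼⇒rem p) (sym (next-class x)))))
  ...   | no ≁x+1 = stay ≁x ≁x+1 (trans (s-else x m (≁x ∘ rem-cong)) (if-false (λ q → ≁x+1 (rem-cong (trans q (next-class x))))))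

  s-up : ∀ x m → m ∼ x → s x m ≡ m +ᶻ + 1
  s-up x m p with view x m
  ... | up _ _ e = e
  ... | down l e _ = ⊥-elim (+1≁ x (∼-trans (∼-sym (l , e)) p))
  ... | stay n _ _ = ⊥-elim (n p)

  s-down : ∀ x m → m ∼ x +ᶻ + 1 → s x m ≡ m -ᶻ + 1
  s-down x m p with view x m
  ... | up l e _ = ⊥-elim (+1≁ x (∼-trans (∼-sym p) (l , e)))
  ... | down _ _ e = e
  ... | stay _ n _ = ⊥-elim (n p)

  s-stay : ∀ x m → ¬ (m ∼ x) → ¬ (m ∼ x +ᶻ + 1) → s x m ≡ m
  s-stay x m n₁ n₂ with view x m
  ... | up l e _ = ⊥-elim (n₁ (l , e))
  ... | down l e _ = ⊥-elim (n₂ (l , e))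
  ... | stay _ _ e = e

  s-shift : ∀ x m l → s x (m +ᶻ l ∙N) ≡ s x m +ᶻ l ∙N
  s-shift x m l with view x m
  ... | up l′ e q = trans (s-up x _ (∼-trans (l , refl) (l′ , e)))
          (lin (m ∷ l ∙N ∷ s x m ∷ []) ((γ ≐ α ⊞ # 1) ∷ []) (α ⊞ β ⊞ # 1 ≐ γ ⊞ β) q)
  ... | down l′ e q = trans (s-down x _ (∼-trans (l , refl) (l′ , e)))
          (lin (m ∷ l ∙N ∷ s x m ∷ []) ((γ ≐ α ⊟ # 1) ∷ []) (α ⊞ β ⊟ # 1 ≐ γ ⊞ β) q)
  ... | stay n₁ n₂ q = trans (s-stay x _ (λ p → n₁ (∼-trans (∼-sym (l , refl)) p)) (λ p → n₂ (∼-trans (∼-sym (l , refl)) p)))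
          (cong (_+ᶻ l ∙N) (sym q))

  s-involutive : ∀ x m → s x (s x m) ≡ m
  s-involutive x m with view x m
  ... | up l refl q = trans (cong (s x) q) (trans (s-down x _ (∼-+ {x} {x +ᶻ l ∙N} (+ 1) (l , refl)))
          (lin (x +ᶻ l ∙N ∷ []) [] (α ⊞ # 1 ⊟ # 1 ≐ α)))
  ... | down l e q = trans (cong (s x) q) (trans (s-up x _ (∼-+-cancel (+ 1) (l , lin (x ∷ m ∷ l ∙N ∷ []) ((β ≐ α ⊞ # 1 ⊞ γ) ∷ []) (β ⊟ # 1 ⊞ # 1 ≐ α ⊞ # 1 ⊞ γ) e)))
          (lin (m ∷ []) [] (α ⊟ # 1 ⊞ # 1 ≐ α)))
  ... | stay _ _ q = trans (cong (s x) q) q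

  s-injective : ∀ x {a b} → s x a ≡ s x b → a ≡ b
  s-injective x {a} {b} e = trans (sym (s-involutive x a)) (trans (cong (s x) e) (s-involutive x b))

  s-≤ : ∀ x m → s x m ≤ᶻ m +ᶻ + 1
  s-≤ x m with view x m
  ... | up _ _ q   = ℤP.≤-reflexive q
  ... | down _ _ q = lin (m ∷ s x m ∷ []) ((β ≐ α ⊟ # 1) ∷ []) (β ≼ α ⊞ # 1) q
  ... | stay _ _ q = lin (m ∷ s x m ∷ []) ((β ≐ α) ∷ []) (β ≼ α ⊞ # 1) q

  s-≥ : ∀ x m → m ≤ᶻ s x m +ᶻ + 1
  s-≥ x m with view x m
  ... | up _ _ q   = lin (m ∷ s x m ∷ []) ((β ≐ α ⊞ # 1) ∷ []) (α ≼ β ⊞ # 1) q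
  ... | down _ _ q = lin (m ∷ s x m ∷ []) ((β ≐ α ⊟ # 1) ∷ []) (α ≼ β ⊞ # 1) q
  ... | stay _ _ q = lin (m ∷ s x m ∷ []) ((β ≐ α) ∷ []) (α ≼ β ⊞ # 1) q

  -- Each integer moves by at most one, so only neighbours `a`, `a + 1` can lose their order, and
  -- only if the letter exchanges their two classes. All length and order arguments below rest on
  -- this.
  s-monotone : ∀ x {a b} → a <ᶻ b → s x a <ᶻ s x b ⊎ (a ∼ x × b ≡ a +ᶻ + 1)
  s-monotone x {a} {b} a<b with b ℤ.≟ a +ᶻ + 1
  ... | no ne = inj₁ (ℤP.≤∧≢⇒<
          (lin (a ∷ b ∷ s x a ∷ s x b ∷ []) ((α ⊞ # 1 ≺ β) ∷ (γ ≼ α ⊞ # 1) ∷ (β ≼ ζ ⊞ # 1) ∷ []) (γ ≼ ζ)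
            (ℤP.≤∧≢⇒< (lin (a ∷ b ∷ []) ((α ≺ β) ∷ []) (α ⊞ # 1 ≼ β) a<b) (ne ∘ sym)) (s-≤ x a) (s-≥ x b))
          (λ e → ℤP.<⇒≢ a<b (s-injective x e)))
  ... | yes refl with view x a | view x (a +ᶻ + 1)
  ...   | up l e _    | _ = inj₂ ((l , e) , refl)
  ...   | _           | down l e _ = inj₂ (∼-+-cancel (+ 1) (l , e) , refl)
  ...   | down _ _ q  | up _ _ r = inj₁ (lin (a ∷ s x a ∷ s x (a +ᶻ + 1) ∷ []) ((β ≐ α ⊟ # 1) ∷ (γ ≐ α ⊞ # 1 ⊞ # 1) ∷ []) (β ≺ γ) q r)
  ...   | down _ _ q  | stay _ _ r = inj₁ (lin (a ∷ s x a ∷ s x (a +ᶻ + 1) ∷ []) ((β ≐ α ⊟ # 1) ∷ (γ ≐ α ⊞ # 1) ∷ []) (β ≺ γ) q r)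
  ...   | stay _ _ q  | up _ _ r = inj₁ (lin (a ∷ s x a ∷ s x (a +ᶻ + 1) ∷ []) ((β ≐ α) ∷ (γ ≐ α ⊞ # 1 ⊞ # 1) ∷ []) (β ≺ γ) q r)
  ...   | stay _ _ q  | stay _ _ r = inj₁ (lin (a ∷ s x a ∷ s x (a +ᶻ + 1) ∷ []) ((β ≐ α) ∷ (γ ≐ α ⊞ # 1) ∷ []) (β ≺ γ) q r)

  -- The action of words and the length

  act-∷ : ∀ i (u : Word k) x → act (i ∷ u) x ≡ s (ι i) (act u x)
  act-∷ i u x = trans (cong (λ j → sAct j (act u x)) (sym (fin-ι i))) (s-def (ι i) (act u x))

  act-fin : ∀ y (u : Word k) x → act (fin y ∷ u) x ≡ s y (act u x)
  act-fin y u x = s-def y (act u x)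

  act-++ : ∀ (u v : Word k) x → act (u ++ v) x ≡ act u (act v x)
  act-++ []      v x = refl
  act-++ (i ∷ u) v x = cong (sAct i) (act-++ u v x)

  act-shift : ∀ (u : Word k) x l → act u (x +ᶻ l ∙N) ≡ act u x +ᶻ l ∙N
  act-shift []      x l = refl
  act-shift (i ∷ u) x l = trans (act-∷ i u _) (trans (cong (s (ι i)) (act-shift u x l))
    (trans (s-shift (ι i) (act u x) l) (cong (_+ᶻ l ∙N) (sym (act-∷ i u x)))))

  inv : Word k → ℤ → ℤ
  inv u = act (reverse u)

  inv-∷ : ∀ i (u : Word k) x → inv (i ∷ u) x ≡ inv u (s (ι i) x)
  inv-∷ i u x = trans (cong (λ w → act w x) (ListP.unfold-reverse i u))
    (trans (act-++ (reverse u) (i ∷ []) x) (cong (inv u) (act-∷ i [] x)))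

  inv-fin : ∀ y (u : Word k) x → inv (fin y ∷ u) x ≡ inv u (s y x)
  inv-fin y u x = trans (cong (λ w → act w x) (ListP.unfold-reverse (fin y) u))
    (trans (act-++ (reverse u) (fin y ∷ []) x) (cong (inv u) (act-fin y [] x)))

  inv-act : ∀ (u : Word k) x → inv u (act u x) ≡ x
  inv-act []      x = refl
  inv-act (i ∷ u) x = trans (inv-∷ i u _) (trans (cong (inv u ∘ s (ι i)) (act-∷ i u x))
    (trans (cong (inv u) (s-involutive (ι i) _)) (inv-act u x)))

  act-inv : ∀ (u : Word k) x → act u (inv u x) ≡ x
  act-inv u x = trans (cong (λ w → act w (inv u x)) (sym (ListP.reverse-involutive u))) (inv-act (reverse u) x)

  act-injective : ∀ (u : Word k) {x y} → act u x ≡ act u y → x ≡ y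
  act-injective u {x} {y} e = trans (sym (inv-act u x)) (trans (cong (inv u) e) (inv-act u y))

  inv-shift : ∀ (u : Word k) x l → inv u (x +ᶻ l ∙N) ≡ inv u x +ᶻ l ∙N
  inv-shift u = act-shift (reverse u)

  infix 4 _≈W_
  _≈W_ : Word k → Word k → Set
  u ≈W v = ∀ x → act u x ≡ act v x

  ≡W⇒≈W : ∀ {u v : Word k} → u ≡W v → u ≈W v
  ≡W⇒≈W {u} {v} e x = trans (cong (act u) split) (trans (act-shift u _ _)
    (trans (cong (_+ᶻ quo y ∙N) (trans (cong (λ t → act u (+ suc t)) (sym toℕ-i)) (trans entry (cong (λ t → act v (+ suc t)) toℕ-i))))
      (trans (sym (act-shift v _ _)) (cong (act v) (sym split)))))
    where
    -- Windows list the positions 1, ..., n while remainders run over 0, ..., k.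
    y = x -ᶻ + 1
    i = fromℕ< (rem<n y)
    entry : act u (+ suc (toℕ i)) ≡ act v (+ suc (toℕ i))
    entry = trans (sym (VecP.lookup∘tabulate (λ p → act u (+ suc (toℕ p))) i)) (trans (cong (λ w → Vec.lookup w i) e) (VecP.lookup∘tabulate (λ p → act v (+ suc (toℕ p))) i))
    toℕ-i : toℕ i ≡ rem y
    toℕ-i = FinP.toℕ-fromℕ< (rem<n y)
    split : x ≡ + suc (rem y) +ᶻ quo y ∙N
    split = lin (x ∷ + rem y ∷ quo y ∙N ∷ []) ((α ⊟ # 1 ≐ β ⊞ γ) ∷ []) (α ≐ # 1 ⊞ β ⊞ γ) (rem-quo y)

  ≈W⇒≡W : ∀ {u v : Word k} → u ≈W v → u ≡W v
  ≈W⇒≡W e = VecP.tabulate-cong (λ i → e (+ suc (toℕ i)))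

  ≈W-sym : ∀ {u v : Word k} → u ≈W v → v ≈W u
  ≈W-sym e x = sym (e x)

  ≈W-trans : ∀ {u v w : Word k} → u ≈W v → v ≈W w → u ≈W w
  ≈W-trans e f x = trans (e x) (f x)

  ∷-cong : ∀ i {u v : Word k} → u ≈W v → i ∷ u ≈W i ∷ v
  ∷-cong i e x = cong (sAct i) (e x)

  ++-congˡ : ∀ (w : Word k) {u v : Word k} → u ≈W v → u ++ w ≈W v ++ w
  ++-congˡ w {u} {v} e x = trans (act-++ u w x) (trans (e (act w x)) (sym (act-++ v w x)))

  ∷∷-cancel : ∀ i (u : Word k) → i ∷ i ∷ u ≈W u
  ∷∷-cancel i u x = trans (act-∷ i (i ∷ u) x) (trans (cong (s (ι i)) (act-∷ i u x)) (s-involutive (ι i) (act u x)))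

  inv-cong : ∀ {u v : Word k} → u ≈W v → ∀ x → inv u x ≡ inv v x
  inv-cong {u} {v} e x = act-injective u (trans (act-inv u x) (sym (trans (e (inv v x)) (act-inv v x))))

  private
    IsFirst : (ℕ → Bool) → ℕ → Set
    IsFirst B m = B m ≡ true × (∀ j → j < m → B j ≡ false)

    -- Here `a` is the number of values already rejected and `n` the number still to be tried. As
    -- `B L` is true, the list cannot run out before the search succeeds.
    first-search : ∀ (B : ℕ → Bool) (L : ℕ) (F : List ℕ → ℕ) → F [] ≡ L →
      (∀ m ms → F (m ∷ ms) ≡ (if B m then m else F ms)) → B L ≡ true →
      ∀ n a (f : ℕ → ℕ) → (∀ i → f i ≡ a ℕ.+ i) → a ℕ.+ n ≡ suc L → (∀ j → j < a → B j ≡ false) → IsFirst B (F (applyUpTo f n))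
    first-search B L F F[] F∷ BL zero a f fa eq below
      with trans (sym BL) (below L (subst (L <_) (sym (trans (sym (ℕP.+-identityʳ a)) eq)) (ℕP.n<1+n L)))
    ... | ()
    first-search B L F F[] F∷ BL (suc n) a f fa eq below with B (f 0) in b
    ... | true  = subst (IsFirst B) (sym (trans (F∷ (f 0) _) (cong (λ t → if t then f 0 else F (applyUpTo (f ∘ suc) n)) b)))
                    (b , λ j j<f0 → below j (subst (j <_) (trans (fa 0) (ℕP.+-identityʳ a)) j<f0))
    ... | false = subst (IsFirst B) (sym (trans (F∷ (f 0) _) (cong (λ t → if t then f 0 else F (applyUpTo (f ∘ suc) n)) b)))
                    (first-search B L F F[] F∷ BL n (suc a) (f ∘ suc) (λ i → trans (fa (suc i)) (ℕP.+-suc a i)) (trans (sym (ℕP.+-suc a n)) eq) below′)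
      where
      below′ : ∀ j → j < suc a → B j ≡ false
      below′ j (s≤s j≤a) with ℕP.m≤n⇒m<n∨m≡n j≤a
      ... | inj₁ lt   = below j lt
      ... | inj₂ refl = trans (cong B (trans (sym (ℕP.+-identityʳ a)) (sym (fa 0)))) b

    -- The search inside len is a local function that cannot be named: abstracting over its argument
    -- lets unification supply it as the argument F here.
    search-from-0 : ∀ (B : ℕ → Bool) (L : ℕ) (F : List ℕ → ℕ) → F [] ≡ L →
      (∀ m ms → F (m ∷ ms) ≡ (if B m then m else F ms)) → B L ≡ true →
      ∀ w → w ≡ applyUpTo suc L → IsFirst B (if B 0 then 0 else F w)
    search-from-0 B L F F[] F∷ BL w refl =
      subst (IsFirst B) (F∷ 0 _) (first-search B L F F[] F∷ BL (suc L) 0 id (λ _ → refl) refl (λ _ ()))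

    true⇒T : ∀ {b} → b ≡ true → T b
    true⇒T refl = tt

    T⇒true : ∀ {b} → T b → b ≡ true
    T⇒true {true} _ = refl

    ⌊⌋-true : ∀ {A : Set} (d : Dec A) → A → ⌊ d ⌋ ≡ true
    ⌊⌋-true (yes _) a = refl
    ⌊⌋-true (no ¬a) a = contradiction a ¬a

    allWords-complete : ∀ (v : Word k) → v ∈ allWords k (length v)
    allWords-complete []      = here refl
    allWords-complete (i ∷ v) = MemP.∈-concatMap⁺ (λ i → map (i ∷_) (allWords k (length v)))
      (lose (MemP.∈-allFin i) (MemP.∈-map⁺ (i ∷_) (allWords-complete v)))

    allWords-length : ∀ m {v : Word k} → v ∈ allWords k m → length v ≡ m
    allWords-length zero    (here refl) = refl
    allWords-length (suc m) v∈ with find (MemP.∈-concatMap⁻ (λ i → map (i ∷_) (allWords k m)) {xs = List.allFin (suc k)} v∈)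
    ... | i , _ , v∈′ with MemP.∈-map⁻ (i ∷_) v∈′
    ...   | v′ , v′∈ , refl = cong suc (allWords-length m v′∈)

    hasWord⁺ : ∀ (u v : Word k) → v ≡W u → hasWordOfLength u (length v) ≡ true
    hasWord⁺ u v e = T⇒true (AnyP.any⁺ (λ v → ⌊ v ≟W u ⌋) (lose (allWords-complete v) (true⇒T (⌊⌋-true (v ≟W u) e))))

    hasWord⁻ : ∀ (u : Word k) m → hasWordOfLength u m ≡ true → ∃[ v ] v ≡W u × length v ≡ m
    hasWord⁻ u m e with find (AnyP.any⁻ (λ v → ⌊ v ≟W u ⌋) (allWords k m) (true⇒T e))
    ... | v , v∈ , t with v ≟W u | t
    ...   | yes q | _ = v , q , allWords-length m v∈

  len-first : ∀ (u : Word k) → IsFirst (hasWordOfLength u) (len u)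
  len-first u with search-from-0 (hasWordOfLength u) (length u) _ refl (λ m ms → refl) (hasWord⁺ u u refl) | applyUpTo suc (length u) in eq
  ... | found | w = found w (sym eq)

  reduced : ∀ (u : Word k) → ∃[ v ] v ≈W u × length v ≡ len u
  reduced u with hasWord⁻ u (len u) (proj₁ (len-first u))
  ... | v , e , l = v , ≡W⇒≈W {v} {u} e , l

  len-≤ : ∀ (u v : Word k) → v ≈W u → len u ≤ length v
  len-≤ u v e with ℕP.≤-<-connex (len u) (length v)
  ... | inj₁ le = le
  ... | inj₂ lt with trans (sym (hasWord⁺ u v (≈W⇒≡W {v} {u} e))) (proj₂ (len-first u) (length v) lt)
  ...   | ()

  opaque
    ℓ : Word k → ℕ
    ℓ = len

    ℓ-def : ∀ u → ℓ u ≡ len u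
    ℓ-def u = refl

    ℓ-reduced : ∀ (u : Word k) → ∃[ v ] v ≈W u × length v ≡ ℓ u
    ℓ-reduced = reduced

    ℓ-≤ : ∀ (u v : Word k) → v ≈W u → ℓ u ≤ length v
    ℓ-≤ = len-≤

  ℓ-cong : ∀ {u v : Word k} → u ≈W v → ℓ u ≡ ℓ v
  ℓ-cong {u} {v} e with ℓ-reduced u | ℓ-reduced v
  ... | u′ , p , lu | v′ , q , lv = ℕP.≤-antisym
    (subst (ℓ u ≤_) lv (ℓ-≤ u v′ (≈W-trans {v′} {v} {u} q (≈W-sym {u} {v} e))))
    (subst (ℓ v ≤_) lu (ℓ-≤ v u′ (≈W-trans {u′} {u} {v} p e)))

  ℓ-∷ : ∀ i (u : Word k) → ℓ (i ∷ u) ≤ suc (ℓ u)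
  ℓ-∷ i u with ℓ-reduced u
  ... | v , p , lv = subst (ℓ (i ∷ u) ≤_) (cong suc lv) (ℓ-≤ (i ∷ u) (i ∷ v) (∷-cong i {v} {u} p))

  ℓ-[] : ℓ [] ≡ 0
  ℓ-[] = ℕP.n≤0⇒n≡0 (ℓ-≤ [] [] (λ _ → refl))

  -- Strong exchange

  conj : Word k → Fin (suc k) → Word k
  conj u i = u ++ i ∷ reverse u

  Swaps : ℤ → ℤ → ℤ → Set
  Swaps y p q = (p ∼ y × q ≡ p +ᶻ + 1) ⊎ (q ∼ y × p ≡ q +ᶻ + 1)

  private
    swap-pair : ∀ y p q → Swaps y p q → s y p ≡ q × s y q ≡ p
    swap-pair y p q (inj₁ (c , refl)) = s-up y p c , trans (s-down y _ (∼-+ (+ 1) c)) (lin (p ∷ []) [] (α ⊞ # 1 ⊟ # 1 ≐ α))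
    swap-pair y p q (inj₂ (c , refl)) = trans (s-down y _ (∼-+ (+ 1) c)) (lin (q ∷ []) [] (α ⊞ # 1 ⊟ # 1 ≐ α)) , s-up y q c

    pair-classes : ∀ y p q → Swaps y p q → ∀ {z} → z ∼ y ⊎ z ∼ y +ᶻ + 1 → z ∼ p ⊎ z ∼ q
    pair-classes y p q (inj₁ (c , refl)) (inj₁ d) = inj₁ (∼-trans d (∼-sym c))
    pair-classes y p q (inj₁ (c , refl)) (inj₂ d) = inj₂ (∼-trans d (∼-sym (∼-+ (+ 1) c)))
    pair-classes y p q (inj₂ (c , refl)) (inj₁ d) = inj₂ (∼-trans d (∼-sym c))
    pair-classes y p q (inj₂ (c , refl)) (inj₂ d) = inj₁ (∼-trans d (∼-sym (∼-+ (+ 1) c)))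

    ∼-act⁻¹ : ∀ (u : Word k) {x z} → act u x ∼ act u z → x ∼ z
    ∼-act⁻¹ u {x} {z} (l , e) = l , act-injective u (trans e (sym (act-shift u z l)))

  -- The reflection u s_i u⁻¹ is s_y as soon as `u` carries the neighbours i, i + 1 to a pair of
  -- neighbours in the classes of y, y + 1, in either order.
  conj-letter : ∀ y i (u : Word k) → Swaps y (act u (ι i)) (act u (ι i +ᶻ + 1)) →
                ∀ x → s y (act u (s (ι i) x)) ≡ act u x
  conj-letter y i u sw x with view (ι i) x
  ... | up l refl e = trans (cong (s y ∘ act u) (trans e (lin (ι i ∷ l ∙N ∷ []) [] (α ⊞ β ⊞ # 1 ≐ α ⊞ # 1 ⊞ β))))
          (trans (cong (s y) (act-shift u _ l)) (trans (s-shift y _ l)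
            (trans (cong (_+ᶻ l ∙N) (proj₂ (swap-pair y _ _ sw))) (sym (act-shift u _ l)))))
  ... | down l refl e = trans (cong (s y ∘ act u) (trans e (lin (ι i ∷ l ∙N ∷ []) [] (α ⊞ # 1 ⊞ β ⊟ # 1 ≐ α ⊞ β))))
          (trans (cong (s y) (act-shift u _ l)) (trans (s-shift y _ l)
            (trans (cong (_+ᶻ l ∙N) (proj₁ (swap-pair y _ _ sw))) (sym (act-shift u _ l)))))
  ... | stay n₁ n₂ e = trans (cong (s y ∘ act u) e) (s-stay y _ (away ∘ inj₁) (away ∘ inj₂))
    where
    away : act u x ∼ y ⊎ act u x ∼ y +ᶻ + 1 → ⊥
    away c with pair-classes y _ _ sw c
    ... | inj₁ d = n₁ (∼-act⁻¹ u d)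
    ... | inj₂ d = n₂ (∼-act⁻¹ u d)

  conj-word : ∀ y i (v u : Word k) → Swaps y (act v (act u (ι i))) (act v (act u (ι i +ᶻ + 1))) →
              ∀ x → s y (act (v ++ conj u i) x) ≡ act v x
  conj-word y i v u sw x =
    trans (cong (s y) (trans (act-++ v (conj u i) x) (trans (cong (act v) (trans (act-++ u (i ∷ reverse u) x)
        (cong (act u) (act-∷ i (reverse u) x)))) (sym (act-++ v u _)))))
      (trans (conj-letter y i (v ++ u) (subst₂ (Swaps y) (sym (act-++ v u _)) (sym (act-++ v u _)) sw) (inv u x))
        (trans (act-++ v u _) (cong (act v) (act-inv u x))))

  Inverts Keeps : Word k → ℤ → ℤ → Set
  Inverts v p q = (p <ᶻ q × act v q <ᶻ act v p) ⊎ (q <ᶻ p × act v p <ᶻ act v q)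
  Keeps   v p q = (p <ᶻ q × act v p <ᶻ act v q) ⊎ (q <ᶻ p × act v q <ᶻ act v p)

  private
    -- Reading `v` from the right, the images of the two positions start in order and end reversed,
    -- so some letter reverses them. By `s-monotone` they are neighbours exchanged by that letter,
    -- and by `conj-word` deleting it amounts to multiplying by the reflection.
    delete-letter : ∀ (v u : Word k) i → Inverts v (act u (ι i)) (act u (ι i +ᶻ + 1)) →
                    ∃[ v′ ] v′ ≈W v ++ conj u i × length v′ < length v
    delete-letter [] u i (inj₁ (p<q , q<p)) = ⊥-elim (ℤP.<-asym p<q q<p)
    delete-letter [] u i (inj₂ (q<p , p<q)) = ⊥-elim (ℤP.<-asym p<q q<p)
    delete-letter (j ∷ v) u i = decide (ℤP.<-cmp (act v p) (act v q))
      where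
      p = act u (ι i)
      q = act u (ι i +ᶻ + 1)
      Result = ∃[ v′ ] v′ ≈W (j ∷ v) ++ conj u i × length v′ < suc (length v)
      shorter : Inverts v p q → Result
      shorter h with delete-letter v u i h
      ... | v′ , e , l = j ∷ v′ , ∷-cong j {v′} {v ++ conj u i} e , s≤s l
      drop-j : Swaps (ι j) (act v p) (act v q) → Result
      drop-j sw = v , (λ x → sym (trans (act-∷ j (v ++ conj u i) x) (conj-word (ι j) i v u sw x))) , ℕP.n<1+n (length v)
      decide : _ → Inverts (j ∷ v) p q → Result
      decide (tri≈ _ e _) (inj₁ (p<q , _)) = ⊥-elim (ℤP.<-irrefl (act-injective v e) p<q)
      decide (tri≈ _ e _) (inj₂ (q<p , _)) = ⊥-elim (ℤP.<-irrefl (sym (act-injective v e)) q<p)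
      decide (tri< lt _ _) (inj₂ (q<p , _)) = shorter (inj₂ (q<p , lt))
      decide (tri< lt _ _) (inj₁ (p<q , jq<jp)) with s-monotone (ι j) lt
      ... | inj₁ lt′ = ⊥-elim (ℤP.<-asym lt′ (subst₂ _<ᶻ_ (act-∷ j v q) (act-∷ j v p) jq<jp))
      ... | inj₂ sw  = drop-j (inj₁ sw)
      decide (tri> _ _ gt) (inj₁ (p<q , _)) = shorter (inj₁ (p<q , gt))
      decide (tri> _ _ gt) (inj₂ (q<p , jp<jq)) with s-monotone (ι j) gt
      ... | inj₁ gt′ = ⊥-elim (ℤP.<-asym gt′ (subst₂ _<ᶻ_ (act-∷ j v p) (act-∷ j v q) jp<jq))
      ... | inj₂ sw  = drop-j (inj₂ sw)

  Inverts-cong : ∀ {v w : Word k} {p q} → v ≈W w → Inverts v p q → Inverts w p q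
  Inverts-cong e (inj₁ (a , b)) = inj₁ (a , subst₂ _<ᶻ_ (e _) (e _) b)
  Inverts-cong e (inj₂ (a , b)) = inj₂ (a , subst₂ _<ᶻ_ (e _) (e _) b)

  reflection-down : ∀ (y z u : Word k) i → z ≈W y ++ conj u i →
                    Inverts y (act u (ι i)) (act u (ι i +ᶻ + 1)) → ℓ z < ℓ y
  reflection-down y z u i e iv with ℓ-reduced y
  ... | v , v≈y , lv with delete-letter v u i (Inverts-cong {y} {v} (≈W-sym {v} {y} v≈y) iv)
  ...   | v′ , e′ , lt = ℕP.≤-<-trans
            (ℓ-≤ z v′ (≈W-trans {v′} {v ++ conj u i} {z} e′ (≈W-trans {v ++ conj u i} {y ++ conj u i} {z} (++-congˡ (conj u i) {v} {y} v≈y) (≈W-sym {z} {y ++ conj u i} e))))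
            (subst (length v′ <_) lv lt)

  conj-swap : ∀ (u : Word k) i → act (conj u i) (act u (ι i)) ≡ act u (ι i +ᶻ + 1)
                               × act (conj u i) (act u (ι i +ᶻ + 1)) ≡ act u (ι i)
  conj-swap u i = trans (expand (ι i)) (cong (act u) (s-up (ι i) (ι i) ∼-refl))
                , trans (expand _) (cong (act u) (trans (s-down (ι i) _ ∼-refl) (lin (ι i ∷ []) [] (α ⊞ # 1 ⊟ # 1 ≐ α))))
    where
    expand : ∀ x → act (conj u i) (act u x) ≡ act u (s (ι i) x)
    expand x = trans (act-++ u (i ∷ reverse u) (act u x)) (cong (act u) (trans (act-∷ i (reverse u) (act u x)) (cong (s (ι i)) (inv-act u x))))

  conj-involutive : ∀ (y u : Word k) i → y ≈W (y ++ conj u i) ++ conj u i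
  conj-involutive y u i x = sym (trans (act-++ (y ++ conj u i) (conj u i) x) (trans (act-++ y (conj u i) _) (cong (act y) twice)))
    where
    expand : ∀ x → act (conj u i) x ≡ act u (s (ι i) (inv u x))
    expand x = trans (act-++ u (i ∷ reverse u) x) (cong (act u) (act-∷ i (reverse u) x))
    twice : act (conj u i) (act (conj u i) x) ≡ x
    twice = trans (expand _) (trans (cong (λ t → act u (s (ι i) (inv u t))) (expand x))
      (trans (cong (act u ∘ s (ι i)) (inv-act u _)) (trans (cong (act u) (s-involutive (ι i) _)) (act-inv u x))))

  -- Multiplying by the reflection is an involution that exchanges the two values, so `z` inverts
  -- the pair that `y` keeps and `reflection-down` applies with the roles exchanged.
  reflection-up : ∀ (y z u : Word k) i → z ≈W y ++ conj u i →
                  Keeps y (act u (ι i)) (act u (ι i +ᶻ + 1)) → ℓ y < ℓ z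
  reflection-up y z u i e kp = reflection-down z y u i
    (≈W-trans {y} {(y ++ conj u i) ++ conj u i} {z ++ conj u i} (conj-involutive y u i) (++-congˡ (conj u i) {y ++ conj u i} {z} (≈W-sym {z} {y ++ conj u i} e)))
    (exchange kp)
    where
    zp : act z (act u (ι i)) ≡ act y (act u (ι i +ᶻ + 1))
    zp = trans (e _) (trans (act-++ y (conj u i) _) (cong (act y) (proj₁ (conj-swap u i))))
    zq : act z (act u (ι i +ᶻ + 1)) ≡ act y (act u (ι i))
    zq = trans (e _) (trans (act-++ y (conj u i) _) (cong (act y) (proj₂ (conj-swap u i))))
    exchange : Keeps y (act u (ι i)) (act u (ι i +ᶻ + 1)) → Inverts z (act u (ι i)) (act u (ι i +ᶻ + 1))
    exchange (inj₁ (a , b)) = inj₁ (a , subst₂ _<ᶻ_ (sym zq) (sym zp) b)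
    exchange (inj₂ (a , b)) = inj₂ (a , subst₂ _<ᶻ_ (sym zp) (sym zq) b)

  keeps-or-inverts : ∀ (y : Word k) p q → p ≢ q → Keeps y p q ⊎ Inverts y p q
  keeps-or-inverts y p q p≢q with ℤP.<-cmp p q | ℤP.<-cmp (act y p) (act y q)
  ... | tri≈ _ e _ | _ = ⊥-elim (p≢q e)
  ... | _ | tri≈ _ e _ = ⊥-elim (p≢q (act-injective y e))
  ... | tri< a _ _ | tri< b _ _ = inj₁ (inj₁ (a , b))
  ... | tri< a _ _ | tri> _ _ b = inj₂ (inj₁ (a , b))
  ... | tri> _ _ a | tri< b _ _ = inj₂ (inj₂ (a , b))
  ... | tri> _ _ a | tri> _ _ b = inj₁ (inj₂ (a , b))

  root-distinct : ∀ (u : Word k) i → act u (ι i) ≢ act u (ι i +ᶻ + 1)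
  root-distinct u i e = ℤP.<-irrefl (act-injective u e) (lin (ι i ∷ []) [] (α ≺ α ⊞ # 1))

  reflection-up⁻¹ : ∀ (y z u : Word k) i → z ≈W y ++ conj u i → ℓ y < ℓ z →
                    Keeps y (act u (ι i)) (act u (ι i +ᶻ + 1))
  reflection-up⁻¹ y z u i e lt with keeps-or-inverts y _ _ (root-distinct u i)
  ... | inj₁ kp = kp
  ... | inj₂ iv = ⊥-elim (ℕP.<-asym lt (reflection-down y z u i e iv))

  -- s_i w = w (w⁻¹ s_i w). Left multiplication by a letter thus falls under the statements on
  -- reflections, with w⁻¹(i) and w⁻¹(i + 1) as the pair of positions to compare.
  left-as-reflection : ∀ i (w : Word k) → i ∷ w ≈W w ++ conj (reverse w) i
  left-as-reflection i w x = sym (trans (act-++ w (conj (reverse w) i) x) (trans (cong (act w) (act-++ (reverse w) (i ∷ reverse (reverse w)) x))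
    (trans (act-inv w _) (cong (λ v → sAct i (act v x)) (ListP.reverse-involutive w)))))

  private
    class-shift : ∀ y (w : Word k) → ∃[ l ] inv w y ≡ inv w (ι (fin y)) +ᶻ l ∙N × inv w (y +ᶻ + 1) ≡ inv w (ι (fin y) +ᶻ + 1) +ᶻ l ∙N
    class-shift y w with ∼-sym (ι-fin y)
    ... | l , e = l , trans (cong (inv w) e) (inv-shift w _ l)
                    , trans (cong (inv w) (trans (cong (_+ᶻ + 1) e) (lin (ι (fin y) ∷ l ∙N ∷ []) [] (α ⊞ β ⊞ # 1 ≐ α ⊞ # 1 ⊞ β)))) (inv-shift w _ l)

    n<n+1 : ∀ x → x <ᶻ x +ᶻ + 1
    n<n+1 x = lin (x ∷ []) [] (α ≺ α ⊞ # 1)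

    letter-up : ∀ i (w : Word k) → inv w (ι i) <ᶻ inv w (ι i +ᶻ + 1) → ℓ w < ℓ (i ∷ w)
    letter-up i w lt = reflection-up w (i ∷ w) (reverse w) i (left-as-reflection i w)
      (inj₁ (lt , subst₂ _<ᶻ_ (sym (act-inv w _)) (sym (act-inv w _)) (n<n+1 (ι i))))

    letter-down : ∀ i (w : Word k) → inv w (ι i +ᶻ + 1) <ᶻ inv w (ι i) → ℓ (i ∷ w) < ℓ w
    letter-down i w lt = reflection-down w (i ∷ w) (reverse w) i (left-as-reflection i w)
      (inj₂ (lt , subst₂ _<ᶻ_ (sym (act-inv w _)) (sym (act-inv w _)) (n<n+1 (ι i))))

  left-up : ∀ y (w : Word k) → inv w y <ᶻ inv w (y +ᶻ + 1) → ℓ w < ℓ (fin y ∷ w)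
  left-up y w lt with class-shift y w
  ... | l , e , f = letter-up (fin y) w (lin (inv w y ∷ inv w (y +ᶻ + 1) ∷ inv w (ι (fin y)) ∷ inv w (ι (fin y) +ᶻ + 1) ∷ l ∙N ∷ [])
      ((α ≺ β) ∷ (α ≐ γ ⊞ η) ∷ (β ≐ ζ ⊞ η) ∷ []) (γ ≺ ζ) lt e f)

  left-down : ∀ y (w : Word k) → inv w (y +ᶻ + 1) <ᶻ inv w y → ℓ (fin y ∷ w) < ℓ w
  left-down y w lt with class-shift y w
  ... | l , e , f = letter-down (fin y) w (lin (inv w y ∷ inv w (y +ᶻ + 1) ∷ inv w (ι (fin y)) ∷ inv w (ι (fin y) +ᶻ + 1) ∷ l ∙N ∷ [])
      ((β ≺ α) ∷ (α ≐ γ ⊞ η) ∷ (β ≐ ζ ⊞ η) ∷ []) (ζ ≺ γ) lt e f)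

  inv-distinct : ∀ y (w : Word k) → inv w y ≢ inv w (y +ᶻ + 1)
  inv-distinct y w e = ℤP.<-irrefl (act-injective (reverse w) e) (n<n+1 y)

  left-up⁻¹ : ∀ y (w : Word k) → ℓ w < ℓ (fin y ∷ w) → inv w y <ᶻ inv w (y +ᶻ + 1)
  left-up⁻¹ y w lt with ℤP.<-cmp (inv w y) (inv w (y +ᶻ + 1))
  ... | tri< l _ _ = l
  ... | tri≈ _ e _ = ⊥-elim (inv-distinct y w e)
  ... | tri> _ _ g = ⊥-elim (ℕP.<-asym lt (left-down y w g))

  right-up : ∀ i (w : Word k) → act w (ι i) <ᶻ act w (ι i +ᶻ + 1) → ℓ w < ℓ (w ++ i ∷ [])
  right-up i w lt = reflection-up w (w ++ i ∷ []) [] i (λ _ → refl) (inj₁ (n<n+1 (ι i) , lt))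

  right-down : ∀ i (w : Word k) → act w (ι i +ᶻ + 1) <ᶻ act w (ι i) → ℓ (w ++ i ∷ []) < ℓ w
  right-down i w lt = reflection-down w (w ++ i ∷ []) [] i (λ _ → refl) (inj₁ (n<n+1 (ι i) , lt))

  right-up⁻¹ : ∀ i (w : Word k) → ℓ w < ℓ (w ++ i ∷ []) → act w (ι i) <ᶻ act w (ι i +ᶻ + 1)
  right-up⁻¹ i w lt with reflection-up⁻¹ w (w ++ i ∷ []) [] i (λ _ → refl) lt
  ... | inj₁ (_ , h) = h
  ... | inj₂ (h , _) = ⊥-elim (ℤP.<-asym h (n<n+1 (ι i)))

  -- Lifting in the Bruhat order

  ≤B-congʳ : ∀ {x y z : Word k} → x ≤B y → y ≈W z → x ≤B z
  ≤B-congʳ {z = z} (≤B-refl {x} {y} e) f = ≤B-refl (trans e (≈W⇒≡W {y} {z} f))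
  ≤B-congʳ {z = z′} (≤B-step {x} {y} {z} u i h e l) f =
    ≤B-step u i h (trans (sym (≈W⇒≡W {z} {z′} f)) e)
      (subst (len y <_) (trans (sym (ℓ-def z)) (trans (ℓ-cong {z} {z′} f) (ℓ-def z′))) l)

  ≤B-congˡ : ∀ {x y z : Word k} → x ≈W y → y ≤B z → x ≤B z
  ≤B-congˡ {x} e (≤B-refl {y} f) = ≤B-refl (trans (≈W⇒≡W {x} {y} e) f)
  ≤B-congˡ e (≤B-step u i h f l) = ≤B-step u i (≤B-congˡ e h) f l

  ≤B-trans : ∀ {x y z : Word k} → x ≤B y → y ≤B z → x ≤B z
  ≤B-trans {x} {y} {z} h (≤B-refl e) = ≤B-congʳ h (≡W⇒≈W {y} {z} e)
  ≤B-trans h (≤B-step u i h′ f l) = ≤B-step u i (≤B-trans h h′) f l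

  reflection-≤ : ∀ (y z u : Word k) i → z ≈W y ++ conj u i → ℓ y < ℓ z → y ≤B z
  reflection-≤ y z u i e l = ≤B-step {x = y} {y} {z} u i (≤B-refl {x = y} {y} refl) (≈W⇒≡W {z} {y ++ conj u i} e) (subst₂ _<_ (ℓ-def y) (ℓ-def z) l)

  -- Here `τ` is multiplication by a simple reflection on a fixed side, and `lower x`, `upper x` are
  -- the smaller and the larger of `x` and `τ x`. The lifting property takes the form that `lower`
  -- and `upper` are monotone; it is used on the left for ideals and on the right to return to coset
  -- representatives.
  module Lifting
    (τ : Word k → Word k)
    (τ-cong : ∀ {x y : Word k} → x ≈W y → τ x ≈W τ y)
    (τ-involutive : ∀ x → τ (τ x) ≈W x)
    (τ-distinct : ∀ x → ℓ (τ x) ≢ ℓ x)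
    (τ-up : ∀ x → ℓ x < ℓ (τ x) → x ≤B τ x)
    (τ-step : ∀ y z u i → z ≈W y ++ conj u i → ℓ y < ℓ z → τ y ≤B τ z ⊎ τ y ≈W z)
    where

    lower upper : Word k → Word k
    lower x with ℓ (τ x) ℕ.<? ℓ x
    ... | yes _ = τ x
    ... | no _  = x
    upper x with ℓ (τ x) ℕ.<? ℓ x
    ... | yes _ = x
    ... | no _  = τ x

    τ-down : ∀ x → ℓ (τ x) < ℓ x → τ x ≤B x
    τ-down x l = ≤B-congʳ (τ-up (τ x) (subst (ℓ (τ x) <_) (sym (ℓ-cong {τ (τ x)} {x} (τ-involutive x))) l)) (τ-involutive x)

    private
      ascends : ∀ x → ¬ (ℓ (τ x) < ℓ x) → ℓ x < ℓ (τ x)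
      ascends x n = ℕP.≤∧≢⇒< (ℕP.≮⇒≥ n) (τ-distinct x ∘ sym)

    lower≤ : ∀ x → lower x ≤B x × lower x ≤B τ x
    lower≤ x with ℓ (τ x) ℕ.<? ℓ x
    ... | yes l = τ-down x l , ≤B-refl refl
    ... | no n  = ≤B-refl refl , τ-up x (ascends x n)

    ≤upper : ∀ x → x ≤B upper x × τ x ≤B upper x
    ≤upper x with ℓ (τ x) ℕ.<? ℓ x
    ... | yes l = ≤B-refl refl , τ-down x l
    ... | no n  = τ-up x (ascends x n) , ≤B-refl refl

    private
      into-lower : ∀ {x} z → x ≤B z → x ≤B τ z → x ≤B lower z
      into-lower z a b with ℓ (τ z) ℕ.<? ℓ z
      ... | yes _ = b
      ... | no _  = a

      from-upper : ∀ {x} z → z ≤B x → τ z ≤B x → upper z ≤B x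
      from-upper z a b with ℓ (τ z) ℕ.<? ℓ z
      ... | yes _ = a
      ... | no _  = b

    -- In one step from y up to z it suffices that `lower y` is below both z and `τ z`. For the
    -- latter, either `τ y ≤ τ z`, or `τ y` is z and then `τ z` is y.
    lower-mono : ∀ {x z} → x ≤B z → lower x ≤B lower z
    lower-mono {x} {z} (≤B-refl e) = into-lower z (≤B-congʳ (proj₁ (lower≤ x)) e′) (≤B-congʳ (proj₂ (lower≤ x)) (τ-cong {x} {z} e′))
      where e′ = ≡W⇒≈W {x} {z} e
    lower-mono {x} {z} (≤B-step {x} {y} {z} u i h e l) = ≤B-trans (lower-mono h) (into-lower z (≤B-trans (proj₁ (lower≤ y)) y≤z) below)
      where
      e′ = ≡W⇒≈W {z} {y ++ conj u i} e
      l′ = subst₂ _<_ (sym (ℓ-def y)) (sym (ℓ-def z)) l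
      y≤z = reflection-≤ y z u i e′ l′
      below : lower y ≤B τ z
      below with τ-step y z u i e′ l′
      ... | inj₁ le = ≤B-trans (proj₂ (lower≤ y)) le
      ... | inj₂ eq = ≤B-congʳ (proj₁ (lower≤ y)) (≈W-trans {y} {τ (τ y)} {τ z} (≈W-sym {τ (τ y)} {y} (τ-involutive y)) (τ-cong {τ y} {z} eq))

    upper-mono : ∀ {x z} → x ≤B z → upper x ≤B upper z
    upper-mono {x} {z} (≤B-refl e) = from-upper x (≤B-congˡ e′ (proj₁ (≤upper z))) (≤B-congˡ (τ-cong {x} {z} e′) (proj₂ (≤upper z)))
      where e′ = ≡W⇒≈W {x} {z} e
    upper-mono {x} {z} (≤B-step {x} {y} {z} u i h e l) = ≤B-trans (upper-mono h) (from-upper y (≤B-trans y≤z (proj₁ (≤upper z))) below)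
      where
      e′ = ≡W⇒≈W {z} {y ++ conj u i} e
      l′ = subst₂ _<_ (sym (ℓ-def y)) (sym (ℓ-def z)) l
      y≤z = reflection-≤ y z u i e′ l′
      below : τ y ≤B upper z
      below with τ-step y z u i e′ l′
      ... | inj₁ le = ≤B-trans le (proj₂ (≤upper z))
      ... | inj₂ eq = ≤B-congˡ eq (proj₁ (≤upper z))

    lower-desc : ∀ x → ℓ (τ x) < ℓ x → lower x ≡ τ x
    lower-desc x l with ℓ (τ x) ℕ.<? ℓ x
    ... | yes _ = refl
    ... | no n  = contradiction l n

    lower-asc : ∀ x → ℓ x < ℓ (τ x) → lower x ≡ x
    lower-asc x l with ℓ (τ x) ℕ.<? ℓ x
    ... | yes g = contradiction g (ℕP.<-asym l)
    ... | no _  = refl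

    upper-desc : ∀ x → ℓ (τ x) < ℓ x → upper x ≡ x
    upper-desc x l with ℓ (τ x) ℕ.<? ℓ x
    ... | yes _ = refl
    ... | no n  = contradiction l n

    upper-asc : ∀ x → ℓ x < ℓ (τ x) → upper x ≡ τ x
    upper-asc x l with ℓ (τ x) ℕ.<? ℓ x
    ... | yes g = contradiction g (ℕP.<-asym l)
    ... | no _  = refl

  left-distinct : ∀ i (w : Word k) → ℓ (i ∷ w) ≢ ℓ w
  left-distinct i w e with ℤP.<-cmp (inv w (ι i)) (inv w (ι i +ᶻ + 1))
  ... | tri< a _ _ = ℕP.<-irrefl (sym e) (subst (λ j → ℓ w < ℓ (j ∷ w)) (fin-ι i) (left-up (ι i) w a))
  ... | tri≈ _ q _ = inv-distinct (ι i) w q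
  ... | tri> _ _ a = ℕP.<-irrefl e (subst (λ j → ℓ (j ∷ w) < ℓ w) (fin-ι i) (left-down (ι i) w a))

  right-distinct : ∀ i (w : Word k) → ℓ (w ++ i ∷ []) ≢ ℓ w
  right-distinct i w e with ℤP.<-cmp (act w (ι i)) (act w (ι i +ᶻ + 1))
  ... | tri< a _ _ = ℕP.<-irrefl (sym e) (right-up i w a)
  ... | tri≈ _ q _ = ℤP.<-irrefl (act-injective w q) (lin (ι i ∷ []) [] (α ≺ α ⊞ # 1))
  ... | tri> _ _ a = ℕP.<-irrefl e (right-down i w a)

  -- The pair of values in order under `y` either stays in order after s_j, so that the step from
  -- s_j y to s_j z still goes up, or is exchanged by s_j, and then s_j y = y t = z.
  left-step : ∀ j (y z u : Word k) i → z ≈W y ++ conj u i → ℓ y < ℓ z → (j ∷ y) ≤B (j ∷ z) ⊎ (j ∷ y) ≈W z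
  left-step j y z u i e l = decide (reflection-up⁻¹ y z u i e l)
    where
    p = act u (ι i)
    q = act u (ι i +ᶻ + 1)
    keep : Keeps (j ∷ y) p q → (j ∷ y) ≤B (j ∷ z) ⊎ (j ∷ y) ≈W z
    keep kp = inj₁ (reflection-≤ (j ∷ y) (j ∷ z) u i e′ (reflection-up (j ∷ y) (j ∷ z) u i e′ kp))
      where
      e′ : j ∷ z ≈W (j ∷ y) ++ conj u i
      e′ = ∷-cong j {z} {y ++ conj u i} e
    swap : Swaps (ι j) (act y p) (act y q) → (j ∷ y) ≤B (j ∷ z) ⊎ (j ∷ y) ≈W z
    swap sw = inj₂ λ x → trans (act-∷ j y x) (trans (cong (s (ι j)) (sym (conj-word (ι j) i y u sw x)))
      (trans (s-involutive (ι j) _) (sym (e x))))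
    decide : Keeps y p q → (j ∷ y) ≤B (j ∷ z) ⊎ (j ∷ y) ≈W z
    decide (inj₁ (a , b)) with s-monotone (ι j) b
    ... | inj₁ b′ = keep (inj₁ (a , subst₂ _<ᶻ_ (sym (act-∷ j y p)) (sym (act-∷ j y q)) b′))
    ... | inj₂ sw = swap (inj₁ sw)
    decide (inj₂ (a , b)) with s-monotone (ι j) b
    ... | inj₁ b′ = keep (inj₂ (a , subst₂ _<ᶻ_ (sym (act-∷ j y q)) (sym (act-∷ j y p)) b′))
    ... | inj₂ sw = swap (inj₂ sw)

  act-∷ʳ : ∀ (y : Word k) j x → act (y ++ j ∷ []) x ≡ act y (s (ι j) x)
  act-∷ʳ y j x = trans (act-++ y (j ∷ []) x) (cong (act y) (act-∷ j [] x))

  -- As on the left, with s_j now acting on the pair of positions: z s_j = (y s_j)(s_j t s_j), and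
  -- if s_j reverses the pair then t = s_j.
  right-step : ∀ j (y z u : Word k) i → z ≈W y ++ conj u i → ℓ y < ℓ z → (y ++ j ∷ []) ≤B (z ++ j ∷ []) ⊎ (y ++ j ∷ []) ≈W z
  right-step j y z u i e l = decide (reflection-up⁻¹ y z u i e l)
    where
    p = act u (ι i)
    q = act u (ι i +ᶻ + 1)
    Result = (y ++ j ∷ []) ≤B (z ++ j ∷ []) ⊎ (y ++ j ∷ []) ≈W z
    conj-∷ : ∀ x → act (conj (j ∷ u) i) x ≡ s (ι j) (act (conj u i) (s (ι j) x))
    conj-∷ x = trans (act-∷ j (u ++ i ∷ reverse (j ∷ u)) x) (cong (s (ι j))
      (trans (act-++ u (i ∷ reverse (j ∷ u)) x) (trans (cong (λ t → act u (sAct i t)) (inv-∷ j u x)) (sym (act-++ u (i ∷ reverse u) (s (ι j) x))))))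
    e′ : z ++ j ∷ [] ≈W (y ++ j ∷ []) ++ conj (j ∷ u) i
    e′ x = trans (act-∷ʳ z j x) (trans (e (s (ι j) x)) (trans (act-++ y (conj u i) _)
      (sym (trans (act-++ (y ++ j ∷ []) (conj (j ∷ u) i) x) (trans (act-∷ʳ y j _)
        (cong (act y) (trans (cong (s (ι j)) (conj-∷ x)) (s-involutive (ι j) _))))))))
    at-s : ∀ x → act (y ++ j ∷ []) (act (j ∷ u) x) ≡ act y (act u x)
    at-s x = trans (act-∷ʳ y j _) (cong (act y) (trans (cong (s (ι j)) (act-∷ j u x)) (s-involutive (ι j) _)))
    keep : Keeps (y ++ j ∷ []) (act (j ∷ u) (ι i)) (act (j ∷ u) (ι i +ᶻ + 1)) → Result
    keep kp = inj₁ (reflection-≤ (y ++ j ∷ []) (z ++ j ∷ []) (j ∷ u) i e′ (reflection-up (y ++ j ∷ []) (z ++ j ∷ []) (j ∷ u) i e′ kp))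
    swap : Swaps (ι j) p q → Result
    swap sw = inj₂ λ x → trans (act-∷ʳ y j x) (trans (cong (act y) (sym (trans (sym (s-involutive (ι j) _)) (cong (s (ι j)) (conj-word (ι j) i [] u sw x)))))
      (trans (sym (act-++ y (conj u i) x)) (sym (e x))))
    decide : Keeps y p q → Result
    decide (inj₁ (a , b)) with s-monotone (ι j) a
    ... | inj₁ a′ = keep (inj₁ (subst₂ _<ᶻ_ (sym (act-∷ j u _)) (sym (act-∷ j u _)) a′ , subst₂ _<ᶻ_ (sym (at-s _)) (sym (at-s _)) b))
    ... | inj₂ sw = swap (inj₁ sw)
    decide (inj₂ (a , b)) with s-monotone (ι j) a
    ... | inj₁ a′ = keep (inj₂ (subst₂ _<ᶻ_ (sym (act-∷ j u _)) (sym (act-∷ j u _)) a′ , subst₂ _<ᶻ_ (sym (at-s _)) (sym (at-s _)) b))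
    ... | inj₂ sw = swap (inj₂ sw)

  ∷ʳ-involutive : ∀ j (x : Word k) → (x ++ j ∷ []) ++ j ∷ [] ≈W x
  ∷ʳ-involutive j x y = trans (act-∷ʳ (x ++ j ∷ []) j y) (trans (act-∷ʳ x j _) (cong (act x) (s-involutive (ι j) y)))

  module Left (j : Fin (suc k)) = Lifting (j ∷_) (λ {x} {y} → ∷-cong j {x} {y}) (∷∷-cancel j) (left-distinct j)
    (λ x l → reflection-≤ x (j ∷ x) (reverse x) j (left-as-reflection j x) l) (left-step j)

  module Right (j : Fin (suc k)) = Lifting (_++ j ∷ []) (λ {x} {y} → ++-congˡ (j ∷ []) {x} {y}) (∷ʳ-involutive j) (right-distinct j)
    (λ x l → reflection-≤ x (x ++ j ∷ []) [] j (λ _ → refl) l) (right-step j)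

  -- Affine Grassmannian elements and the truncated Demazure action

  opaque
    -- Block 0 is the window of positions 1, ..., n rather than 0, ..., k; hence `p - 1` here and
    -- the successor in `pos`.
    blk : ℤ → ℤ
    blk p = quo (p -ᶻ + 1)

    pos : ℤ → ℤ
    pos p = + suc (rem (p -ᶻ + 1))

    pos+blk : ∀ p → p ≡ pos p +ᶻ blk p ∙N
    pos+blk p = lin (p ∷ + rem (p -ᶻ + 1) ∷ quo (p -ᶻ + 1) ∙N ∷ []) ((α ⊟ # 1 ≐ β ⊞ γ) ∷ []) (α ≐ # 1 ⊞ β ⊞ γ) (rem-quo (p -ᶻ + 1))

    1≤pos : ∀ p → + 1 ≤ᶻ pos p
    1≤pos p = +≤+ (s≤s z≤n)

    pos≤N : ∀ p → pos p ≤ᶻ N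
    pos≤N p = +≤+ (rem<n (p -ᶻ + 1))

  blk-unique : ∀ {p} a l → + 1 ≤ᶻ a → a ≤ᶻ N → p ≡ a +ᶻ l ∙N → blk p ≡ l
  blk-unique {p} a l a₁ a₂ e = division-unique {pos p -ᶻ + 1} {a -ᶻ + 1}
    (lin (pos p ∷ []) ((# 1 ≼ α) ∷ []) (# 0 ≼ α ⊟ # 1) (1≤pos p))
    (lin (pos p ∷ N ∷ []) ((α ≼ β) ∷ []) (α ⊟ # 1 ≺ β) (pos≤N p))
    (lin (a ∷ []) ((# 1 ≼ α) ∷ []) (# 0 ≼ α ⊟ # 1) a₁)
    (lin (a ∷ N ∷ []) ((α ≼ β) ∷ []) (α ⊟ # 1 ≺ β) a₂)
    (lin (p ∷ pos p ∷ blk p ∙N ∷ a ∷ l ∙N ∷ []) ((α ≐ β ⊞ γ) ∷ (α ≐ ζ ⊞ η) ∷ []) (β ⊟ # 1 ⊞ γ ≐ ζ ⊟ # 1 ⊞ η) (pos+blk p) e)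

  blk-shift : ∀ p l → blk (p +ᶻ l ∙N) ≡ blk p +ᶻ l
  blk-shift p l = blk-unique (pos p) _ (1≤pos p) (pos≤N p)
    (lin (p ∷ pos p ∷ blk p ∙N ∷ l ∙N ∷ (blk p +ᶻ l) ∙N ∷ []) ((α ≐ β ⊞ γ) ∷ (η ≐ γ ⊞ ζ) ∷ []) (α ⊞ ζ ≐ β ⊞ η) (pos+blk p) (N-add (blk p) l))

  blk-zero : ∀ {a} → + 1 ≤ᶻ a → a ≤ᶻ N → blk a ≡ + 0
  blk-zero {a} a₁ a₂ = blk-unique a (+ 0) a₁ a₂ (lin (a ∷ + 0 ∙N ∷ []) ((β ≐ # 0) ∷ []) (α ≐ α ⊞ β) N-zero)

  blk-mono : ∀ {p q} → p ≤ᶻ q → blk p ≤ᶻ blk q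
  blk-mono {p} {q} le = ℤP.≮⇒≥ λ lt → lin (p ∷ pos p ∷ blk p ∙N ∷ q ∷ pos q ∷ blk q ∙N ∷ N ∷ [])
    ((α ≐ β ⊞ γ) ∷ (ζ ≐ η ⊞ θ) ∷ (α ≼ ζ) ∷ (# 1 ≼ β) ∷ (η ≼ ξ) ∷ (θ ⊞ ξ ≼ γ) ∷ []) ff
    (pos+blk p) (pos+blk q) le (1≤pos p) (pos≤N q) (N-gap lt)

  blk-< : ∀ {p q} → blk p <ᶻ blk q → p <ᶻ q
  blk-< {p} {q} lt = ℤP.≰⇒> λ le → ℤP.<⇒≱ lt (blk-mono le)

  record Incr (w : Word k) : Set where
    field
      raise : ∀ {p q} → blk p ≡ blk q → p <ᶻ q → act w p <ᶻ act w q

  open Incr public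

  Incr⇒Grass : ∀ {w} → Incr w → Grass w
  Incr⇒Grass {w} inc i = subst₂ _<_ (ℓ-def w) (ℓ-def (w ++ Fin.suc i ∷ [])) (right-up (Fin.suc i) w
    (raise inc (trans (blk-zero (+≤+ (s≤s z≤n)) (+≤+ (s≤s (ℕP.<⇒≤ (FinP.toℕ<n i))))) (sym (blk-zero (+≤+ (s≤s z≤n)) (+≤+ le))))
         (lin (ι (Fin.suc i) ∷ []) [] (α ≺ α ⊞ # 1))))
    where
    le : suc (toℕ i) ℕ.+ 1 ≤ suc k
    le = subst (_≤ suc k) (cong suc (ℕP.+-comm 1 (toℕ i))) (s≤s (FinP.toℕ<n i))

  private
    Grass-adjacent : ∀ {w} → Grass w → ∀ m → 1 ≤ m → m < suc k → act w (+ m) <ᶻ act w (+ suc m)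
    Grass-adjacent {w} gr (suc m) _ (s≤s m<k) = subst₂ (λ a b → act w a <ᶻ act w b)
        (cong (+_ ∘ suc) toℕ-i) (cong (+_ ∘ suc) (trans (ℕP.+-comm _ 1) (cong suc toℕ-i)))
        (right-up⁻¹ (Fin.suc i) w (subst₂ _<_ (sym (ℓ-def w)) (sym (ℓ-def (w ++ Fin.suc i ∷ []))) (gr i)))
      where
      i = fromℕ< m<k
      toℕ-i = FinP.toℕ-fromℕ< m<k

    Grass-steps : ∀ {w} → Grass w → ∀ m d → 1 ≤ m → suc (d ℕ.+ m) ≤ suc k → act w (+ m) <ᶻ act w (+ suc (d ℕ.+ m))
    Grass-steps {w} gr m zero    m₁ le = Grass-adjacent {w} gr m m₁ le
    Grass-steps {w} gr m (suc d) m₁ le = ℤP.<-trans (Grass-steps {w} gr m d m₁ (ℕP.≤-trans (ℕP.n≤1+n _) le))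
      (Grass-adjacent {w} gr (suc d ℕ.+ m) (s≤s z≤n) le)

  Grass⇒Incr : ∀ {w} → Grass w → Incr w
  raise (Grass⇒Incr {w} gr) {p} {q} e p<q = lin (act w p ∷ act w q ∷ act w (pos p) ∷ act w (pos q) ∷ blk p ∙N ∷ [])
      ((α ≐ γ ⊞ η) ∷ (β ≐ ζ ⊞ η) ∷ (γ ≺ ζ) ∷ []) (α ≺ β)
      (trans (cong (act w) (pos+blk p)) (act-shift w _ _))
      (trans (cong (act w) (trans (pos+blk q) (cong (λ l → pos q +ᶻ l ∙N) (sym e)))) (act-shift w _ _))
      (in-window (pos p) (pos q) (1≤pos p) (pos≤N q)
        (lin (p ∷ q ∷ pos p ∷ pos q ∷ blk p ∙N ∷ blk q ∙N ∷ []) ((α ≺ β) ∷ (α ≐ γ ⊞ η) ∷ (β ≐ ζ ⊞ θ) ∷ (η ≐ θ) ∷ []) (γ ≺ ζ)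
          p<q (pos+blk p) (pos+blk q) (cong _∙N e)))
    where
    in-window : ∀ a b → + 1 ≤ᶻ a → b ≤ᶻ N → a <ᶻ b → act w a <ᶻ act w b
    in-window (+ a) (+ b) (+≤+ a₁) (+≤+ b₂) (ℤ.+<+ a<b) with ℕP.m≤n⇒∃[o]m+o≡n a<b
    ... | d , refl = subst (λ t → act w (+ a) <ᶻ act w (+ suc t)) (ℕP.+-comm d a)
      (Grass-steps {w} gr a d a₁ (subst (λ t → suc t ≤ suc k) (ℕP.+-comm a d) b₂))
    in-window (+ a) -[1+ _ ] _ _ ()

  Incr-cong : ∀ {v w} → v ≈W w → Incr v → Incr w
  raise (Incr-cong e inc) b l = subst₂ _<ᶻ_ (e _) (e _) (raise inc b l)

  Incr-[] : Incr []
  raise Incr-[] _ l = l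

  Incr-inv : ∀ {w} → Incr w → ∀ {x y} → blk (inv w x) ≡ blk (inv w y) → x <ᶻ y → inv w x <ᶻ inv w y
  Incr-inv {w} inc {x} {y} e x<y with ℤP.<-cmp (inv w x) (inv w y)
  ... | tri< l _ _ = l
  ... | tri≈ _ q _ = ⊥-elim (ℤP.<-irrefl (act-injective (reverse w) q) x<y)
  ... | tri> _ _ g = ⊥-elim (ℤP.<-asym x<y (subst₂ _<ᶻ_ (act-inv w y) (act-inv w x) (raise inc (sym e) g)))

  block : Word k → ℤ → ℤ
  block w y = blk (inv w y)

  block-shift : ∀ w y l → block w (y +ᶻ l ∙N) ≡ block w y +ᶻ l
  block-shift w y l = trans (cong blk (inv-shift w y l)) (blk-shift (inv w y) l)

  block-cong : ∀ {v w} → v ≈W w → ∀ y → block v y ≡ block w y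
  block-cong {v} {w} e y = cong blk (inv-cong {v} {w} e y)

  block-fin : ∀ y w x → block (fin y ∷ w) x ≡ block w (s y x)
  block-fin y w x = cong blk (inv-fin y w x)

  s-self : ∀ y → s y y ≡ y +ᶻ + 1
  s-self y = s-up y y ∼-refl

  s-next : ∀ y → s y (y +ᶻ + 1) ≡ y
  s-next y = trans (s-down y _ ∼-refl) (lin (y ∷ []) [] (α ⊞ # 1 ⊟ # 1 ≐ α))

  y<y+1 : ∀ y → y <ᶻ y +ᶻ + 1
  y<y+1 y = lin (y ∷ []) [] (α ≺ α ⊞ # 1)

  -- No value lies strictly between y and y + 1, and `w` increases on the block, so no position of
  -- the block lies between theirs.
  adjacent : ∀ {w} → Incr w → ∀ y → block w y ≡ block w (y +ᶻ + 1) → inv w (y +ᶻ + 1) ≡ inv w y +ᶻ + 1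
  adjacent {w} inc y e with ℤP.<-cmp (inv w (y +ᶻ + 1)) (inv w y +ᶻ + 1)
  ... | tri≈ _ q _ = q
  ... | tri< l _ _ = ⊥-elim (ℤP.<⇒≱ (Incr-inv {w} inc e (y<y+1 y))
          (lin (inv w y ∷ inv w (y +ᶻ + 1) ∷ []) ((β ≺ α ⊞ # 1) ∷ []) (β ≼ α) l))
  ... | tri> _ _ g = ⊥-elim (lin (y ∷ act w (inv w y +ᶻ + 1) ∷ []) ((α ≺ β) ∷ (β ≺ α ⊞ # 1) ∷ []) ff
          (subst (_<ᶻ act w (inv w y +ᶻ + 1)) (act-inv w y) (raise inc same (y<y+1 (inv w y))))
          (subst (act w (inv w y +ᶻ + 1) <ᶻ_) (act-inv w _) (raise inc (trans (sym same) e) g)))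
    where
    same : blk (inv w y) ≡ blk (inv w y +ᶻ + 1)
    same = ℤP.≤-antisym (blk-mono (ℤP.<⇒≤ (y<y+1 (inv w y))))
      (ℤP.≤-trans (blk-mono (ℤP.<⇒≤ g)) (ℤP.≤-reflexive (sym e)))

  private
    ∼-act : ∀ (u : Word k) {x z} → x ∼ z → act u x ∼ act u z
    ∼-act u {x} {z} (l , e) = l , trans (cong (act u) e) (act-shift u z l)

  -- Blocks end at the multiples of n, so p is not one of them and its letter is not s_0.
  inner-letter : ∀ p → blk p ≡ blk (p +ᶻ + 1) → ∃[ j ] fin p ≡ Fin.suc j
  inner-letter p e with fin p in eq
  ... | Fin.suc j = j , refl
  ... | Fin.zero  = ⊥-elim (ℤP.<-irrefl e (subst (blk p <ᶻ_) (sym next) (lin (quo p ∷ blk p ∷ []) ((β ≐ α ⊟ # 1) ∷ []) (β ≺ α) here′)))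
    where
    rem0 : rem p ≡ 0
    rem0 = trans (sym (toℕ-fin p)) (cong toℕ eq)
    p≡ : p ≡ quo p ∙N
    p≡ = lin (p ∷ + rem p ∷ quo p ∙N ∷ []) ((α ≐ β ⊞ γ) ∷ (β ≐ # 0) ∷ []) (α ≐ γ) (rem-quo p) (cong +_ rem0)
    here′ : blk p ≡ quo p -ᶻ + 1
    here′ = blk-unique N _ (ℤP.<⇒≤ 1<N) ℤP.≤-refl
      (lin (p ∷ quo p ∙N ∷ N ∷ (quo p -ᶻ + 1) ∙N ∷ + 1 ∙N ∷ []) ((α ≐ β) ∷ (ζ ≐ β ⊟ η) ∷ (η ≐ γ) ∷ []) (α ≐ γ ⊞ ζ) p≡ (N-sub (quo p) (+ 1)) N-one)
    next : blk (p +ᶻ + 1) ≡ quo p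
    next = blk-unique (+ 1) _ ℤP.≤-refl (ℤP.<⇒≤ 1<N) (lin (p ∷ quo p ∙N ∷ []) ((α ≐ β) ∷ []) (α ⊞ # 1 ≐ # 1 ⊞ β) p≡)

  -- With equal blocks the letter passes through `w` to become one of s_1, ..., s_k on the right:
  -- s_y w lies in the coset of `w` and is not Grassmannian. This is the case in which `D` differs
  -- from the ordinary Demazure action.
  slide : ∀ {w} → Incr w → ∀ y → block w y ≡ block w (y +ᶻ + 1) → ∃[ j ] fin y ∷ w ≈W w ++ Fin.suc j ∷ []
  slide {w} inc y e with inner-letter (inv w y) (trans e (cong blk (adjacent {w} inc y e)))
  ... | j , fj = j , λ x → trans (act-fin y w x) (trans (cong (s y ∘ act w) (sym (s-involutive (ι i) x)))
        (trans (conj-letter y i w sw _) (sym (trans (act-++ w (i ∷ []) x) (cong (act w) (act-∷ i [] x))))))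
    where
    i = Fin.suc j
    p = inv w y
    near : ι i ∼ p
    near = subst (λ t → ι t ∼ p) fj (ι-fin p)
    sw : Swaps y (act w (ι i)) (act w (ι i +ᶻ + 1))
    sw with near
    ... | l , q = inj₁ (subst (act w (ι i) ∼_) (act-inv w y) (∼-act w near) , (begin
        act w (ι i +ᶻ + 1)          ≡⟨ cong (act w) (trans (cong (_+ᶻ + 1) q) (lin (p ∷ l ∙N ∷ inv w (y +ᶻ + 1) ∷ []) ((γ ≐ α ⊞ # 1) ∷ []) (α ⊞ β ⊞ # 1 ≐ γ ⊞ β) (adjacent {w} inc y e))) ⟩
        act w (inv w (y +ᶻ + 1) +ᶻ l ∙N) ≡⟨ trans (act-shift w _ l) (cong (_+ᶻ l ∙N) (act-inv w _)) ⟩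
        y +ᶻ + 1 +ᶻ l ∙N            ≡⟨ lin (y ∷ l ∙N ∷ act w (ι i) ∷ []) ((γ ≐ α ⊞ β) ∷ []) (α ⊞ # 1 ⊞ β ≐ γ ⊞ # 1)
                                         (trans (cong (act w) q) (trans (act-shift w p l) (cong (_+ᶻ l ∙N) (act-inv w y)))) ⟩
        act w (ι i) +ᶻ + 1          ∎))
      where open ≡-Reasoning

  private
    positions-of : ∀ w {a y l} → act w a ≡ y +ᶻ l ∙N → a ≡ inv w y +ᶻ l ∙N
    positions-of w {a} {y} {l} e = trans (sym (inv-act w a)) (trans (cong (inv w) e) (inv-shift w y l))

    same-block : ∀ {p q a b l} → p ≡ a +ᶻ l ∙N → q ≡ b +ᶻ l ∙N → blk p ≡ blk q → blk a ≡ blk b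
    same-block {p} {q} {a} {b} {l} e f g = lin (blk a ∷ blk b ∷ l ∷ blk p ∷ blk q ∷ []) ((ζ ≐ α ⊞ γ) ∷ (η ≐ β ⊞ γ) ∷ (ζ ≐ η) ∷ []) (α ≐ β)
      (trans (cong blk e) (blk-shift a l)) (trans (cong blk f) (blk-shift b l)) g

  -- The letter reverses only the values y, y + 1 and their translates, and these never share a
  -- block.
  Incr-∷ : ∀ {w} → Incr w → ∀ y → block w y ≢ block w (y +ᶻ + 1) → Incr (fin y ∷ w)
  raise (Incr-∷ {w} inc y ne) {p} {q} e p<q with s-monotone y (raise inc e p<q)
  ... | inj₁ lt = subst₂ _<ᶻ_ (sym (act-fin y w p)) (sym (act-fin y w q)) lt
  ... | inj₂ ((l , a) , b) = ⊥-elim (ne (same-block (positions-of w a)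
          (positions-of w (trans b (trans (cong (_+ᶻ + 1) a) (lin (y ∷ l ∙N ∷ []) [] (α ⊞ β ⊞ # 1 ≐ α ⊞ # 1 ⊞ β))))) e))

  Incr-∷⁻¹ : ∀ {w} y → Incr (fin y ∷ w) → inv w y <ᶻ inv w (y +ᶻ + 1) → Incr w
  raise (Incr-∷⁻¹ {w} y inc lt) {p} {q} e p<q with s-monotone y (subst₂ _<ᶻ_ (act-fin y w p) (act-fin y w q) (raise inc e p<q))
  ... | inj₁ l = subst₂ _<ᶻ_ (s-involutive y _) (s-involutive y _) l
  ... | inj₂ ((l , a) , b) = ⊥-elim (lin (inv w y ∷ inv w (y +ᶻ + 1) ∷ l ∙N ∷ p ∷ q ∷ []) ((α ≺ β) ∷ (ζ ≐ β ⊞ γ) ∷ (η ≐ α ⊞ γ) ∷ (ζ ≺ η) ∷ []) ff lt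
        (positions-of w at-p) (positions-of w at-q) p<q)
    where
    at-p : act w p ≡ y +ᶻ + 1 +ᶻ l ∙N
    at-p = trans (sym (s-involutive y (act w p))) (trans (cong (s y) a) (trans (s-up y (y +ᶻ l ∙N) (l , refl))
      (lin (y ∷ l ∙N ∷ []) [] (α ⊞ β ⊞ # 1 ≐ α ⊞ # 1 ⊞ β))))
    at-q : act w q ≡ y +ᶻ l ∙N
    at-q = trans (sym (s-involutive y (act w q))) (trans (cong (s y) (trans b (trans (cong (_+ᶻ + 1) a)
      (lin (y ∷ l ∙N ∷ []) [] (α ⊞ β ⊞ # 1 ≐ α ⊞ # 1 ⊞ β))))) (trans (s-down y (y +ᶻ + 1 +ᶻ l ∙N) (l , refl))
      (lin (y ∷ l ∙N ∷ []) [] (α ⊞ # 1 ⊞ β ⊟ # 1 ≐ α ⊞ β))))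

  Up : ℤ → Word k → Set
  Up y w = block w y <ᶻ block w (y +ᶻ + 1)

  left-rise : ∀ {w} → Incr w → ∀ y → block w y ≤ᶻ block w (y +ᶻ + 1) → inv w y <ᶻ inv w (y +ᶻ + 1)
  left-rise {w} inc y le with ℤP.<-cmp (block w y) (block w (y +ᶻ + 1))
  ... | tri< l _ _ = blk-< l
  ... | tri≈ _ e _ = Incr-inv {w} inc e (y<y+1 y)
  ... | tri> _ _ g = ⊥-elim (ℤP.<⇒≱ g le)

  -- If the two blocks were equal, s_y w would reverse the two positions inside that block.
  rise⇒Up : ∀ {w} y → Incr (fin y ∷ w) → inv w y <ᶻ inv w (y +ᶻ + 1) → Up y w
  rise⇒Up {w} y inc lt with ℤP.<-cmp (block w y) (block w (y +ᶻ + 1))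
  ... | tri< l _ _ = l
  ... | tri> _ _ g = ⊥-elim (ℤP.<-asym lt (blk-< g))
  ... | tri≈ _ e _ = ⊥-elim (ℤP.<-asym (y<y+1 y) (subst₂ _<ᶻ_ {act (fin y ∷ w) (inv w y)} {y +ᶻ + 1} {act (fin y ∷ w) (inv w (y +ᶻ + 1))} {y}
      (value y (s-self y)) (value (y +ᶻ + 1) (s-next y)) (raise inc {inv w y} {inv w (y +ᶻ + 1)} e lt)))
    where
    value : ∀ z {c} → s y z ≡ c → act (fin y ∷ w) (inv w z) ≡ c
    value z f = trans (act-fin y w (inv w z)) (trans (cong (s y) (act-inv w z)) f)

  block-class : ∀ w {y z} → y ∼ z → ∃[ l ] block w y ≡ block w z +ᶻ l × block w (y +ᶻ + 1) ≡ block w (z +ᶻ + 1) +ᶻ l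
  block-class w {y} {z} (l , e) = l , trans (cong (block w) e) (block-shift w z l)
    , trans (cong (block w) (trans (cong (_+ᶻ + 1) e) (lin (z ∷ l ∙N ∷ []) [] (α ⊞ β ⊞ # 1 ≐ α ⊞ # 1 ⊞ β)))) (block-shift w _ l)

  Up-class : ∀ w {y z} → y ∼ z → Up y w → Up z w
  Up-class w {y} {z} c u = compare (block-class w c) u
    where
    compare : ∀ {a b a′ b′} → ∃[ l ] a ≡ a′ +ᶻ l × b ≡ b′ +ᶻ l → a <ᶻ b → a′ <ᶻ b′
    compare {a} {b} {a′} {b′} (l , e , f) u = lin (a ∷ b ∷ a′ ∷ b′ ∷ l ∷ [])
        ((α ≺ β) ∷ (α ≐ γ ⊞ η) ∷ (β ≐ ζ ⊞ η) ∷ []) (γ ≺ ζ) u e f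

  Up-cong : ∀ {v w} y → v ≈W w → Up y v → Up y w
  Up-cong {v} {w} y e = subst₂ _<ᶻ_ (block-cong {v} {w} e y) (block-cong {v} {w} e _)

  Up? : ∀ y w → Dec (Up y w)
  Up? y w = block w y ℤP.<? block w (y +ᶻ + 1)

  -- The Demazure action of a letter, truncated to affine Grassmannian elements.
  D : Fin (suc k) → Word k → Word k
  D i w with Up? (ι i) w
  ... | yes _ = i ∷ w
  ... | no _  = w

  D-yes : ∀ {i w} → Up (ι i) w → D i w ≡ i ∷ w
  D-yes {i} {w} u with Up? (ι i) w
  ... | yes _ = refl
  ... | no n  = contradiction u n

  D-no : ∀ {i w} → ¬ Up (ι i) w → D i w ≡ w
  D-no {i} {w} n with Up? (ι i) w
  ... | yes u = contradiction u n
  ... | no _  = refl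

  D-cong : ∀ i {v w} → v ≈W w → D i v ≈W D i w
  D-cong i {v} {w} e with Up? (ι i) v | Up? (ι i) w
  ... | yes _ | yes _ = ∷-cong i {v} {w} e
  ... | no _  | no _  = e
  ... | yes u | no n  = ⊥-elim (n (Up-cong {v} {w} (ι i) e u))
  ... | no n  | yes u = ⊥-elim (n (Up-cong {w} {v} (ι i) (≈W-sym {v} {w} e) u))

  Incr-∷ᵢ : ∀ {w} → Incr w → ∀ i → block w (ι i) ≢ block w (ι i +ᶻ + 1) → Incr (i ∷ w)
  Incr-∷ᵢ {w} inc i ne = subst (λ j → Incr (j ∷ w)) (fin-ι i) (Incr-∷ {w} inc (ι i) ne)

  D-Incr : ∀ i {w} → Incr w → Incr (D i w)
  D-Incr i {w} inc with Up? (ι i) w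
  ... | yes u = Incr-∷ᵢ {w} inc i (λ e → ℤP.<-irrefl e u)
  ... | no _  = inc

  δ : Word k → Word k
  δ = foldr D []

  δ-Incr : ∀ u → Incr (δ u)
  δ-Incr []      = Incr-[]
  δ-Incr (i ∷ u) = D-Incr i {δ u} (δ-Incr u)

  private
    -- A suffix of a reduced word of a Grassmannian element is again reduced and Grassmannian
    -- (`Incr-∷⁻¹`), so every letter acts effectively and `D` just prepends it.
    δ-reduced : ∀ v → ℓ v ≡ length v → Incr v → δ v ≈W v
    δ-reduced []      _ _   x = refl
    δ-reduced (i ∷ v) e inc = ≈W-trans {D i (δ v)} {D i v} {i ∷ v} (D-cong i {δ v} {v} (δ-reduced v ev inc-v))
        (λ x → cong (λ w → act w x) (D-yes {i} {v} (rise⇒Up {v} (ι i) inc′ rise)))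
      where
      ev : ℓ v ≡ length v
      ev = ℕP.≤-antisym (ℓ-≤ v v (λ _ → refl)) (ℕP.≤-pred (subst (_≤ suc (ℓ v)) e (ℓ-∷ i v)))
      inc′ = subst (λ j → Incr (j ∷ v)) (sym (fin-ι i)) inc
      rise : inv v (ι i) <ᶻ inv v (ι i +ᶻ + 1)
      rise = left-up⁻¹ (ι i) v (subst (ℓ v <_) (sym (trans (cong (λ j → ℓ (j ∷ v)) (fin-ι i)) e)) (s≤s (ℕP.≤-reflexive ev)))
      inc-v : Incr v
      inc-v = Incr-∷⁻¹ {v} (ι i) inc′ rise

  δ-surjective : ∀ {w} → Incr w → ∃[ u ] δ u ≈W w
  δ-surjective {w} inc with ℓ-reduced w
  ... | v , e , lv = v , ≈W-trans {δ v} {v} {w} (δ-reduced v (trans (ℓ-cong {v} {w} e) (sym lv)) (Incr-cong {w} {v} (≈W-sym {v} {w} e) inc)) e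

  -- Bruhat ideals

  -- Arranged so that each member x of the new ideal is produced once: from s_i x if b(i) > b(i+1)
  -- in x, and from x itself otherwise. An element with b(i) > b(i+1) yields nothing, as it is
  -- already produced from its shorter partner.
  expand : Fin (suc k) → Word k → List (Word k)
  expand i v with ℤP.<-cmp (block v (ι i)) (block v (ι i +ᶻ + 1))
  ... | tri< _ _ _ = v ∷ (i ∷ v) ∷ []
  ... | tri≈ _ _ _ = v ∷ []
  ... | tri> _ _ _ = []

  ideal : Word k → List (Word k)
  ideal []      = [] ∷ []
  ideal (i ∷ u) = concatMap (expand i) (ideal u)

  infix 4 _≉W_
  _≉W_ : Word k → Word k → Set
  u ≉W v = ¬ (u ≈W v)

  record Enumerates (w : Word k) (L : List (Word k)) : Set where
    field
      all-Incr     : All Incr L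
      all-≤    : All (_≤B w) L
      all-≉ : AllPairs _≉W_ L
      covers : ∀ x → Incr x → x ≤B w → Any (x ≈W_) L

  open Enumerates

  rises : ∀ {v} → Incr v → ∀ i → block v (ι i) ≤ᶻ block v (ι i +ᶻ + 1) → ℓ v < ℓ (i ∷ v)
  rises {v} inc i le = subst (λ j → ℓ v < ℓ (j ∷ v)) (fin-ι i) (left-up (ι i) v (left-rise {v} inc (ι i) le))

  falls : ∀ {v} i → block v (ι i +ᶻ + 1) <ᶻ block v (ι i) → ℓ (i ∷ v) < ℓ v
  falls {v} i lt = subst (λ j → ℓ (j ∷ v) < ℓ v) (fin-ι i) (left-down (ι i) v (blk-< lt))

  block-∷ : ∀ i v x → block (i ∷ v) x ≡ block v (s (ι i) x)
  block-∷ i v x = cong blk (inv-∷ i v x)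

  block-∷-self : ∀ i v → block (i ∷ v) (ι i) ≡ block v (ι i +ᶻ + 1)
  block-∷-self i v = trans (block-∷ i v (ι i)) (cong (block v) (s-self (ι i)))

  block-∷-next : ∀ i v → block (i ∷ v) (ι i +ᶻ + 1) ≡ block v (ι i)
  block-∷-next i v = trans (block-∷ i v _) (cong (block v) (s-next (ι i)))

  slideᵢ : ∀ {w} → Incr w → ∀ i → block w (ι i) ≡ block w (ι i +ᶻ + 1) → ∃[ j ] i ∷ w ≈W w ++ Fin.suc j ∷ []
  slideᵢ {w} inc i e = subst (λ t → ∃[ j ] t ∷ w ≈W w ++ Fin.suc j ∷ []) (fin-ι i) (slide {w} inc (ι i) e)

  Incr-rises : ∀ {w} → Incr w → ∀ j → ℓ w < ℓ (w ++ Fin.suc j ∷ [])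
  Incr-rises {w} inc j = subst₂ _<_ (sym (ℓ-def w)) (sym (ℓ-def (w ++ Fin.suc j ∷ []))) (Incr⇒Grass {w} inc j)

  private
    -- The delicate case is that of equal blocks, where `Left.upper i w` is s_i w = w s_j but
    -- `D i w` is only w. As x is minimal in its coset, it equals its `Right.lower`, and lifting on
    -- the right brings x ≤ w s_j down to x ≤ w.
    ≤-upper⇒≤-D : ∀ {w x} i → Incr w → Incr x → x ≤B Left.upper i w → x ≤B D i w
    ≤-upper⇒≤-D {w} {x} i inc inc-x le = decide (ℤP.<-cmp (block w (ι i)) (block w (ι i +ᶻ + 1)))
      where
      decide : _ → x ≤B D i w
      decide (tri< u _ _) = subst (x ≤B_) (trans (Left.upper-asc i w (rises {w} inc i (ℤP.<⇒≤ u))) (sym (D-yes {i} {w} u))) le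
      decide (tri> n _ g) = subst (x ≤B_) (trans (Left.upper-desc i w (falls {w} i g)) (sym (D-no {i} {w} n))) le
      decide (tri≈ n e _) = subst (x ≤B_) (sym (D-no {i} {w} n)) (transfer (slideᵢ {w} inc i e))
        where
        transfer : ∃[ j ] i ∷ w ≈W w ++ Fin.suc j ∷ [] → x ≤B w
        transfer (j , q) = subst (_≤B w) (Right.lower-asc (Fin.suc j) x (Incr-rises {x} inc-x j))
          (≤B-trans (Right.lower-mono (Fin.suc j) (≤B-congʳ (subst (x ≤B_) (Left.upper-asc i w (rises {w} inc i (ℤP.≤-reflexive e))) le) q))
            (≤B-congʳ (proj₂ (Right.lower≤ (Fin.suc j) (w ++ Fin.suc j ∷ []))) (∷ʳ-involutive (Fin.suc j) w)))

    ≤-D : ∀ {w} i → Incr w → w ≤B D i w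
    ≤-D {w} i inc with Up? (ι i) w
    ... | yes u = subst (w ≤B_) (Left.upper-asc i w (rises {w} inc i (ℤP.<⇒≤ u))) (proj₁ (Left.≤upper i w))
    ... | no _  = ≤B-refl refl

    lower-D : ∀ {w} i → Left.lower i (D i w) ≤B w
    lower-D {w} i with Up? (ι i) w
    ... | yes u = ≤B-congʳ (proj₂ (Left.lower≤ i (i ∷ w))) (∷∷-cancel i w)
    ... | no _  = proj₁ (Left.lower≤ i w)

    expand-All : ∀ {P : Word k → Set} i {v} → P v → (Up (ι i) v → P (i ∷ v)) → All P (expand i v)
    expand-All i {v} pv piv with ℤP.<-cmp (block v (ι i)) (block v (ι i +ᶻ + 1))
    ... | tri< u _ _ = pv ∷ piv u ∷ []
    ... | tri≈ _ _ _ = pv ∷ []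
    ... | tri> _ _ _ = []

    expand-All′ : ∀ {P : Word k → Set} i {v} → (block v (ι i) ≤ᶻ block v (ι i +ᶻ + 1) → P v) → (Up (ι i) v → P (i ∷ v)) → All P (expand i v)
    expand-All′ i {v} pv piv with ℤP.<-cmp (block v (ι i)) (block v (ι i +ᶻ + 1))
    ... | tri< u _ _ = pv (ℤP.<⇒≤ u) ∷ piv u ∷ []
    ... | tri≈ _ e _ = pv (ℤP.≤-reflexive e) ∷ []
    ... | tri> _ _ _ = []

    expand-self : ∀ {P : Word k → Set} i {v} → block v (ι i) ≤ᶻ block v (ι i +ᶻ + 1) → P v → Any P (expand i v)
    expand-self i {v} le pv with ℤP.<-cmp (block v (ι i)) (block v (ι i +ᶻ + 1))
    ... | tri< _ _ _ = here pv
    ... | tri≈ _ _ _ = here pv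
    ... | tri> _ _ g = ⊥-elim (ℤP.<⇒≱ g le)

    expand-next : ∀ {P : Word k → Set} i {v} → Up (ι i) v → P (i ∷ v) → Any P (expand i v)
    expand-next i {v} u pv with ℤP.<-cmp (block v (ι i)) (block v (ι i +ᶻ + 1))
    ... | tri< _ _ _ = there (here pv)
    ... | tri≈ n _ _ = ⊥-elim (n u)
    ... | tri> n _ _ = ⊥-elim (n u)

    self≉next : ∀ i {v w} → block v (ι i) ≤ᶻ block v (ι i +ᶻ + 1) → Up (ι i) w → v ≉W i ∷ w
    self≉next i {v} {w} le u e = ℤP.<⇒≱ u (subst₂ _≤ᶻ_ (trans (block-cong {v} {i ∷ w} e _) (block-∷-self i w)) (trans (block-cong {v} {i ∷ w} e _) (block-∷-next i w)) le)

    ∷-cancel : ∀ i {v w : Word k} → i ∷ v ≈W i ∷ w → v ≈W w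
    ∷-cancel i {v} {w} e = ≈W-trans {v} {i ∷ i ∷ v} {w} (≈W-sym {i ∷ i ∷ v} {v} (∷∷-cancel i v))
      (≈W-trans {i ∷ i ∷ v} {i ∷ i ∷ w} {w} (∷-cong i {i ∷ v} {i ∷ w} e) (∷∷-cancel i w))

    expand-distinct : ∀ i v → AllPairs _≉W_ (expand i v)
    expand-distinct i v with ℤP.<-cmp (block v (ι i)) (block v (ι i +ᶻ + 1))
    ... | tri< u _ _ = (self≉next i {v} {v} (ℤP.<⇒≤ u) u ∷ []) ∷ [] ∷ []
    ... | tri≈ _ _ _ = [] ∷ []
    ... | tri> _ _ _ = []

    expand-separate : ∀ i {v w} → v ≉W w → All (λ x → All (x ≉W_) (expand i w)) (expand i v)
    expand-separate i {v} {w} ne = expand-All′ i {v}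
      (λ le → expand-All i {w} ne (λ u → self≉next i {v} {w} le u))
      (λ u → expand-All′ i {w} (λ le e → self≉next i {w} {v} le u (≈W-sym {i ∷ v} {w} e)) (λ _ e → ne (∷-cancel i {v} {w} e)))

    concatMap-distinct : ∀ i L → AllPairs _≉W_ L → AllPairs _≉W_ (concatMap (expand i) L)
    concatMap-distinct i []      []       = []
    concatMap-distinct i (v ∷ L) (n ∷ ns) = AllPairs-++ (expand-distinct i v) (concatMap-distinct i L ns) (separate L n)
      where
      AllPairs-++ : ∀ {xs ys} → AllPairs _≉W_ xs → AllPairs _≉W_ ys → All (λ x → All (x ≉W_) ys) xs → AllPairs _≉W_ (xs ++ ys)
      AllPairs-++ []       q _        = q
      AllPairs-++ (p ∷ ps) q (r ∷ rs) = AllP.++⁺ p r ∷ AllPairs-++ ps q rs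
      zip-++ : ∀ {xs ys zs} → All (λ x → All (x ≉W_) ys) xs → All (λ x → All (x ≉W_) zs) xs → All (λ x → All (x ≉W_) (ys ++ zs)) xs
      zip-++ []       []       = []
      zip-++ (p ∷ ps) (q ∷ qs) = AllP.++⁺ p q ∷ zip-++ ps qs
      separate : ∀ L → All (v ≉W_) L → All (λ x → All (x ≉W_) (concatMap (expand i) L)) (expand i v)
      separate []      []       = All.universal (λ _ → []) (expand i v)
      separate (w ∷ L) (n ∷ ns) = zip-++ (expand-separate i {v} {w} n) (separate L ns)

    ℓ-mono : ∀ {x y : Word k} → x ≤B y → ℓ x ≤ ℓ y
    ℓ-mono {x} {y} (≤B-refl e) = ℕP.≤-reflexive (ℓ-cong {x} {y} (≡W⇒≈W {x} {y} e))
    ℓ-mono {x} (≤B-step {y = y} {z = z} u i h e l) = ℕP.≤-trans (ℓ-mono h) (ℕP.<⇒≤ (subst₂ _<_ (sym (ℓ-def y)) (sym (ℓ-def z)) l))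

  ℓ≡0⇒[] : ∀ {x : Word k} → ℓ x ≡ 0 → x ≈W []
  ℓ≡0⇒[] {x} e with ℓ-reduced x
  ... | [] , q , _ = ≈W-sym {[]} {x} q
  ... | (_ ∷ _) , _ , lv with trans lv e
  ...   | ()

  Enumerates-[] : Enumerates [] ([] ∷ [])
  Enumerates-[] = record
    { all-Incr     = Incr-[] ∷ []
    ; all-≤    = ≤B-refl refl ∷ []
    ; all-≉ = [] ∷ []
    ; covers = λ x _ le → here (ℓ≡0⇒[] {x} (ℕP.n≤0⇒n≡0 (subst (ℓ x ≤_) ℓ-[] (ℓ-mono le))))
    }

  -- Left lifting gives both inclusions: v ≤ w yields `upper v ≤ upper w`, and x ≤ D i w yields
  -- `lower x ≤ w`, where `lower x` is the element from which `expand` produces x.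
  Enumerates-D : ∀ {w L} i → Incr w → Enumerates w L → Enumerates (D i w) (concatMap (expand i) L)
  Enumerates-D {w} {L} i inc en = record
    { all-Incr     = concatMap-All {P = Incr} {Q = Incr} (expand i) (λ v inc-v → expand-All {P = Incr} i {v} inc-v (λ u → Incr-∷ᵢ {v} inc-v i (λ e → ℤP.<-irrefl e u))) (all-Incr en)
    ; all-≤    = concatMap-All (expand i) (λ v pv → expand-All i {v} (≤B-trans (proj₂ pv) (≤-D {w} i inc))
                   (λ u → ≤-upper⇒≤-D {w} {i ∷ v} i inc (Incr-∷ᵢ {v} (proj₁ pv) i (λ e → ℤP.<-irrefl e u))
                     (≤B-trans (proj₂ (Left.≤upper i v)) (Left.upper-mono i (proj₂ pv)))))
                   (All.zipWith id (all-Incr en , all-≤ en))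
    ; all-≉ = concatMap-distinct i L (all-≉ en)
    ; covers = found
    }
    where
    found : ∀ x → Incr x → x ≤B D i w → Any (x ≈W_) (concatMap (expand i) L)
    found x inc-x le = decide (ℤP.<-cmp (block x (ι i)) (block x (ι i +ᶻ + 1)))
      where
      lower-x : Left.lower i x ≤B w
      lower-x = ≤B-trans (Left.lower-mono i le) (lower-D {w} i)
      stays : block x (ι i) ≤ᶻ block x (ι i +ᶻ + 1) → Any (x ≈W_) (concatMap (expand i) L)
      stays r = AnyP.concatMap⁺ (expand i) (Any.map (λ {v} e → expand-self i {v} (subst₂ _≤ᶻ_ (block-cong {x} {v} e _) (block-cong {x} {v} e _) r) e)
        (covers en x inc-x (subst (_≤B w) (Left.lower-asc i x (rises {x} inc-x i r)) lower-x)))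
      decide : _ → Any (x ≈W_) (concatMap (expand i) L)
      decide (tri< r _ _) = stays (ℤP.<⇒≤ r)
      decide (tri≈ _ e _) = stays (ℤP.≤-reflexive e)
      decide (tri> _ _ g) = AnyP.concatMap⁺ (expand i) (Any.map (λ {v} e → expand-next i {v}
          (Up-cong {i ∷ x} {v} (ι i) e (subst₂ _<ᶻ_ (sym (block-∷-self i x)) (sym (block-∷-next i x)) g))
          (≈W-trans {x} {i ∷ i ∷ x} {i ∷ v} (≈W-sym {i ∷ i ∷ x} {x} (∷∷-cancel i x)) (∷-cong i {i ∷ x} {v} e)))
        (covers en (i ∷ x) (Incr-∷ᵢ {x} inc-x i (λ e → ℤP.<-irrefl (sym e) g)) (subst (_≤B w) (Left.lower-desc i x (falls {x} i g)) lower-x)))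

  ideal-enumerates : ∀ u → Enumerates (δ u) (ideal u)
  ideal-enumerates []      = Enumerates-[]
  ideal-enumerates (i ∷ u) = Enumerates-D {δ u} {ideal u} i (δ-Incr u) (ideal-enumerates u)

  Enumerates-cong : ∀ {v w L} → v ≈W w → Enumerates v L → Enumerates w L
  Enumerates-cong {v} {w} e en = record
    { all-Incr     = all-Incr en
    ; all-≤    = All.map (λ le → ≤B-congʳ le e) (all-≤ en)
    ; all-≉ = all-≉ en
    ; covers = λ x inc le → covers en x inc (≤B-congʳ le (≈W-sym {v} {w} e))
    }

  -- Sums over an ideal do not depend on its enumeration

  sum : ∀ {A : Set} → (A → ℤ) → List A → ℤ
  sum G = foldr (λ v → G v +ᶻ_) (+ 0)

  sum-++ : ∀ {A : Set} (G : A → ℤ) xs ys → sum G (xs ++ ys) ≡ sum G xs +ᶻ sum G ys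
  sum-++ G []       ys = sym (ℤP.+-identityˡ _)
  sum-++ G (x ∷ xs) ys = trans (cong (G x +ᶻ_) (sum-++ G xs ys)) (sym (ℤP.+-assoc (G x) (sum G xs) (sum G ys)))

  private
    without : ∀ {P : Word k → Set} {L} → Any P L → List (Word k)
    without {L = _ ∷ L} (here _)  = L
    without {L = x ∷ L} (there p) = x ∷ without p

    the : ∀ {P : Word k → Set} {L} → Any P L → Word k
    the {L = x ∷ _} (here _)  = x
    the {L = _ ∷ _} (there p) = the p

    sum-without : ∀ (G : Word k → ℤ) {P : Word k → Set} {L} (p : Any P L) → sum G L ≡ G (the p) +ᶻ sum G (without p)
    sum-without G (here _) = refl
    sum-without G {L = x ∷ L} (there p) = trans (cong (G x +ᶻ_) (sum-without G p))
      (lin (G x ∷ G (the p) ∷ sum G (without p) ∷ []) [] (α ⊞ (β ⊞ γ) ≐ β ⊞ (α ⊞ γ)))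

    the-holds : ∀ {P : Word k → Set} {L} (p : Any P L) → P (the p)
    the-holds (here h)  = h
    the-holds (there p) = the-holds p

    without-All : ∀ {P Q : Word k → Set} {L} (p : Any P L) → All Q L → All Q (without p)
    without-All (here _)  (_ ∷ as) = as
    without-All (there p) (a ∷ as) = a ∷ without-All p as

    without-distinct : ∀ {P : Word k → Set} {L} (p : Any P L) → AllPairs _≉W_ L → AllPairs _≉W_ (without p)
    without-distinct (here _)  (_ ∷ ns) = ns
    without-distinct (there p) (n ∷ ns) = without-All p n ∷ without-distinct p ns

    without-≉ : ∀ {P : Word k → Set} {L} (p : Any P L) → AllPairs _≉W_ L → All (_≉W the p) (without p)
    without-≉ {L = x ∷ L} (here _) (n ∷ _) = All.map (λ {y} h e → h (≈W-sym {y} {x} e)) n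
    without-≉ {L = x ∷ L} (there p) (n ∷ ns) = lookup-the {x = x} p n ∷ without-≉ p ns
      where
      lookup-the : ∀ {P : Word k → Set} {L x} (p : Any P L) → All (x ≉W_) L → x ≉W the p
      lookup-the (here _)  (a ∷ _)  = a
      lookup-the {x = x} (there p) (_ ∷ as) = lookup-the {x = x} p as

    without-Any : ∀ {P : Word k → Set} {L x} (p : Any P L) → x ≉W the p → Any (x ≈W_) L → Any (x ≈W_) (without p)
    without-Any (here _)  n (here e)  = ⊥-elim (n e)
    without-Any (here _)  n (there q) = q
    without-Any (there p) n (here e)  = here e
    without-Any {x = x} (there p) n (there q) = there (without-Any {x = x} p n q)

  -- Induction on `L`: the partner of its head is struck from `L′`, and distinctness on both sides
  -- ensures that the remaining elements still have their partners.
  sum-unique : ∀ (G : Word k → ℤ) → (∀ {u v} → Incr u → u ≈W v → G u ≡ G v) →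
    ∀ L L′ → All Incr L → AllPairs _≉W_ L → AllPairs _≉W_ L′ → All (λ x → Any (x ≈W_) L′) L → All (λ y → Any (y ≈W_) L) L′ → sum G L ≡ sum G L′
  sum-unique G resp []      []      _ _ _ _ _ = refl
  sum-unique G resp []      (_ ∷ _) _ _ _ _ (() ∷ _)
  sum-unique G resp (x ∷ L) L′ (i ∷ is) (n ∷ ns) ns′ (p ∷ ps) qs =
    trans (cong₂ _+ᶻ_ (resp {x} {the p} i (the-holds {x ≈W_} p)) (sum-unique G resp L (without p) is ns (without-distinct {x ≈W_} p ns′) (tail-in L n ps) (tail-out (without p) (without-≉ p ns′) (without-All p qs))))
      (sym (sum-without G p))
    where
    tail-in : ∀ L → All (x ≉W_) L → All (λ y → Any (y ≈W_) L′) L → All (λ y → Any (y ≈W_) (without p)) L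
    tail-in []      []       []       = []
    tail-in (y ∷ L) (n ∷ ns) (q ∷ qs) = without-Any {P = x ≈W_} {L′} {y} p (λ e → n (≈W-trans {x} {the p} {y} (the-holds {x ≈W_} p) (≈W-sym {y} {the p} e))) q ∷ tail-in L ns qs
    tail-out : ∀ M → All (_≉W the p) M → All (λ y → Any (y ≈W_) (x ∷ L)) M → All (λ y → Any (y ≈W_) L) M
    tail-out []      []       []       = []
    tail-out (y ∷ M) (n ∷ ns) (here e ∷ qs) = ⊥-elim (n (≈W-trans {y} {x} {the p} e (the-holds {x ≈W_} p)))
    tail-out (y ∷ M) (n ∷ ns) (there q ∷ qs) = q ∷ tail-out M ns qs

  Enumerates-sum : ∀ (G : Word k → ℤ) → (∀ {u v} → Incr u → u ≈W v → G u ≡ G v) →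
    ∀ {w L L′} → Enumerates w L → Enumerates w L′ → sum G L ≡ sum G L′
  Enumerates-sum G resp {w} {L} {L′} en en′ = sum-unique G resp L L′ (all-Incr en) (all-≉ en) (all-≉ en′) (covered en en′) (covered en′ en)
    where
    covered : ∀ {L L′} → Enumerates w L → Enumerates w L′ → All (λ x → Any (x ≈W_) L′) L
    covered {L} {L′} a b = All.map {P = λ x → Incr x × x ≤B w} {Q = λ x → Any (x ≈W_) L′} (λ {x} p → covers b x (proj₁ p) (proj₂ p)) (All.zipWith id (all-Incr a , all-≤ a))

  -- Cyclically decreasing words

  descending ascending : ℤ → ℕ → List (Fin (suc k))
  descending m zero    = []
  descending m (suc c) = fin (m -ᶻ + 1) ∷ descending (m -ᶻ + 1) c
  ascending m zero    = []
  ascending m (suc c) = fin m ∷ ascending (m +ᶻ + 1) c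

  private
    -1-cancel : ∀ m → m +ᶻ + 1 -ᶻ + 1 ≡ m
    -1-cancel m = lin (m ∷ []) [] (α ⊞ # 1 ⊟ # 1 ≐ α)

  descending-++ : ∀ m a b → descending m (a ℕ.+ b) ≡ descending m a ++ descending (m -ᶻ + a) b
  descending-++ m zero    b = cong (λ t → descending t b) (sym (ℤP.+-identityʳ m))
  descending-++ m (suc a) b = cong (fin (m -ᶻ + 1) ∷_) (trans (descending-++ (m -ᶻ + 1) a b)
    (cong (λ t → descending (m -ᶻ + 1) a ++ descending t b) (lin (m ∷ + a ∷ []) [] (α ⊟ # 1 ⊟ β ≐ α ⊟ (# 1 ⊞ β)))))

  ascending-∷ʳ : ∀ m c → ascending m (suc c) ≡ ascending m c ++ fin (m +ᶻ + c) ∷ []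
  ascending-∷ʳ m zero    = cong (λ t → fin t ∷ []) (sym (ℤP.+-identityʳ m))
  ascending-∷ʳ m (suc c) = cong (fin m ∷_) (trans (ascending-∷ʳ (m +ᶻ + 1) c)
    (cong (λ t → ascending (m +ᶻ + 1) c ++ fin t ∷ []) (ℤP.+-assoc m (+ 1) (+ c))))

  descending-cong : ∀ {m m′} c → m ∼ m′ → descending m c ≡ descending m′ c
  descending-cong zero    e = refl
  descending-cong (suc c) e = cong₂ _∷_ (fin-cong (∼-+ (-ᶻ (+ 1)) e)) (descending-cong c (∼-+ (-ᶻ (+ 1)) e))

  private
    applyUpTo-descending : ∀ (f : ℕ → Fin (suc k)) m c → (∀ d → d < c → f d ≡ fin (m -ᶻ + suc d)) → applyUpTo f c ≡ descending m c
    applyUpTo-descending f m zero    e = refl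
    applyUpTo-descending f m (suc c) e = cong₂ _∷_ (e 0 (s≤s z≤n)) (applyUpTo-descending (f ∘ suc) (m -ᶻ + 1) c
      (λ d d<c → trans (e (suc d) (s≤s d<c)) (cong fin (lin (m ∷ + d ∷ []) [] (α ⊟ (# 2 ⊞ β) ≐ α ⊟ # 1 ⊟ (# 1 ⊞ β))))))

  opaque
    unfolding rem

    fin-mod : ∀ m → m mod suc k ≡ fin (+ m)
    fin-mod m = FinP.toℕ-injective (trans (FinP.toℕ-fromℕ< _) (sym (toℕ-fin (+ m))))

  -- The cyclically decreasing word of `A` with a free starting point m, meant to be a class outside
  -- `A`; `dA` is the case of the first missing class.
  descendingWord : ℤ → Subset k → Word k
  descendingWord m A = List.filterᵇ (Vec.lookup A) (descending m k)

  dword≡ : ∀ (A : Subset k) → dA A ≡ descendingWord (ι (missing A)) A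
  dword≡ A = cong (List.filterᵇ (Vec.lookup A)) (trans (ListP.map-applyUpTo suc (λ d → (toℕ (missing A) ℕ.+ suc k ∸ d) mod suc k) k)
    (applyUpTo-descending _ (ι (missing A)) k (λ d d<k → letter d (ℕP.m≤n⇒m≤1+n d<k))))
    where
    letter : ∀ d → d < suc k → (toℕ (missing A) ℕ.+ suc k ∸ suc d) mod suc k ≡ fin (ι (missing A) -ᶻ + suc d)
    -- Adding n before the subtraction of naturals leaves the value one full turn above
    -- `missing A - (d + 1)`, hence the witness `+ 1`.
    letter d d<n = trans (fin-mod (toℕ (missing A) ℕ.+ suc k ∸ suc d)) (fin-cong {+ (toℕ (missing A) ℕ.+ suc k ∸ suc d)} {ι (missing A) -ᶻ + suc d} (+ 1 , (begin
        + (toℕ (missing A) ℕ.+ suc k ∸ suc d)     ≡⟨ ℤP.⊖-≥ (ℕP.≤-trans d<n (ℕP.m≤n+m (suc k) (toℕ (missing A)))) ⟨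
        (toℕ (missing A) ℕ.+ suc k) ℤ.⊖ suc d     ≡⟨ ℤP.[+m]-[+n]≡m⊖n (toℕ (missing A) ℕ.+ suc k) (suc d) ⟨
        ι (missing A) +ᶻ N -ᶻ + suc d             ≡⟨ lin (ι (missing A) ∷ N ∷ + suc d ∷ + 1 ∙N ∷ []) ((ζ ≐ β) ∷ []) (α ⊞ β ⊟ γ ≐ α ⊟ γ ⊞ ζ) N-one ⟩
        ι (missing A) -ᶻ + suc d +ᶻ + 1 ∙N        ∎)))
      where open ≡-Reasoning

  filterᵇ-++ : ∀ {A : Set} (p : A → Bool) xs ys → List.filterᵇ p (xs ++ ys) ≡ List.filterᵇ p xs ++ List.filterᵇ p ys
  filterᵇ-++ p []       ys = refl
  filterᵇ-++ p (x ∷ xs) ys with p x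
  ... | true  = cong (x ∷_) (filterᵇ-++ p xs ys)
  ... | false = filterᵇ-++ p xs ys

  private
    count : (Fin (suc k) → Bool) → List (Fin (suc k)) → ℕ
    count p xs = length (List.filterᵇ p xs)

    count-++ : ∀ p xs ys → count p (xs ++ ys) ≡ count p xs ℕ.+ count p ys
    count-++ p xs ys = trans (cong length (filterᵇ-++ p xs ys)) (ListP.length-++ (List.filterᵇ p xs))

    count-swap : ∀ p xs i → count p (xs ++ i ∷ []) ≡ count p (i ∷ xs)
    count-swap p xs i = trans (count-++ p xs (i ∷ [])) (trans (ℕP.+-comm (count p xs) _) (sym (count-++ p (i ∷ []) xs)))

    count-∷ : ∀ p i {xs ys} → count p xs ≡ count p ys → count p (i ∷ xs) ≡ count p (i ∷ ys)
    count-∷ p i e with p i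
    ... | true  = cong suc e
    ... | false = e

    count-direction : ∀ p m c → count p (descending (m +ᶻ + c) c) ≡ count p (ascending m c)
    count-direction p m zero    = refl
    count-direction p m (suc c) = trans
      (trans (cong (λ t → count p (fin t ∷ descending t c)) (lin (m ∷ + c ∷ []) [] (α ⊞ (# 1 ⊞ β) ⊟ # 1 ≐ α ⊞ β)))
        (count-∷ p (fin (m +ᶻ + c)) {descending (m +ᶻ + c) c} {ascending m c} (count-direction p m c)))
      (trans (sym (count-swap p (ascending m c) (fin (m +ᶻ + c)))) (cong (count p) (sym (ascending-∷ʳ m c))))

    count-rotate : ∀ p m → count p (descending (m +ᶻ + 1) (suc k)) ≡ count p (descending m (suc k))
    count-rotate p m = trans (cong (λ t → count p (fin t ∷ descending t k)) (-1-cancel m))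
      (trans (sym (count-swap p (descending m k) (fin m)))
        (cong (count p) (sym (trans (cong (descending m) (ℕP.+-comm 1 k)) (trans (descending-++ m k 1) (cong (λ t → descending m k ++ t ∷ []) (fin-cong wrap)))))))
      where
      wrap : m -ᶻ + k -ᶻ + 1 ∼ m
      wrap = -ᶻ (+ 1) , lin (m ∷ + k ∷ (-ᶻ (+ 1)) ∙N ∷ + 1 ∙N ∷ N ∷ + 0 ∙N ∷ [])
        ((γ ≐ θ ⊟ ζ) ∷ (ζ ≐ η) ∷ (θ ≐ # 0) ∷ (η ≐ # 1 ⊞ β) ∷ []) (α ⊟ β ⊟ # 1 ≐ α ⊞ γ)
        (N-sub (+ 0) (+ 1)) N-one N-zero refl

    count-from : ∀ p a → count p (descending (+ a) (suc k)) ≡ count p (descending (+ 0) (suc k))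
    count-from p zero    = refl
    count-from p (suc a) = trans (cong (λ t → count p (descending t (suc k))) (ℤP.+-comm (+ 1) (+ a))) (trans (count-rotate p (+ a)) (count-from p a))

    count-tabulate : ∀ {m} (v : Vec Bool m) (f : Fin m → Fin (suc k)) p → (∀ i → p (f i) ≡ Vec.lookup v i) → count p (List.tabulate f) ≡ card v
    count-tabulate []          f p e = refl
    count-tabulate (true ∷ v)  f p e rewrite e Fin.zero = cong suc (count-tabulate v (f ∘ Fin.suc) p (e ∘ Fin.suc))
    count-tabulate (false ∷ v) f p e rewrite e Fin.zero = count-tabulate v (f ∘ Fin.suc) p (e ∘ Fin.suc)

    ascending-tabulate : ∀ a c → ascending (+ a) c ≡ List.tabulate {n = c} (λ i → fin (+ (a ℕ.+ toℕ i)))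
    ascending-tabulate a zero    = refl
    ascending-tabulate a (suc c) = cong₂ _∷_ (cong (fin ∘ +_) (sym (ℕP.+-identityʳ a)))
      (trans (trans (cong (λ t → ascending t c) (ℤP.+-comm (+ a) (+ 1))) (ascending-tabulate (suc a) c))
        (ListP.tabulate-cong (λ i → cong (fin ∘ +_) (sym (ℕP.+-suc a (toℕ i))))))

  -- The letter of m, dropped by the filter, completes the word to a full turn. A full turn meets
  -- each class once and may start anywhere, so it is moved to end at 0 and then read backwards as
  -- the list of all of I.
  length-descendingWord : ∀ m (A : Subset k) → Vec.lookup A (fin m) ≡ false → length (descendingWord m A) ≡ card A
  length-descendingWord m A m∉A = begin
    count p (descending m k)                    ≡⟨ skip ⟨
    count p (fin m ∷ descending m k)            ≡⟨ cong (λ t → count p (fin t ∷ descending t k)) (-1-cancel m) ⟨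
    count p (descending (m +ᶻ + 1) (suc k))     ≡⟨ count-rotate p m ⟩
    count p (descending m (suc k))              ≡⟨ cong (count p) (descending-cong {m} {+ rem m} (suc k) (quo m , rem-quo m)) ⟩
    count p (descending (+ rem m) (suc k))      ≡⟨ trans (count-from p (rem m)) (sym (count-from p (suc k))) ⟩
    count p (descending (+ 0 +ᶻ N) (suc k))     ≡⟨ count-direction p (+ 0) (suc k) ⟩
    count p (ascending (+ 0) (suc k))           ≡⟨ cong (count p) (ascending-tabulate 0 (suc k)) ⟩
    count p (List.tabulate (fin ∘ ι))           ≡⟨ count-tabulate A (fin ∘ ι) p (λ i → cong (Vec.lookup A) (fin-ι i)) ⟩
    card A                                      ∎
    where
    open ≡-Reasoning
    p = Vec.lookup A
    skip : count p (fin m ∷ descending m k) ≡ count p (descending m k)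
    skip rewrite m∉A = refl

  private
    card-full : ∀ {m} (v : Vec Bool m) → (∀ j → Vec.lookup v j ≡ true) → card v ≡ m
    card-full []          e = refl
    card-full (true ∷ v)  e = cong suc (card-full v (e ∘ Fin.suc))
    card-full (false ∷ v) e with e Fin.zero
    ... | ()

    first-missing : ∀ (A : Subset k) (F : List (Fin (suc k)) → Fin (suc k)) →
      (∀ j js → F (j ∷ js) ≡ (if Vec.lookup A j then F js else j)) →
      ∀ js → Any (λ j → Vec.lookup A j ≡ false) js → Vec.lookup A (F js) ≡ false
    first-missing A F F∷ (j ∷ js) p with Vec.lookup A j in eq
    ... | false = trans (cong (Vec.lookup A) (trans (F∷ j js) (cong (λ b → if b then F js else j) eq))) eq
    first-missing A F F∷ (j ∷ js) (here e)  | true with trans (sym eq) e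
    ... | ()
    first-missing A F F∷ (j ∷ js) (there p)  | true =
      trans (cong (Vec.lookup A) (trans (F∷ j js) (cong (λ b → if b then F js else j) eq))) (first-missing A F F∷ js p)

    -- The search inside `missing` is an anonymous local function, as for `len`: it enters as `F`,
    -- applied to a variable list so that unification can find it.
    first-missing-∷ : ∀ (A : Subset k) (F : List (Fin (suc k)) → Fin (suc k)) →
      (∀ j js → F (j ∷ js) ≡ (if Vec.lookup A j then F js else j)) →
      ∀ js → js ≡ List.tabulate Fin.suc → Any (λ j → Vec.lookup A j ≡ false) (Fin.zero ∷ js) →
      Vec.lookup A (if Vec.lookup A Fin.zero then F js else Fin.zero) ≡ false
    first-missing-∷ A F F∷ js _ p = trans (cong (Vec.lookup A) (sym (F∷ Fin.zero js))) (first-missing A F F∷ (Fin.zero ∷ js) p)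

    some-missing : ∀ (A : Subset k) → card A < suc k → Any (λ j → Vec.lookup A j ≡ false) (List.allFin (suc k))
    some-missing A lt with FinP.any? (λ j → Vec.lookup A j Data.Bool.≟ false)
    ... | yes (j , e) = lose (MemP.∈-allFin j) e
    ... | no none = ⊥-elim (ℕP.<-irrefl (card-full A full) lt)
      where
      full : ∀ j → Vec.lookup A j ≡ true
      full j with Vec.lookup A j in e
      ... | true  = refl
      ... | false = ⊥-elim (none (j , e))

  missing∉ : ∀ (A : Subset k) → card A < suc k → Vec.lookup A (missing A) ≡ false
  missing∉ A lt with first-missing-∷ A _ (λ j js → refl) | some-missing A lt | List.tabulate {n = k} Fin.suc in eq
  ... | found | p | js = found js (sym eq) (subst (λ t → Any (λ j → Vec.lookup A j ≡ false) (Fin.zero ∷ t)) eq p)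

  length-dA : ∀ (A : Subset k) → card A < suc k → length (dA A) ≡ card A
  length-dA A lt = trans (cong length (dword≡ A)) (length-descendingWord (ι (missing A)) A (trans (cong (Vec.lookup A) (fin-ι (missing A))) (missing∉ A lt)))

  -- The Pieri rule for ideal sums

  sum-cong : ∀ {A : Set} {F G : A → ℤ} {xs} → All (λ x → F x ≡ G x) xs → sum F xs ≡ sum G xs
  sum-cong []       = refl
  sum-cong (e ∷ es) = cong₂ _+ᶻ_ e (sum-cong es)

  sum-cong′ : ∀ {A : Set} {F G : A → ℤ} xs → (∀ x → F x ≡ G x) → sum F xs ≡ sum G xs
  sum-cong′ xs e = sum-cong (All.universal e xs)

  sum-map : ∀ {A B : Set} (F : B → ℤ) (f : A → B) xs → sum F (map f xs) ≡ sum (F ∘ f) xs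
  sum-map F f []       = refl
  sum-map F f (x ∷ xs) = cong (F (f x) +ᶻ_) (sum-map F f xs)

  sum-concatMap : ∀ {A B : Set} (F : B → ℤ) (f : A → List B) xs → sum F (concatMap f xs) ≡ sum (sum F ∘ f) xs
  sum-concatMap F f []       = refl
  sum-concatMap F f (x ∷ xs) = trans (sum-++ F (f x) (concatMap f xs)) (cong (sum F (f x) +ᶻ_) (sum-concatMap F f xs))

  sum-zero : ∀ {A : Set} (xs : List A) → sum (λ _ → + 0) xs ≡ + 0
  sum-zero []       = refl
  sum-zero (_ ∷ xs) = trans (ℤP.+-identityˡ _) (sum-zero xs)

  sum-+ : ∀ {A : Set} (F G : A → ℤ) xs → sum (λ x → F x +ᶻ G x) xs ≡ sum F xs +ᶻ sum G xs
  sum-+ F G []       = refl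
  sum-+ F G (x ∷ xs) = trans (cong (F x +ᶻ G x +ᶻ_) (sum-+ F G xs))
    (lin (F x ∷ G x ∷ sum F xs ∷ sum G xs ∷ []) [] (α ⊞ β ⊞ (γ ⊞ ζ) ≐ α ⊞ γ ⊞ (β ⊞ ζ)))

  sum-- : ∀ {A : Set} (F G : A → ℤ) xs → sum (λ x → F x -ᶻ G x) xs ≡ sum F xs -ᶻ sum G xs
  sum-- F G []       = refl
  sum-- F G (x ∷ xs) = trans (cong (F x -ᶻ G x +ᶻ_) (sum-- F G xs))
    (lin (F x ∷ G x ∷ sum F xs ∷ sum G xs ∷ []) [] (α ⊟ β ⊞ (γ ⊟ ζ) ≐ α ⊞ γ ⊟ (β ⊞ ζ)))

  sum-* : ∀ {A : Set} c (F : A → ℤ) xs → sum (λ x → c *ᶻ F x) xs ≡ c *ᶻ sum F xs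
  sum-* c F []       = sym (ℤP.*-zeroʳ c)
  sum-* c F (x ∷ xs) = trans (cong (c *ᶻ F x +ᶻ_) (sum-* c F xs)) (sym (ℤP.*-distribˡ-+ c (F x) (sum F xs)))

  sum-swap : ∀ {A B : Set} (F : A → B → ℤ) xs ys → sum (λ x → sum (F x) ys) xs ≡ sum (λ y → sum (λ x → F x y) xs) ys
  sum-swap F []       ys = sym (sum-zero ys)
  sum-swap F (x ∷ xs) ys = trans (cong (sum (F x) ys +ᶻ_) (sum-swap F xs ys)) (sym (sum-+ (F x) _ ys))

  sum-filter : ∀ {A : Set} (F : A → ℤ) p xs → sum F (List.filterᵇ p xs) ≡ sum (λ x → if p x then F x else + 0) xs
  sum-filter F p []       = refl
  sum-filter F p (x ∷ xs) with p x
  ... | true  = cong (F x +ᶻ_) (sum-filter F p xs)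
  ... | false = trans (sum-filter F p xs) (sym (ℤP.+-identityˡ _))

  -- Polynomials are studied through all linear functionals φ ↦ Σ c φ(m).
  evaluate : (Mono k → ℤ) → ℤ × Mono k → ℤ
  evaluate φ t = proj₁ t *ᶻ φ (proj₂ t)

  pair : Poly k → (Mono k → ℤ) → ℤ
  pair p φ = sum (evaluate φ) p

  pair-cong : ∀ p {φ ψ} → (∀ m → φ m ≡ ψ m) → pair p φ ≡ pair p ψ
  pair-cong p {φ} {ψ} e = sum-cong′ {F = evaluate φ} {evaluate ψ} p (λ t → cong (proj₁ t *ᶻ_) (e (proj₂ t)))

  pair-⊕ : ∀ p q φ → pair (p ⊕ q) φ ≡ pair p φ +ᶻ pair q φ
  pair-⊕ p q φ = sum-++ (evaluate φ) p q

  pair-neg : ∀ p φ → pair (neg p) φ ≡ -ᶻ pair p φ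
  pair-neg p φ = begin
    pair (neg p) φ                                ≡⟨ sum-map (evaluate φ) (λ t → (-ᶻ proj₁ t , proj₂ t)) p ⟩
    sum (λ t → -ᶻ proj₁ t *ᶻ φ (proj₂ t)) p       ≡⟨ sum-cong′ p (λ t → trans (sym (ℤP.neg-distribˡ-* (proj₁ t) (φ (proj₂ t)))) (sym (ℤP.-1*i≡-i (evaluate φ t)))) ⟩
    sum (λ t → -ᶻ (+ 1) *ᶻ evaluate φ t) p        ≡⟨ sum-* (-ᶻ (+ 1)) (evaluate φ) p ⟩
    -ᶻ (+ 1) *ᶻ pair p φ                          ≡⟨ ℤP.-1*i≡-i (pair p φ) ⟩
    -ᶻ pair p φ                                   ∎
    where open ≡-Reasoning

  pair-⊗ : ∀ p q φ → pair (p ⊗ q) φ ≡ pair p (λ a → pair q (λ b → φ (Vec.zipWith ℕ._+_ a b)))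
  pair-⊗ p q φ = trans (sum-concatMap (evaluate φ) (λ t → map (times t) q) p) (sum-cong′ p λ t →
    trans (sum-map (evaluate φ) (times t) q) (trans
      (sum-cong′ q (λ u → ℤP.*-assoc (proj₁ t) (proj₁ u) (φ (Vec.zipWith ℕ._+_ (proj₂ t) (proj₂ u)))))
      (sum-* (proj₁ t) (evaluate (λ b → φ (Vec.zipWith ℕ._+_ (proj₂ t) b))) q)))
    where
    times : ℤ × Mono k → ℤ × Mono k → ℤ × Mono k
    times t u = (proj₁ t *ᶻ proj₁ u , Vec.zipWith ℕ._+_ (proj₂ t) (proj₂ u))

  sign : ℕ → ℤ → ℤ
  sign zero          x = x
  sign (suc zero)    x = -ᶻ x
  sign (suc (suc e)) x = sign e x

  sign-suc : ∀ e x → sign (suc e) x ≡ -ᶻ sign e x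
  sign-suc zero          x = refl
  sign-suc (suc zero)    x = sym (ℤP.neg-involutive x)
  sign-suc (suc (suc e)) x = sign-suc e x

  sign-neg : ∀ e x → sign e (-ᶻ x) ≡ -ᶻ sign e x
  sign-neg zero          x = refl
  sign-neg (suc zero)    x = refl
  sign-neg (suc (suc e)) x = sign-neg e x

  sign-zero : ∀ e → sign e (+ 0) ≡ + 0
  sign-zero zero          = refl
  sign-zero (suc zero)    = refl
  sign-zero (suc (suc e)) = sign-zero e

  pair-sgn : ∀ e p φ → pair (sgn e p) φ ≡ sign e (pair p φ)
  pair-sgn zero          p φ = refl
  pair-sgn (suc zero)    p φ = pair-neg p φ
  pair-sgn (suc (suc e)) p φ = pair-sgn e p φ

  pair-Σ : ∀ {A : Set} (f : A → Poly k) xs φ → pair (Σ-list (map f xs)) φ ≡ sum (λ x → pair (f x) φ) xs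
  pair-Σ f []       φ = refl
  pair-Σ f (x ∷ xs) φ = trans (pair-⊕ (f x) _ φ) (cong (pair (f x) φ +ᶻ_) (pair-Σ f xs φ))

  private
    _≟M_ : (m m′ : Mono k) → Dec (m ≡ m′)
    _≟M_ = VecP.≡-dec ℕ._≟_

    strip : Mono k → Poly k → Poly k
    strip m []             = []
    strip m ((c , m′) ∷ p) = if ⌊ m′ ≟M m ⌋ then strip m p else (c , m′) ∷ strip m p

    strip-length : ∀ m p → length (strip m p) ≤ length p
    strip-length m []             = z≤n
    strip-length m ((c , m′) ∷ p) with m′ ≟M m
    ... | yes _ = ℕP.m≤n⇒m≤1+n (strip-length m p)
    ... | no _  = s≤s (strip-length m p)

    pair-strip : ∀ m p φ → pair p φ ≡ coeff p m *ᶻ φ m +ᶻ pair (strip m p) φ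
    pair-strip m []             φ = refl
    pair-strip m ((c , m′) ∷ p) φ with m′ ≟M m
    ... | yes refl = trans (cong (c *ᶻ φ m +ᶻ_) (pair-strip m p φ))
            (trans (sym (ℤP.+-assoc (c *ᶻ φ m) (coeff p m *ᶻ φ m) (pair (strip m p) φ))) (cong (_+ᶻ pair (strip m p) φ) (sym (ℤP.*-distribʳ-+ (φ m) c (coeff p m)))))
    ... | no _     = trans (cong (c *ᶻ φ m′ +ᶻ_) (pair-strip m p φ))
            (lin (c *ᶻ φ m′ ∷ coeff p m *ᶻ φ m ∷ pair (strip m p) φ ∷ []) [] (α ⊞ (β ⊞ γ) ≐ β ⊞ (α ⊞ γ)))

    coeff-strip : ∀ m p → (∀ m′ → coeff p m′ ≡ + 0) → ∀ m′ → coeff (strip m p) m′ ≡ + 0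
    coeff-strip m p z m′ with m ≟M m′
    ... | yes refl = self p
      where
      self : ∀ p → coeff (strip m p) m ≡ + 0
      self []             = refl
      self ((c , m″) ∷ p) with m″ ≟M m
      ... | yes _ = self p
      ... | no ne with m″ ≟M m
      ...   | yes e = contradiction e ne
      ...   | no _  = self p
    ... | no ne = trans (other p) (z m′)
      where
      other : ∀ p → coeff (strip m p) m′ ≡ coeff p m′
      other []             = refl
      other ((c , m″) ∷ p) with m″ ≟M m
      ... | yes refl with m″ ≟M m′
      ...   | yes e = contradiction e ne
      ...   | no _  = other p
      other ((c , m″) ∷ p) | no _ with m″ ≟M m′
      ...   | yes _ = cong (c +ᶻ_) (other p)
      ...   | no _  = other p

    -- Induction on the number of terms. All terms sharing the exponent m of the first one are
    -- stripped at once; together they contribute `coeff p m * φ m`, which is 0.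
    pair-null : ∀ n p → length p ≤ n → (∀ m → coeff p m ≡ + 0) → ∀ φ → pair p φ ≡ + 0
    pair-null n       []             _       z φ = refl
    pair-null (suc n) ((c , m) ∷ p) (s≤s le) z φ = trans (pair-strip m ((c , m) ∷ p) φ)
      (trans (cong₂ _+ᶻ_ (trans (cong (_*ᶻ φ m) (z m)) (ℤP.*-zeroˡ (φ m))) (pair-null n (strip m ((c , m) ∷ p)) (shorter le) (coeff-strip m ((c , m) ∷ p) z) φ)) refl)
      where
      shorter : length p ≤ n → length (strip m ((c , m) ∷ p)) ≤ n
      shorter le with m ≟M m
      ... | yes _ = ℕP.≤-trans (strip-length m p) le
      ... | no ne = contradiction refl ne

    indicator : Mono k → Mono k → ℤ
    indicator m m′ = if ⌊ m′ ≟M m ⌋ then + 1 else + 0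

    coeff-pair : ∀ p m → coeff p m ≡ pair p (indicator m)
    coeff-pair []             m = refl
    coeff-pair ((c , m′) ∷ p) m with m′ ≟M m
    ... | yes _ = cong₂ _+ᶻ_ (sym (ℤP.*-identityʳ c)) (coeff-pair p m)
    ... | no _  = trans (coeff-pair p m) (sym (trans (cong (_+ᶻ pair p (indicator m)) (ℤP.*-zeroʳ c)) (ℤP.+-identityˡ _)))

  pair⇒≈ : ∀ p q → (∀ φ → pair p φ ≡ pair q φ) → p ≈ q
  pair⇒≈ p q e m = trans (coeff-pair p m) (trans (e (indicator m)) (sym (coeff-pair q m)))

  ≈⇒pair : ∀ p q → p ≈ q → ∀ φ → pair p φ ≡ pair q φ
  ≈⇒pair p q e φ = lin (pair p φ ∷ pair q φ ∷ []) ((α ⊟ β ≐ # 0) ∷ []) (α ≐ β)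
    (trans (sym (trans (pair-⊕ p (neg q) φ) (cong (pair p φ +ᶻ_) (pair-neg q φ))))
      (pair-null (length (p ⊕ neg q)) (p ⊕ neg q) ℕP.≤-refl null φ))
    where
    null : ∀ m → coeff (p ⊕ neg q) m ≡ + 0
    null m = trans (coeff-pair (p ⊕ neg q) m) (trans (pair-⊕ p (neg q) _) (trans (cong (pair p (indicator m) +ᶻ_) (pair-neg q _))
      (ℤP.i≡j⇒i-j≡0 (trans (sym (coeff-pair p m)) (trans (e m) (coeff-pair q m))))))

  -- Transposes of multiplication by h_r and of the one-letter operators

  eʳ : ℕ → Mono k
  eʳ r = Vec.tabulate (λ j → if suc (toℕ j) ≡ᵇ r then 1 else 0)

  -- The transpose of multiplication by h_r. Identities between polynomials become identities
  -- between integers for all functionals, with h_r moved into the functional.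
  translate : ℕ → (Mono k → ℤ) → Mono k → ℤ
  translate r φ m = φ (Vec.zipWith ℕ._+_ (eʳ r) m)

  pair-h : ∀ r q φ → pair (h k r ⊗ q) φ ≡ pair q (translate r φ)
  pair-h r q φ = trans (pair-⊗ (h k r) q φ) (trans (ℤP.+-identityʳ _) (ℤP.*-identityˡ _))

  -- The alternating sum Σ (-1)^{|a|-|b|} Ψ(b u) over the subwords b of a; for a = d_A it is the
  -- inner sum over B ⊆ A in the Pieri rule for ideal sums.
  ∇ : Word k → (Word k → ℤ) → Word k → ℤ
  ∇ []      Ψ = Ψ
  ∇ (i ∷ a) Ψ = ∇ a (λ u → Ψ (i ∷ u) -ᶻ Ψ u)

  ∇-cong : ∀ a {Ψ Φ} → (∀ u → Ψ u ≡ Φ u) → ∀ u → ∇ a Ψ u ≡ ∇ a Φ u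
  ∇-cong []      e u = e u
  ∇-cong (i ∷ a) e u = ∇-cong a (λ u → cong₂ _-ᶻ_ (e (i ∷ u)) (e u)) u

  -- The transpose of the operator T_i − 1, where T_i g_v is the sum of g over expand i v.
  U : Fin (suc k) → (Word k → ℤ) → Word k → ℤ
  U i G v = sum G (expand i v) -ᶻ G v

  U* : Word k → (Word k → ℤ) → Word k → ℤ
  U* []      G = G
  U* (i ∷ a) G = U* a (U i G)

  Ψ : (Word k → ℤ) → Word k → ℤ
  Ψ G u = sum G (ideal u)

  -- The ideal of `i ∷ u` is by definition the expansion of the ideal of `u`, so that `U i G` summed
  -- over the latter is a difference of two ideal sums of `G`.
  sum-U* : ∀ a G u → sum (U* a G) (ideal u) ≡ ∇ a (Ψ G) u
  sum-U* []      G u = refl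
  sum-U* (i ∷ a) G u = trans (sum-U* a (U i G) u) (∇-cong a step u)
    where
    step : ∀ u → Ψ (U i G) u ≡ Ψ G (i ∷ u) -ᶻ Ψ G u
    step u = trans (sum-- (sum G ∘ expand i) G (ideal u)) (cong (_-ᶻ Ψ G u) (sym (sum-concatMap G (expand i) (ideal u))))

  private
    U-up : ∀ i G v → Up (ι i) v → U i G v ≡ G (i ∷ v)
    U-up i G v u with ℤP.<-cmp (block v (ι i)) (block v (ι i +ᶻ + 1))
    ... | tri< _ _ _ = lin (G v ∷ G (i ∷ v) ∷ []) [] (α ⊞ (β ⊞ # 0) ⊟ α ≐ β)
    ... | tri≈ n _ _ = contradiction u n
    ... | tri> n _ _ = contradiction u n

    U-level : ∀ i G v → block v (ι i) ≡ block v (ι i +ᶻ + 1) → U i G v ≡ + 0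
    U-level i G v e with ℤP.<-cmp (block v (ι i)) (block v (ι i +ᶻ + 1))
    ... | tri< _ n _ = contradiction e n
    ... | tri≈ _ _ _ = lin (G v ∷ []) [] (α ⊞ # 0 ⊟ α ≐ # 0)
    ... | tri> _ n _ = contradiction e n

    U-down : ∀ i G v → block v (ι i +ᶻ + 1) <ᶻ block v (ι i) → U i G v ≡ -ᶻ G v
    U-down i G v g with ℤP.<-cmp (block v (ι i)) (block v (ι i +ᶻ + 1))
    ... | tri< _ _ n = contradiction g n
    ... | tri≈ _ _ n = contradiction g n
    ... | tri> _ _ _ = ℤP.+-identityˡ _

    φ-rise : ∀ i v → ℓ v < ℓ (i ∷ v) → φ i v ≡ i ∷ v
    φ-rise i v lt with len v <ᵇ len (i ∷ v) | ℕP.<⇒<ᵇ (subst₂ _<_ (ℓ-def v) (ℓ-def (i ∷ v)) lt)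
    ... | true | _ = refl

    φ-fall : ∀ i v → ¬ (ℓ v < ℓ (i ∷ v)) → φ i v ≡ v
    φ-fall i v n with len v <ᵇ len (i ∷ v) in eq
    ... | false = refl
    ... | true  = contradiction (subst₂ _<_ (sym (ℓ-def v)) (sym (ℓ-def (i ∷ v))) (ℕP.<ᵇ⇒< (len v) (len (i ∷ v)) (subst T (sym eq) tt))) n

    rise-inv : ∀ i v → ℓ v < ℓ (i ∷ v) → inv v (ι i) <ᶻ inv v (ι i +ᶻ + 1)
    rise-inv i v lt = left-up⁻¹ (ι i) v (subst (λ j → ℓ v < ℓ (j ∷ v)) (sym (fin-ι i)) lt)

    Incr-φ⁻¹ : ∀ i v → Incr (φ i v) → Incr v
    Incr-φ⁻¹ i v inc with ℓ v ℕ.<? ℓ (i ∷ v)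
    ... | yes lt = Incr-∷⁻¹ {v} (ι i) (subst (λ j → Incr (j ∷ v)) (sym (fin-ι i)) (subst Incr (φ-rise i v lt) inc)) (rise-inv i v lt)
    ... | no n   = subst Incr (φ-fall i v n) inc

  opaque
    isGrass : Word k → Bool
    isGrass x = ⌊ grass? x ⌋

    isGrass-def : ∀ x → ⌊ grass? x ⌋ ≡ isGrass x
    isGrass-def x = refl

    isGrass-Incr : ∀ x → (Incr x × isGrass x ≡ true) ⊎ (¬ Incr x × isGrass x ≡ false)
    isGrass-Incr x with grass? x
    ... | yes g = inj₁ (Grass⇒Incr {x} g , refl)
    ... | no n  = inj₂ (n ∘ Incr⇒Grass {x} , refl)

  Coefficient : ℕ → (Word k → ℤ) → Word k → Word k → ℤ
  Coefficient r G w x = if isGrass x then sign ((r ℕ.+ ℓ w) ∸ ℓ x) (G x) else + 0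

  private
    grass-if : ∀ x {a b : ℤ} → Incr x → (if isGrass x then a else b) ≡ a
    grass-if x {a} {b} inc with isGrass-Incr x
    ... | inj₁ (_ , e) = cong (λ t → if t then a else b) e
    ... | inj₂ (n , _) = contradiction inc n

    not-grass-if : ∀ x {a b : ℤ} → ¬ Incr x → (if isGrass x then a else b) ≡ b
    not-grass-if x {a} {b} n with isGrass-Incr x
    ... | inj₁ (i , _) = contradiction i n
    ... | inj₂ (_ , e) = cong (λ t → if t then a else b) e

    Incr? : ∀ x → Dec (Incr x)
    Incr? x with isGrass-Incr x
    ... | inj₁ (i , _) = yes i
    ... | inj₂ (n , _) = no n

    ℓ-φ : ∀ i y → ℓ (φ i y) ≤ suc (ℓ y)
    ℓ-φ i y = decide (ℓ y ℕ.<? ℓ (i ∷ y))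
      where
      decide : Dec (ℓ y < ℓ (i ∷ y)) → ℓ (φ i y) ≤ suc (ℓ y)
      decide (yes lt) = ℕP.≤-trans (ℕP.≤-reflexive (cong ℓ (φ-rise i y lt))) (ℓ-∷ i y)
      decide (no n)   = ℕP.≤-trans (ℕP.≤-reflexive (cong ℓ (φ-fall i y n))) (ℕP.n≤1+n (ℓ y))

    ℓ-demazure : ∀ a w → ℓ (demazure a w) ≤ length a ℕ.+ ℓ w
    ℓ-demazure []      w = ℕP.≤-refl
    ℓ-demazure (i ∷ a) w = ℕP.≤-trans (ℓ-φ i (demazure a w)) (s≤s (ℓ-demazure a w))

    -- If b(i) < b(i+1), `φ` lengthens y and r grows along with the length. If the blocks are level,
    -- `φ i y` is not Grassmannian and both sides are 0. If b(i) > b(i+1), `φ` keeps y and only r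
    -- grows, which flips the sign. The bound on `ℓ y` makes the truncated subtraction in the
    -- exponent a genuine one.
    Coefficient-∷ : ∀ i r G w y → ℓ y ≤ r ℕ.+ ℓ w → Coefficient r (U i G) w y ≡ Coefficient (suc r) G w (φ i y)
    Coefficient-∷ i r G w y le = split (Incr? y)
      where
      split : Dec (Incr y) → Coefficient r (U i G) w y ≡ Coefficient (suc r) G w (φ i y)
      split (no n) = trans (not-grass-if y n) (sym (not-grass-if (φ i y) (n ∘ Incr-φ⁻¹ i y)))
      split (yes inc) = trans (grass-if y inc) (decide (ℤP.<-cmp (block y (ι i)) (block y (ι i +ᶻ + 1))))
       where
       e = (r ℕ.+ ℓ w) ∸ ℓ y
       decide : _ → sign e (U i G y) ≡ Coefficient (suc r) G w (φ i y)
       decide (tri< u _ _) = trans (cong (sign e) (U-up i G y u)) (sym (trans (cong (Coefficient (suc r) G w) (φ-rise i y rise))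
           (trans (grass-if (i ∷ y) (Incr-∷ᵢ {y} inc i (λ q → ℤP.<-irrefl q u)))
             (cong (λ t → sign (suc (r ℕ.+ ℓ w) ∸ t) (G (i ∷ y))) (ℕP.≤-antisym (ℓ-∷ i y) rise)))))
         where rise = rises {y} inc i (ℤP.<⇒≤ u)
       decide (tri≈ n q _) = trans (cong (sign e) (U-level i G y q)) (trans (sign-zero e) (sym (trans (cong (Coefficient (suc r) G w) (φ-rise i y rise))
           (not-grass-if (i ∷ y) λ inc′ → n (rise⇒Up {y} (ι i) (subst (λ j → Incr (j ∷ y)) (sym (fin-ι i)) inc′) (rise-inv i y rise))))))
         where rise = rises {y} inc i (ℤP.≤-reflexive q)
       decide (tri> _ _ g) = trans (cong (sign e) (U-down i G y g)) (trans (sign-neg e (G y)) (trans (sym (sign-suc e (G y)))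
           (sym (trans (cong (Coefficient (suc r) G w) (φ-fall i y (ℕP.<-asym (falls {y} i g)))) (trans (grass-if y inc)
             (cong (λ t → sign t (G y)) (ℕP.+-∸-assoc 1 le)))))))

  -- Turns a Pieri term, with its sign and its Grassmannian condition, into a product of one-letter
  -- operators, so that ideals can be treated one letter at a time.
  U*-demazure : ∀ a G {w} → Incr w → U* a G w ≡ Coefficient (length a) G w (demazure a w)
  U*-demazure []      G {w} inc = sym (trans (grass-if w inc) (cong (λ t → sign t (G w)) (ℕP.n∸n≡0 (ℓ w))))
  U*-demazure (i ∷ a) G {w} inc = trans (U*-demazure a (U i G) inc) (Coefficient-∷ i (length a) G w (demazure a w) (ℓ-demazure a w))

  subsets : ℕ → List (Subset k)
  subsets r = List.filterᵇ (λ A → card A ≡ᵇ r) (allVecs (suc k))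

  module KkSchur (g : Word k → Poly k) (isK : IsKkSchur k g) where
    open IsKkSchur isK

    G : (Mono k → ℤ) → Word k → ℤ
    G φ v = pair (g v) φ

    G-cong : ∀ φ {u v} → Incr u → u ≈W v → G φ u ≡ G φ v
    G-cong φ {u} {v} inc e = ≈⇒pair (g u) (g v) (respects u v (Incr⇒Grass {u} inc) (≈W⇒≡W {u} {v} e)) φ

    pieri-U* : ∀ r → 1 ≤ r → r ≤ k → ∀ φ {w} → Incr w → G (translate r φ) w ≡ sum (λ A → U* (dA A) (G φ) w) (subsets r)
    pieri-U* r r₁ r₂ φ {w} inc = begin
      G (translate r φ) w                       ≡⟨ pair-h r (g w) φ ⟨
      pair (h k r ⊗ g w) φ                      ≡⟨ ≈⇒pair (h k r ⊗ g w) (pieriSum g r w) (pieri w (Incr⇒Grass {w} inc) r r₁ r₂) φ ⟩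
      pair (pieriSum g r w) φ                   ≡⟨ trans (pair-Σ _ (List.filterᵇ inPieri (allVecs (suc k))) φ) (sum-filter _ inPieri (allVecs (suc k))) ⟩
      sum (λ A → if inPieri A then pair (term A) φ else + 0) (allVecs (suc k)) ≡⟨ sum-cong′ (allVecs (suc k)) same ⟩
      sum (λ A → if card A ≡ᵇ r then U* (dA A) (G φ) w else + 0) (allVecs (suc k)) ≡⟨ sum-filter _ (λ A → card A ≡ᵇ r) (allVecs (suc k)) ⟨
      sum (λ A → U* (dA A) (G φ) w) (subsets r) ∎
      where
      open ≡-Reasoning
      inPieri : Subset k → Bool
      inPieri A = (card A <ᵇ suc k) ∧ (card A ≡ᵇ r) ∧ ⌊ grass? (demazure (dA A) w) ⌋
      term : Subset k → Poly k
      term A = sgn ((r ℕ.+ len w) ∸ len (demazure (dA A) w)) (g (demazure (dA A) w))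
      guard : ∀ a b c {x y z : ℤ} → (b ≡ true → a ≡ true) → (b ≡ true → (if c then x else + 0) ≡ y) →
              (if a ∧ b ∧ c then x else + 0) ≡ (if b then y else + 0)
      guard true  true  c     _ f = f refl
      guard true  false c     _ f = refl
      guard false false c     _ f = refl
      guard false true  c     h f with h refl
      ... | ()
      same : ∀ A → (if inPieri A then pair (term A) φ else + 0) ≡ (if card A ≡ᵇ r then U* (dA A) (G φ) w else + 0)
      same A = guard (card A <ᵇ suc k) (card A ≡ᵇ r) ⌊ grass? x ⌋ {z = + 0} (λ e → small (is-r e)) (λ e → sym (trans (U*-demazure (dA A) (G φ) inc)
          (trans (cong (λ t → Coefficient t (G φ) w x) (trans (length-dA A (ℕP.≤-trans (s≤s (ℕP.≤-reflexive (is-r e))) (s≤s r₂))) (is-r e)))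
            (cong₂ (λ b t → if b then t else + 0) (sym (isGrass-def x)) (trans (cong₂ (λ a b → sign ((r ℕ.+ a) ∸ b) (G φ x)) (ℓ-def w) (ℓ-def x)) (sym (pair-sgn ((r ℕ.+ len w) ∸ len x) (g x) φ)))))))
        where
        x = demazure (dA A) w
        is-r : (card A ≡ᵇ r) ≡ true → card A ≡ r
        is-r e = ℕP.≡ᵇ⇒≡ (card A) r (subst T (sym e) tt)
        small : card A ≡ r → (card A <ᵇ suc k) ≡ true
        small e with card A <ᵇ suc k | ℕP.<⇒<ᵇ (ℕP.≤-trans (s≤s (ℕP.≤-reflexive e)) (s≤s r₂))
        ... | true | _ = refl

    -- After summation over the ideal, lengths and signs have disappeared from the rule: it speaks
    -- only of the words `b ++ u`.
    Ψ-pieri : ∀ r → 1 ≤ r → r ≤ k → ∀ φ u → Ψ (G (translate r φ)) u ≡ sum (λ A → ∇ (dA A) (Ψ (G φ)) u) (subsets r)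
    Ψ-pieri r r₁ r₂ φ u = trans (sum-cong (All.map (λ {w} → pieri-U* r r₁ r₂ φ {w}) (Enumerates.all-Incr (ideal-enumerates u))))
      (trans (sum-swap (λ w A → U* (dA A) (G φ) w) (ideal u) (subsets r)) (sum-cong′ (subsets r) (λ A → sum-U* (dA A) (G φ) u)))

    Ψ-cong : ∀ φ {u v} → δ u ≈W δ v → Ψ (G φ) u ≡ Ψ (G φ) v
    Ψ-cong φ {u} {v} e = Enumerates-sum (G φ) (G-cong φ) (ideal-enumerates u)
      (Enumerates-cong {δ v} {δ u} (≈W-sym {δ u} {δ v} e) (ideal-enumerates v))

  -- Independence of the starting point of a cyclically decreasing word

  -- Functions on words that depend only on the element `δ u`. For these, relations among the
  -- operators `D` may be used inside `∇`.
  Resp : (Word k → ℤ) → Set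
  Resp Ψ = ∀ {u v} → δ u ≈W δ v → Ψ u ≡ Ψ v

  step : Fin (suc k) → (Word k → ℤ) → Word k → ℤ
  step i Ψ u = Ψ (i ∷ u) -ᶻ Ψ u

  step-Resp : ∀ i {Ψ} → Resp Ψ → Resp (step i Ψ)
  step-Resp i {Ψ} resp {u} {v} e = cong₂ _-ᶻ_ (resp {i ∷ u} {i ∷ v} (D-cong i {δ u} {δ v} e)) (resp {u} {v} e)

  infix 4 _⟂_
  record _⟂_ (i j : Fin (suc k)) : Set where
    field
      apart : ¬ (ι i ∼ ι j)
      after : ¬ (ι i ∼ ι j +ᶻ + 1)
      under : ¬ (ι j ∼ ι i +ᶻ + 1)

  open _⟂_

  ⟂-sym : ∀ {i j} → i ⟂ j → j ⟂ i
  ⟂-sym p = record { apart = apart p ∘ ∼-sym ; after = under p ; under = after p }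

  private
    fixes : ∀ {i j} → i ⟂ j → ∀ {x} → x ∼ ι i ⊎ x ∼ ι i +ᶻ + 1 → s (ι j) x ≡ x
    fixes p (inj₁ c) = s-stay _ _ (λ d → apart p (∼-trans (∼-sym c) d)) (λ d → after p (∼-trans (∼-sym c) d))
    fixes p (inj₂ c) = s-stay _ _ (λ d → under p (∼-trans (∼-sym d) c)) (λ d → apart p (∼-+-cancel (+ 1) (∼-trans (∼-sym c) d)))

    s-moves : ∀ i {x} → x ∼ ι i ⊎ x ∼ ι i +ᶻ + 1 → s (ι i) x ∼ ι i ⊎ s (ι i) x ∼ ι i +ᶻ + 1
    s-moves i {x} (inj₁ c) = inj₂ (subst (_∼ ι i +ᶻ + 1) (sym (s-up _ _ c)) (∼-+ (+ 1) c))
    s-moves i {x} (inj₂ c) = inj₁ (subst (_∼ ι i) (sym (s-down _ _ c)) (∼-+-cancel (+ 1) (subst (_∼ ι i +ᶻ + 1) (lin (x ∷ []) [] (α ≐ α ⊟ # 1 ⊞ # 1)) c)))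

  s-commute : ∀ {i j} → i ⟂ j → ∀ x → s (ι i) (s (ι j) x) ≡ s (ι j) (s (ι i) x)
  s-commute {i} {j} p x = decide (near? (ι i)) (near? (ι j))
    where
    near? : ∀ y → (x ∼ y ⊎ x ∼ y +ᶻ + 1) ⊎ (s y x ≡ x)
    near? y with view y x
    ... | up l e _   = inj₁ (inj₁ (l , e))
    ... | down l e _ = inj₁ (inj₂ (l , e))
    ... | stay _ _ e = inj₂ e
    decide : _ → _ → s (ι i) (s (ι j) x) ≡ s (ι j) (s (ι i) x)
    decide (inj₁ c) _ = trans (cong (s (ι i)) (fixes p c)) (sym (fixes p (s-moves i c)))
    decide (inj₂ e) (inj₁ c) = trans (fixes (⟂-sym p) (s-moves j c)) (cong (s (ι j)) (sym (fixes (⟂-sym p) c)))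
    decide (inj₂ e) (inj₂ f) = trans (cong (s (ι i)) f) (trans e (trans (sym f) (cong (s (ι j)) (sym e))))

  private
    Up-⟂ : ∀ {i j} → i ⟂ j → ∀ w → Up (ι i) w → Up (ι i) (j ∷ w)
    Up-⟂ {i} {j} p w = subst₂ _<ᶻ_ (sym (trans (block-∷ j w _) (cong (block w) (fixes p (inj₁ ∼-refl)))))
      (sym (trans (block-∷ j w _) (cong (block w) (fixes p (inj₂ ∼-refl)))))

    Up-⟂⁻¹ : ∀ {i j} → i ⟂ j → ∀ w → Up (ι i) (j ∷ w) → Up (ι i) w
    Up-⟂⁻¹ {i} {j} p w = subst₂ _<ᶻ_ (trans (block-∷ j w _) (cong (block w) (fixes p (inj₁ ∼-refl))))
      (trans (block-∷ j w _) (cong (block w) (fixes p (inj₂ ∼-refl))))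

    ∷-commute : ∀ {i j} → i ⟂ j → ∀ (w : Word k) → i ∷ j ∷ w ≈W j ∷ i ∷ w
    ∷-commute {i} {j} p w x = trans (act-∷ i (j ∷ w) x) (trans (cong (s (ι i)) (act-∷ j w x)) (trans (s-commute p (act w x))
      (sym (trans (act-∷ j (i ∷ w) x) (cong (s (ι j)) (act-∷ i w x))))))

    D-split : ∀ i w → (Up (ι i) w × D i w ≡ i ∷ w) ⊎ (¬ Up (ι i) w × D i w ≡ w)
    D-split i w with Up? (ι i) w
    ... | yes u = inj₁ (u , refl)
    ... | no n  = inj₂ (n , refl)

  -- Non-adjacent letters move disjoint pairs of classes, so neither affects the block comparison
  -- that governs the other.
  D-commute : ∀ {i j} → i ⟂ j → ∀ w → D i (D j w) ≈W D j (D i w)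
  D-commute {i} {j} p w = decide (D-split i w) (D-split j w)
    where
    equal : ∀ {u v a b : Word k} → a ≡ u → b ≡ v → u ≈W v → a ≈W b
    equal refl refl e = e
    decide : _ → _ → D i (D j w) ≈W D j (D i w)
    decide (inj₁ (u , e)) (inj₁ (v , f)) = equal (trans (cong (D i) f) (D-yes {i} {j ∷ w} (Up-⟂ p w u))) (trans (cong (D j) e) (D-yes {j} {i ∷ w} (Up-⟂ (⟂-sym p) w v))) (∷-commute p w)
    decide (inj₁ (u , e)) (inj₂ (n , f)) = equal (trans (cong (D i) f) e) (trans (cong (D j) e) (D-no {j} {i ∷ w} (n ∘ Up-⟂⁻¹ (⟂-sym p) w))) (λ _ → refl)
    decide (inj₂ (n , e)) (inj₁ (v , f)) = equal (trans (cong (D i) f) (D-no {i} {j ∷ w} (n ∘ Up-⟂⁻¹ p w))) (trans (cong (D j) e) f) (λ _ → refl)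
    decide (inj₂ (n , e)) (inj₂ (m , f)) = equal (trans (cong (D i) f) e) (trans (cong (D j) e) f) (λ _ → refl)

  ∇-swap : ∀ {i j} → i ⟂ j → ∀ a {Ψ} → Resp Ψ → ∀ u → ∇ (i ∷ j ∷ a) Ψ u ≡ ∇ (j ∷ i ∷ a) Ψ u
  ∇-swap {i} {j} p a {Ψ} resp u = ∇-cong a (λ u → trans
      (cong (λ t → t -ᶻ Ψ (j ∷ u) -ᶻ (Ψ (i ∷ u) -ᶻ Ψ u)) (resp {i ∷ j ∷ u} {j ∷ i ∷ u} (D-commute p (δ u))))
      (lin (Ψ (j ∷ i ∷ u) ∷ Ψ (j ∷ u) ∷ Ψ (i ∷ u) ∷ Ψ u ∷ []) [] (α ⊟ β ⊟ (γ ⊟ ζ) ≐ α ⊟ γ ⊟ (β ⊟ ζ)))) u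

  ∇-move : ∀ {i} Y {Z} → All (i ⟂_) Y → ∀ {Ψ} → Resp Ψ → ∀ u → ∇ (i ∷ Y ++ Z) Ψ u ≡ ∇ (Y ++ i ∷ Z) Ψ u
  ∇-move []      []       resp u = refl
  ∇-move (y ∷ Y) {Z} (p ∷ ps) {Ψ} resp u = trans (∇-swap p (Y ++ Z) {Ψ} (λ {u} {v} → resp {u} {v}) u)
    (∇-move Y {Z} ps {step y Ψ} (λ {u} {v} → step-Resp y {Ψ} (λ {u} {v} → resp {u} {v}) {u} {v}) u)

  ∇-exchange : ∀ X {Y} → All (λ i → All (i ⟂_) Y) X → ∀ {Ψ} → Resp Ψ → ∀ u → ∇ (X ++ Y) Ψ u ≡ ∇ (Y ++ X) Ψ u
  ∇-exchange []      {Y} []       {Ψ} resp u = cong (λ a → ∇ a Ψ u) (sym (ListP.++-identityʳ Y))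
  ∇-exchange (i ∷ X) {Y} (p ∷ ps) {Ψ} resp u = trans (∇-exchange X {Y} ps {step i Ψ} (λ {u} {v} → step-Resp i {Ψ} (λ {u} {v} → resp {u} {v}) {u} {v}) u)
    (∇-move Y {X} p {Ψ} (λ {u} {v} → resp {u} {v}) u)

  between : ∀ {x y} → y <ᶻ x → x <ᶻ y +ᶻ N → ¬ (x ∼ y)
  between {x} {y} lo hi (l , e) = absurd (ℤP.<-cmp l (+ 0))
    where
    absurd : _ → ⊥
    absurd (tri≈ _ z _) = lin (x ∷ y ∷ l ∙N ∷ []) ((β ≺ α) ∷ (α ≐ β ⊞ γ) ∷ (γ ≐ # 0) ∷ []) ff lo e (trans (cong _∙N z) N-zero)
    absurd (tri< neg _ _) = lin (x ∷ y ∷ l ∙N ∷ N ∷ + 0 ∙N ∷ []) ((β ≺ α) ∷ (α ≐ β ⊞ γ) ∷ (γ ⊞ ζ ≼ η) ∷ (η ≐ # 0) ∷ (# 1 ≺ ζ) ∷ []) ff lo e (N-gap neg) N-zero 1<N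
    absurd (tri> _ _ pos) = lin (x ∷ y ∷ l ∙N ∷ N ∷ + 0 ∙N ∷ []) ((α ≺ β ⊞ ζ) ∷ (α ≐ β ⊞ γ) ∷ (η ⊞ ζ ≼ γ) ∷ (η ≐ # 0) ∷ []) ff hi e (N-gap pos) N-zero

  fin-⟂ : ∀ {x y} → y +ᶻ + 1 <ᶻ x → x +ᶻ + 1 <ᶻ y +ᶻ N → fin x ⟂ fin y
  fin-⟂ {x} {y} lo hi = record
    { apart = λ c → between {x} {y} (lin (x ∷ y ∷ []) ((β ⊞ # 1 ≺ α) ∷ []) (β ≺ α) lo)
        (lin (x ∷ y ∷ N ∷ []) ((α ⊞ # 1 ≺ β ⊞ γ) ∷ []) (α ≺ β ⊞ γ) hi) (∼-trans (∼-sym (ι-fin x)) (∼-trans c (ι-fin y)))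
    ; after = λ c → between {x} {y +ᶻ + 1} lo
        (lin (x ∷ y ∷ N ∷ []) ((α ⊞ # 1 ≺ β ⊞ γ) ∷ []) (α ≺ β ⊞ # 1 ⊞ γ) hi) (∼-trans (∼-sym (ι-fin x)) (∼-trans c (∼-+ (+ 1) (ι-fin y))))
    ; under = λ c → between {x +ᶻ + 1} {y} (lin (x ∷ y ∷ []) ((β ⊞ # 1 ≺ α) ∷ []) (β ≺ α ⊞ # 1) lo) hi
        (∼-trans (∼-+ (+ 1) (∼-sym (ι-fin x))) (∼-trans (∼-sym c) (ι-fin y)))
    }

  descending-All : ∀ {P : Fin (suc k) → Set} m c → (∀ z → m -ᶻ + c ≤ᶻ z → z <ᶻ m → P (fin z)) → All P (descending m c)
  descending-All m zero    h = []
  descending-All m (suc c) h = h (m -ᶻ + 1) (lin (m ∷ + c ∷ []) ((# 0 ≼ β) ∷ []) (α ⊟ (# 1 ⊞ β) ≼ α ⊟ # 1) (0≤+ c)) (lin (m ∷ []) [] (α ⊟ # 1 ≺ α))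
    ∷ descending-All (m -ᶻ + 1) c (λ z lo hi → h z (lin (m ∷ + c ∷ z ∷ []) ((α ⊟ # 1 ⊟ β ≼ γ) ∷ []) (α ⊟ (# 1 ⊞ β) ≼ γ) lo)
        (lin (m ∷ z ∷ []) ((β ≺ α ⊟ # 1) ∷ []) (β ≺ α) hi))

  private
    filter-skip : ∀ p i xs → p i ≡ false → List.filterᵇ {A = Fin (suc k)} p (i ∷ xs) ≡ List.filterᵇ p xs
    filter-skip p i xs e rewrite e = refl

  -- For m′ = m − (a + 1), both words consist of the letters strictly
  -- between m and m′ and those strictly between m′ and m − n, in opposite orders.
  descendingWord-∇ : ∀ m a (A : Subset k) → suc a ≤ k → Vec.lookup A (fin m) ≡ false → Vec.lookup A (fin (m -ᶻ + suc a)) ≡ false →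
    ∀ {Ψ} → Resp Ψ → ∀ u → ∇ (descendingWord m A) Ψ u ≡ ∇ (descendingWord (m -ᶻ + suc a) A) Ψ u
  descendingWord-∇ m a A a<k m∉ m′∉ {Ψ} resp u = trans (cong (λ w → ∇ w Ψ u) from-m)
      (trans (∇-exchange X {Y} separated {Ψ} (λ {u} {v} → resp {u} {v}) u) (cong (λ w → ∇ w Ψ u) (sym from-m′)))
    where
    p = Vec.lookup A
    m′ = m -ᶻ + suc a
    b = k ∸ suc a
    k≡ : k ≡ suc a ℕ.+ b
    k≡ = sym (ℕP.m+[n∸m]≡n a<k)
    k≡ᶻ : + k ≡ + suc a +ᶻ + b
    k≡ᶻ = cong +_ k≡
    X = List.filterᵇ p (descending m a)
    Y = List.filterᵇ p (descending m′ b)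
    from-m : descendingWord m A ≡ X ++ Y
    from-m = begin
      List.filterᵇ p (descending m k)                                       ≡⟨ cong (λ t → List.filterᵇ p (descending m t)) (trans k≡ (sym (ℕP.+-suc a b))) ⟩
      List.filterᵇ p (descending m (a ℕ.+ suc b))                           ≡⟨ cong (List.filterᵇ p) (descending-++ m a (suc b)) ⟩
      List.filterᵇ p (descending m a ++ descending (m -ᶻ + a) (suc b))      ≡⟨ filterᵇ-++ p (descending m a) _ ⟩
      X ++ List.filterᵇ p (fin (m -ᶻ + a -ᶻ + 1) ∷ descending (m -ᶻ + a -ᶻ + 1) b) ≡⟨ cong (λ t → X ++ List.filterᵇ p (fin t ∷ descending t b)) (lin (m ∷ + a ∷ []) [] (α ⊟ β ⊟ # 1 ≐ α ⊟ (# 1 ⊞ β))) ⟩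
      X ++ List.filterᵇ p (fin m′ ∷ descending m′ b)                        ≡⟨ cong (X ++_) (filter-skip p (fin m′) (descending m′ b) m′∉) ⟩
      X ++ Y                                                                ∎
      where open ≡-Reasoning
    -- `m′ - b - 1 = m - n`: below the letters of `Y` the descent comes back to the class of m.
    wrap : m′ -ᶻ + b -ᶻ + 1 ∼ m
    wrap = -ᶻ (+ 1) , lin (m ∷ + a ∷ + b ∷ + k ∷ (-ᶻ (+ 1)) ∙N ∷ + 1 ∙N ∷ + 0 ∙N ∷ [])
        ((ζ ≐ # 1 ⊞ β ⊞ γ) ∷ (η ≐ ξ ⊟ θ) ∷ (θ ≐ # 1 ⊞ ζ) ∷ (ξ ≐ # 0) ∷ []) (α ⊟ (# 1 ⊞ β) ⊟ γ ⊟ # 1 ≐ α ⊞ η)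
        k≡ᶻ (N-sub (+ 0) (+ 1)) N-one N-zero
    from-m′ : descendingWord m′ A ≡ Y ++ X
    from-m′ = begin
      List.filterᵇ p (descending m′ k)                                      ≡⟨ cong (λ t → List.filterᵇ p (descending m′ t)) (trans k≡ (ℕP.+-comm (suc a) b)) ⟩
      List.filterᵇ p (descending m′ (b ℕ.+ suc a))                          ≡⟨ cong (List.filterᵇ p) (descending-++ m′ b (suc a)) ⟩
      List.filterᵇ p (descending m′ b ++ descending (m′ -ᶻ + b) (suc a))    ≡⟨ filterᵇ-++ p (descending m′ b) _ ⟩
      Y ++ List.filterᵇ p (fin (m′ -ᶻ + b -ᶻ + 1) ∷ descending (m′ -ᶻ + b -ᶻ + 1) a) ≡⟨ cong (λ t → Y ++ List.filterᵇ p t) (cong₂ _∷_ (fin-cong wrap) (descending-cong a wrap)) ⟩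
      Y ++ List.filterᵇ p (fin m ∷ descending m a)                          ≡⟨ cong (Y ++_) (filter-skip p (fin m) (descending m a) m∉) ⟩
      Y ++ X                                                                ∎
      where open ≡-Reasoning
    separated : All (λ i → All (i ⟂_) Y) X
    separated = filterᵇ-All p (descending-All m a λ z z₁ z₂ → filterᵇ-All p (descending-All m′ b λ y y₁ y₂ → fin-⟂ {z} {y}
      (lin (m ∷ + a ∷ z ∷ y ∷ []) ((α ⊟ β ≼ γ) ∷ (ζ ≺ α ⊟ (# 1 ⊞ β)) ∷ []) (ζ ⊞ # 1 ≺ γ) z₁ y₂)
      (lin (m ∷ + a ∷ z ∷ y ∷ + b ∷ + k ∷ []) ((γ ≺ α) ∷ (α ⊟ (# 1 ⊞ β) ⊟ η ≼ ζ) ∷ (θ ≐ # 1 ⊞ β ⊞ η) ∷ []) (γ ⊞ # 1 ≺ ζ ⊞ (# 1 ⊞ θ)) z₂ y₁ k≡ᶻ)))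

  -- `dA` starts at the first missing class, a choice that rotation does not respect. Any other
  -- class outside `A` gives the same value, because a change of start interchanges two groups of
  -- letters, each letter of one commuting with each of the other.
  ∇-start : ∀ m m′ (A : Subset k) → Vec.lookup A (fin m) ≡ false → Vec.lookup A (fin m′) ≡ false →
    ∀ {Ψ} → Resp Ψ → ∀ u → ∇ (descendingWord m A) Ψ u ≡ ∇ (descendingWord m′ A) Ψ u
  ∇-start m m′ A m∉ m′∉ {Ψ} resp u = decide (rem (m -ᶻ m′)) refl
    where
    decide : ∀ d → rem (m -ᶻ m′) ≡ d → ∇ (descendingWord m A) Ψ u ≡ ∇ (descendingWord m′ A) Ψ u
    decide zero    e = cong (λ w → ∇ (List.filterᵇ (Vec.lookup A) w) Ψ u) (descending-cong k (quo (m -ᶻ m′) ,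
        lin (m ∷ m′ ∷ + rem (m -ᶻ m′) ∷ quo (m -ᶻ m′) ∙N ∷ []) ((α ⊟ β ≐ γ ⊞ ζ) ∷ (γ ≐ # 0) ∷ []) (α ≐ β ⊞ ζ) (rem-quo (m -ᶻ m′)) (cong +_ e)))
    decide (suc a) e = trans (descendingWord-∇ m a A (ℕP.≤-pred (subst (_< suc k) e (rem<n (m -ᶻ m′)))) m∉ (trans (cong (Vec.lookup A) (fin-cong same)) m′∉) {Ψ} (λ {u} {v} → resp {u} {v}) u)
        (cong (λ w → ∇ (List.filterᵇ (Vec.lookup A) w) Ψ u) (descending-cong k same))
      where
      same : m -ᶻ + suc a ∼ m′
      same = quo (m -ᶻ m′) , lin (m ∷ m′ ∷ + rem (m -ᶻ m′) ∷ quo (m -ᶻ m′) ∙N ∷ + suc a ∷ []) ((α ⊟ β ≐ γ ⊞ ζ) ∷ (γ ≐ η) ∷ []) (α ⊟ η ≐ β ⊞ ζ) (rem-quo (m -ᶻ m′)) (cong +_ e)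

  -- Rotation and multiplication by a k-rectangle

  private
    cycle : ∀ {m} → Vec Bool (suc m) → Vec Bool (suc m)
    cycle (b ∷ v) = v Vec.∷ʳ b

    card-∷ʳ : ∀ {m} (v : Vec Bool m) b → card (v Vec.∷ʳ b) ≡ card (b ∷ v)
    card-∷ʳ []          b     = refl
    card-∷ʳ (true ∷ v)  true  = cong suc (card-∷ʳ v true)
    card-∷ʳ (true ∷ v)  false = cong suc (card-∷ʳ v false)
    card-∷ʳ (false ∷ v) true  = card-∷ʳ v true
    card-∷ʳ (false ∷ v) false = card-∷ʳ v false

    card-cycle : ∀ {m} (v : Vec Bool (suc m)) → card (cycle v) ≡ card v
    card-cycle (b ∷ v) = card-∷ʳ v b

    sum-allVecs : ∀ m (F : Vec Bool (suc m) → ℤ) → sum F (allVecs (suc m)) ≡ sum (F ∘ (true ∷_)) (allVecs m) +ᶻ sum (F ∘ (false ∷_)) (allVecs m)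
    sum-allVecs m F = trans (sum-concatMap F (λ b → map (b ∷_) (allVecs m)) (true ∷ false ∷ []))
      (trans (cong₂ (λ a b → a +ᶻ (b +ᶻ + 0)) (sum-map F (true ∷_) (allVecs m)) (sum-map F (false ∷_) (allVecs m)))
        (cong (sum (F ∘ (true ∷_)) (allVecs m) +ᶻ_) (ℤP.+-identityʳ _)))

    -- `allVecs` branches on the first entry; the same sum split by the last entry shows that cyclic
    -- rotation permutes the subsets.
    sum-allVecs-∷ʳ : ∀ m (F : Vec Bool (suc m) → ℤ) → sum F (allVecs (suc m)) ≡ sum (F ∘ (Vec._∷ʳ true)) (allVecs m) +ᶻ sum (F ∘ (Vec._∷ʳ false)) (allVecs m)
    sum-allVecs-∷ʳ zero    F = sum-allVecs zero F
    sum-allVecs-∷ʳ (suc m) F = begin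
      sum F (allVecs (suc (suc m)))                                   ≡⟨ sum-allVecs (suc m) F ⟩
      sum (F ∘ (true ∷_)) (allVecs (suc m)) +ᶻ sum (F ∘ (false ∷_)) (allVecs (suc m))
                                                                      ≡⟨ cong₂ _+ᶻ_ (sum-allVecs-∷ʳ m (F ∘ (true ∷_))) (sum-allVecs-∷ʳ m (F ∘ (false ∷_))) ⟩
      tt′ +ᶻ tf +ᶻ (ft +ᶻ ff′)                                        ≡⟨ lin (tt′ ∷ tf ∷ ft ∷ ff′ ∷ []) [] (α ⊞ β ⊞ (γ ⊞ ζ) ≐ α ⊞ γ ⊞ (β ⊞ ζ)) ⟩
      tt′ +ᶻ ft +ᶻ (tf +ᶻ ff′)                                        ≡⟨ cong₂ _+ᶻ_ (sum-allVecs m (F ∘ (Vec._∷ʳ true))) (sum-allVecs m (F ∘ (Vec._∷ʳ false))) ⟨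
      sum (F ∘ (Vec._∷ʳ true)) (allVecs (suc m)) +ᶻ sum (F ∘ (Vec._∷ʳ false)) (allVecs (suc m)) ∎
      where
      open ≡-Reasoning
      tt′ = sum (λ v → F (true ∷ (v Vec.∷ʳ true))) (allVecs m)
      tf  = sum (λ v → F (true ∷ (v Vec.∷ʳ false))) (allVecs m)
      ft  = sum (λ v → F (false ∷ (v Vec.∷ʳ true))) (allVecs m)
      ff′ = sum (λ v → F (false ∷ (v Vec.∷ʳ false))) (allVecs m)

    sum-cycle : ∀ m (F : Vec Bool (suc m) → ℤ) → sum (F ∘ cycle) (allVecs (suc m)) ≡ sum F (allVecs (suc m))
    sum-cycle m F = trans (sum-allVecs m (F ∘ cycle)) (sym (sum-allVecs-∷ʳ m F))

    lookup-∷ʳ : ∀ {m} (v : Vec Bool m) b (i : Fin (suc m)) →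
      (∀ (j : Fin (suc m)) → toℕ j ≡ suc (toℕ i) → Vec.lookup (v Vec.∷ʳ b) i ≡ Vec.lookup (b ∷ v) j) × (toℕ i ≡ m → Vec.lookup (v Vec.∷ʳ b) i ≡ b)
    lookup-∷ʳ []      b Fin.zero    = (λ { Fin.zero () }) , (λ _ → refl)
    lookup-∷ʳ (x ∷ v) b Fin.zero    = (λ { Fin.zero () ; (Fin.suc Fin.zero) _ → refl ; (Fin.suc (Fin.suc _)) () }) , (λ ())
    lookup-∷ʳ (x ∷ v) b (Fin.suc i) = shift , (λ e → proj₂ (lookup-∷ʳ v b i) (ℕP.suc-injective e))
      where
      shift : ∀ j → toℕ j ≡ suc (suc (toℕ i)) → Vec.lookup (v Vec.∷ʳ b) i ≡ Vec.lookup (b ∷ x ∷ v) j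
      shift (Fin.suc Fin.zero) ()
      shift (Fin.suc (Fin.suc j)) e = proj₁ (lookup-∷ʳ v b i) (Fin.suc j) (ℕP.suc-injective e)

    lookup-cycle : ∀ (A : Subset k) x → Vec.lookup (cycle A) (fin x) ≡ Vec.lookup A (fin (x +ᶻ + 1))
    lookup-cycle (b ∷ v) x with ℕP.m≤n⇒m<n∨m≡n (rem<n x)
    ... | inj₁ lt = proj₁ (lookup-∷ʳ v b (fin x)) (fin (x +ᶻ + 1))
          (trans (toℕ-fin (x +ᶻ + 1)) (trans (rem-+1 x) (trans (m<n⇒m%n≡m lt) (cong suc (sym (toℕ-fin x))))))
    ... | inj₂ eq = trans (proj₂ (lookup-∷ʳ v b (fin x)) (trans (toℕ-fin x) (ℕP.suc-injective eq)))
          (cong (Vec.lookup (b ∷ v)) (sym (FinP.toℕ-injective {i = fin (x +ᶻ + 1)} {Fin.zero} (trans (toℕ-fin (x +ᶻ + 1)) (trans (rem-+1 x) (trans (cong (ℕ._% suc k) eq) (n%n≡0 (suc k))))))))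

    cycles : ℕ → Subset k → Subset k
    cycles zero    A = A
    cycles (suc t) A = cycle (cycles t A)

    card-cycles : ∀ t A → card (cycles t A) ≡ card A
    card-cycles zero    A = refl
    card-cycles (suc t) A = trans (card-cycle (cycles t A)) (card-cycles t A)

    sum-cycles : ∀ t (F : Subset k → ℤ) → sum (F ∘ cycles t) (allVecs (suc k)) ≡ sum F (allVecs (suc k))
    sum-cycles zero    F = refl
    sum-cycles (suc t) F = trans (sum-cycles t (F ∘ cycle)) (sum-cycle k F)

    lookup-cycles : ∀ t (A : Subset k) x → Vec.lookup (cycles t A) (fin x) ≡ Vec.lookup A (fin (x +ᶻ + t))
    lookup-cycles zero    A x = cong (λ y → Vec.lookup A (fin y)) (sym (ℤP.+-identityʳ x))
    lookup-cycles (suc t) A x = trans (lookup-cycle (cycles t A) x) (trans (lookup-cycles t A (x +ᶻ + 1))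
      (cong (λ y → Vec.lookup A (fin y)) (ℤP.+-assoc x (+ 1) (+ t))))

    sum-subsets : ∀ r (F : Subset k → ℤ) → sum F (subsets r) ≡ sum (λ A → if card A ≡ᵇ r then F A else + 0) (allVecs (suc k))
    sum-subsets r F = sum-filter F (λ A → card A ≡ᵇ r) (allVecs (suc k))

    sum-subsets-cycles : ∀ t r (F : Subset k → ℤ) → sum (F ∘ cycles t) (subsets r) ≡ sum F (subsets r)
    sum-subsets-cycles t r F = trans (sum-subsets r (F ∘ cycles t)) (trans
      (sum-cong′ (allVecs (suc k)) (λ A → cong (λ c → if c ≡ᵇ r then F (cycles t A) else + 0) (sym (card-cycles t A))))
      (trans (sum-cycles t (λ A → if card A ≡ᵇ r then F A else + 0)) (sym (sum-subsets r F))))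

  rotate : ℕ → Word k → Word k
  rotate t = map (λ i → fin (ι i +ᶻ + t))

  private
    rotate-descending : ∀ t m c → rotate t (descending m c) ≡ descending (m +ᶻ + t) c
    rotate-descending t m zero    = refl
    rotate-descending t m (suc c) = cong₂ _∷_ (trans (fin-cong (∼-+ (+ t) (ι-fin (m -ᶻ + 1)))) (cong fin move))
      (trans (rotate-descending t (m -ᶻ + 1) c) (cong (λ z → descending z c) move))
      where
      move : m -ᶻ + 1 +ᶻ + t ≡ m +ᶻ + t -ᶻ + 1
      move = lin (m ∷ + t ∷ []) [] (α ⊟ # 1 ⊞ β ≐ α ⊞ β ⊟ # 1)

    map-filterᵇ : ∀ {A B : Set} (f : A → B) p q → (∀ x → p x ≡ q (f x)) → ∀ xs → map f (List.filterᵇ p xs) ≡ List.filterᵇ q (map f xs)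
    map-filterᵇ f p q e []       = refl
    map-filterᵇ f p q e (x ∷ xs) with p x | q (f x) | e x
    ... | true  | true  | _ = cong (f x ∷_) (map-filterᵇ f p q e xs)
    ... | false | false | _ = map-filterᵇ f p q e xs

    rotate-descendingWord : ∀ t m (A : Subset k) → rotate t (descendingWord m (cycles t A)) ≡ descendingWord (m +ᶻ + t) A
    rotate-descendingWord t m A = trans (map-filterᵇ _ (Vec.lookup (cycles t A)) (Vec.lookup A)
        (λ i → trans (cong (Vec.lookup (cycles t A)) (sym (fin-ι i))) (lookup-cycles t A (ι i))) (descending m k))
      (cong (List.filterᵇ (Vec.lookup A)) (rotate-descending t m k))

    ∇-rotate : ∀ t r₀ a Φ u → ∇ (rotate t a) Φ (rotate t u ++ r₀) ≡ ∇ a (λ u → Φ (rotate t u ++ r₀)) u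
    ∇-rotate t r₀ []      Φ u = refl
    ∇-rotate t r₀ (i ∷ a) Φ u = ∇-rotate t r₀ a _ u

  -- Reindexing by `A′ = cycles t A`, the subset A - t: the word of `A′` rotated by t is a
  -- cyclically decreasing word of `A` up to its starting point, and `∇-start` absorbs that
  -- difference.
  ∇-sum-rotate : ∀ t r₀ r → r ≤ k → ∀ {Φ} → Resp Φ → ∀ u →
    sum (λ A → ∇ (dA A) Φ (rotate t u ++ r₀)) (subsets r) ≡ sum (λ A → ∇ (dA A) (λ u → Φ (rotate t u ++ r₀)) u) (subsets r)
  ∇-sum-rotate t r₀ r r≤k {Φ} resp u = trans (trans (sum-subsets r _) (trans (sum-cong′ (allVecs (suc k)) same) (sym (sum-subsets r _))))
    (sum-subsets-cycles t r (λ A → ∇ (dA A) (λ u → Φ (rotate t u ++ r₀)) u))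
    where
    guard : ∀ b {x y : ℤ} → (b ≡ true → x ≡ y) → (if b then x else + 0) ≡ (if b then y else + 0)
    guard true  f = f refl
    guard false f = refl
    same : ∀ A → (if card A ≡ᵇ r then ∇ (dA A) Φ (rotate t u ++ r₀) else + 0)
               ≡ (if card A ≡ᵇ r then ∇ (dA (cycles t A)) (λ u → Φ (rotate t u ++ r₀)) u else + 0)
    same A = guard (card A ≡ᵇ r) λ e → equal (ℕP.≤-trans (s≤s (ℕP.≤-reflexive (ℕP.≡ᵇ⇒≡ (card A) r (subst T (sym e) tt)))) (s≤s r≤k))
      where
      A′ = cycles t A
      m  = ι (missing A′)
      equal : card A < suc k → ∇ (dA A) Φ (rotate t u ++ r₀) ≡ ∇ (dA A′) (λ u → Φ (rotate t u ++ r₀)) u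
      equal lt = begin
        ∇ (dA A) Φ (rotate t u ++ r₀)                                   ≡⟨ cong (λ a → ∇ a Φ (rotate t u ++ r₀)) (dword≡ A) ⟩
        ∇ (descendingWord (ι (missing A)) A) Φ (rotate t u ++ r₀)       ≡⟨ ∇-start (ι (missing A)) (m +ᶻ + t) A
                                                                            (trans (cong (Vec.lookup A) (fin-ι (missing A))) (missing∉ A lt))
                                                                            (trans (sym (lookup-cycles t A m)) (trans (cong (Vec.lookup A′) (fin-ι (missing A′))) (missing∉ A′ (subst (_< suc k) (sym (card-cycles t A)) lt))))
                                                                            {Φ} (λ {u} {v} → resp {u} {v}) (rotate t u ++ r₀) ⟩
        ∇ (descendingWord (m +ᶻ + t) A) Φ (rotate t u ++ r₀)            ≡⟨ cong (λ a → ∇ a Φ (rotate t u ++ r₀)) (rotate-descendingWord t m A) ⟨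
        ∇ (rotate t (descendingWord m A′)) Φ (rotate t u ++ r₀)         ≡⟨ ∇-rotate t r₀ (descendingWord m A′) Φ u ⟩
        ∇ (descendingWord m A′) (λ u → Φ (rotate t u ++ r₀)) u          ≡⟨ cong (λ a → ∇ a (λ u → Φ (rotate t u ++ r₀)) u) (dword≡ A′) ⟨
        ∇ (dA A′) (λ u → Φ (rotate t u ++ r₀)) u                        ∎
        where open ≡-Reasoning

  -- The rectangle element and the map Θ

  s-translate : ∀ y t x → s (y +ᶻ t) (x +ᶻ t) ≡ s y x +ᶻ t
  s-translate y t x with view y x
  ... | up l e q = trans (s-up _ _ (∼-+ {y} {x} t (l , e))) (trans (lin (x ∷ t ∷ []) [] (α ⊞ β ⊞ # 1 ≐ α ⊞ # 1 ⊞ β)) (cong (_+ᶻ t) (sym q)))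
  ... | down l e q = trans (s-down _ _ (subst (x +ᶻ t ∼_) (lin (y ∷ t ∷ []) [] (α ⊞ # 1 ⊞ β ≐ α ⊞ β ⊞ # 1)) (∼-+ {y +ᶻ + 1} {x} t (l , e))))
        (trans (lin (x ∷ t ∷ []) [] (α ⊞ β ⊟ # 1 ≐ α ⊟ # 1 ⊞ β)) (cong (_+ᶻ t) (sym q)))
  ... | stay n₁ n₂ q = trans (s-stay _ _ (n₁ ∘ ∼-+-cancel t) (λ c → n₂ (∼-+-cancel t (subst (x +ᶻ t ∼_) (lin (y ∷ t ∷ []) [] (α ⊞ β ⊞ # 1 ≐ α ⊞ # 1 ⊞ β)) c))))
        (cong (_+ᶻ t) (sym q))

  act-rotate : ∀ t (u : Word k) x → act (rotate t u) (x +ᶻ + t) ≡ act u x +ᶻ + t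
  act-rotate t []      x = refl
  act-rotate t (i ∷ u) x = trans (act-fin (ι i +ᶻ + t) (rotate t u) _) (trans (cong (s (ι i +ᶻ + t)) (act-rotate t u x))
    (trans (s-translate (ι i) (+ t) (act u x)) (cong (_+ᶻ + t) (sym (act-∷ i u x)))))

  inv-rotate : ∀ t (u : Word k) x → inv (rotate t u) (x +ᶻ + t) ≡ inv u x +ᶻ + t
  inv-rotate t u x = act-injective (rotate t u) (trans (act-inv (rotate t u) _) (sym (trans (act-rotate t u (inv u x)) (cong (_+ᶻ + t) (act-inv u x)))))

  inv-++ : ∀ (u v : Word k) x → inv (u ++ v) x ≡ inv v (inv u x)
  inv-++ u v x = trans (cong (λ w → act w x) (ListP.reverse-++ u v)) (act-++ (reverse v) (reverse u) x)

  -- The action of the element of the k-rectangle R_t.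
  IsRectangle : ℕ → Word k → Set
  IsRectangle t r = ∀ x → (pos x ≤ᶻ + t → act r x ≡ x +ᶻ + t -ᶻ N) × (+ t <ᶻ pos x → act r x ≡ x +ᶻ + t)

  pos-shift : ∀ p l → pos (p +ᶻ l ∙N) ≡ pos p
  pos-shift p l = lin (p ∷ l ∙N ∷ pos (p +ᶻ l ∙N) ∷ blk (p +ᶻ l ∙N) ∙N ∷ pos p ∷ blk p ∙N ∷ (blk p +ᶻ l) ∙N ∷ [])
    ((α ⊞ β ≐ γ ⊞ ζ) ∷ (α ≐ η ⊞ θ) ∷ (ξ ≐ θ ⊞ β) ∷ (ζ ≐ ξ) ∷ []) (γ ≐ η)
    (pos+blk (p +ᶻ l ∙N)) (pos+blk p) (N-add (blk p) l) (cong _∙N (blk-shift p l))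

  module Rectangle (t : ℕ) (r : Word k) (isR : IsRectangle t r) where

    Θ : Word k → Word k
    Θ w = rotate t w ++ r

    private
      inv-r : ∀ y → (pos y ≤ᶻ + t × inv r (y +ᶻ + t) ≡ y +ᶻ + 1 ∙N) ⊎ (+ t <ᶻ pos y × inv r (y +ᶻ + t) ≡ y)
      inv-r y with pos y ℤP.≤? + t
      ... | yes le = inj₁ (le , act-injective r (trans (act-inv r _) (sym (trans (proj₁ (isR (y +ᶻ + 1 ∙N)) (subst (_≤ᶻ + t) (sym (pos-shift y (+ 1))) le))
              (lin (y ∷ + 1 ∙N ∷ + t ∷ N ∷ []) ((β ≐ ζ) ∷ []) (α ⊞ β ⊞ γ ⊟ ζ ≐ α ⊞ γ) N-one)))))
      ... | no nle = inj₂ (ℤP.≰⇒> nle , act-injective r (trans (act-inv r _) (sym (proj₂ (isR y) (ℤP.≰⇒> nle)))))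

      -- The rectangle element moves the first t positions of each block by t - n and the others by
      -- t; so under `Θ` exactly the values at the first t positions of a block rise by one block.
      block-Θ : ∀ w x → (pos (inv w x) ≤ᶻ + t × block (Θ w) (x +ᶻ + t) ≡ block w x +ᶻ + 1) ⊎ (+ t <ᶻ pos (inv w x) × block (Θ w) (x +ᶻ + t) ≡ block w x)
      block-Θ w x = shape (inv-r (inv w x))
        where
        unfold : inv (Θ w) (x +ᶻ + t) ≡ inv r (inv w x +ᶻ + t)
        unfold = trans (inv-++ (rotate t w) r _) (cong (inv r) (inv-rotate t w x))
        shape : _ → _
        shape (inj₁ (le , e)) = inj₁ (le , trans (cong blk (trans unfold e)) (blk-shift (inv w x) (+ 1)))
        shape (inj₂ (lt , e)) = inj₂ (lt , cong blk (trans unfold e))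

      act-pos : ∀ w x → act w (pos (inv w x)) ≡ x -ᶻ block w x ∙N
      act-pos w x = lin (act w (pos (inv w x)) ∷ x ∷ block w x ∙N ∷ []) ((β ≐ α ⊞ γ) ∷ []) (α ≐ β ⊟ γ)
        (trans (sym (act-inv w x)) (trans (cong (act w) (pos+blk (inv w x))) (act-shift w _ _)))

      blk-pos : ∀ p → blk (pos p) ≡ + 0
      blk-pos p = blk-zero (1≤pos p) (pos≤N p)

    -- Only a raised y beside an unraised y + 1 could spoil the comparison. Brought into the window,
    -- the two values are y - b(y) n and y + 1 - b(y+1) n; the second is smaller as n > 1. As the
    -- window increases, y + 1 stands at the smaller position in its block and is raised whenever y
    -- is.
    Up-Θ : ∀ {w} → Incr w → ∀ y → Up y w → Up (y +ᶻ + t) (Θ w)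
    Up-Θ {w} inc y u = subst (λ z → block (Θ w) (y +ᶻ + t) <ᶻ block (Θ w) z) (lin (y ∷ + t ∷ []) [] (α ⊞ # 1 ⊞ β ≐ α ⊞ β ⊞ # 1))
        (compare (block-Θ w y) (block-Θ w (y +ᶻ + 1)))
      where
      later : pos (inv w y) <ᶻ pos (inv w (y +ᶻ + 1)) → ⊥
      later lt = lin (y ∷ block w y ∙N ∷ block w (y +ᶻ + 1) ∙N ∷ N ∷ []) ((α ⊟ β ≺ α ⊞ # 1 ⊟ γ) ∷ (β ⊞ ζ ≼ γ) ∷ (# 1 ≺ ζ) ∷ []) ff
        (subst₂ _<ᶻ_ (act-pos w y) (act-pos w (y +ᶻ + 1)) (raise inc (trans (blk-pos (inv w y)) (sym (blk-pos (inv w (y +ᶻ + 1))))) lt)) (N-gap u) 1<N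
      compare : _ → _ → block (Θ w) (y +ᶻ + t) <ᶻ block (Θ w) (y +ᶻ + 1 +ᶻ + t)
      compare (inj₁ (_ , e)) (inj₁ (_ , f)) = lin (block w y ∷ block w (y +ᶻ + 1) ∷ block (Θ w) (y +ᶻ + t) ∷ block (Θ w) (y +ᶻ + 1 +ᶻ + t) ∷ [])
        ((α ≺ β) ∷ (γ ≐ α ⊞ # 1) ∷ (ζ ≐ β ⊞ # 1) ∷ []) (γ ≺ ζ) u e f
      compare (inj₁ (le , e)) (inj₂ (lt , f)) = ⊥-elim (later (ℤP.≤-<-trans le lt))
      compare (inj₂ (_ , e)) (inj₁ (_ , f)) = lin (block w y ∷ block w (y +ᶻ + 1) ∷ block (Θ w) (y +ᶻ + t) ∷ block (Θ w) (y +ᶻ + 1 +ᶻ + t) ∷ [])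
        ((α ≺ β) ∷ (γ ≐ α) ∷ (ζ ≐ β ⊞ # 1) ∷ []) (γ ≺ ζ) u e f
      compare (inj₂ (_ , e)) (inj₂ (_ , f)) = subst₂ _<ᶻ_ (sym e) (sym f) u

    -- A new comparison could arise only from equal blocks with y + 1 raised and y not. But then y +
    -- 1 stands directly after y by `adjacent`, hence also beyond position t.
    Up-Θ⁻¹ : ∀ {w} → Incr w → ∀ y → Up (y +ᶻ + t) (Θ w) → Up y w
    Up-Θ⁻¹ {w} inc y u = ℤP.≰⇒> λ le → ℤP.<⇒≱ (subst (λ z → block (Θ w) (y +ᶻ + t) <ᶻ block (Θ w) z) (lin (y ∷ + t ∷ []) [] (α ⊞ β ⊞ # 1 ≐ α ⊞ # 1 ⊞ β)) u)
        (compare le (block-Θ w y) (block-Θ w (y +ᶻ + 1)))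
      where
      compare : block w (y +ᶻ + 1) ≤ᶻ block w y → _ → _ → block (Θ w) (y +ᶻ + 1 +ᶻ + t) ≤ᶻ block (Θ w) (y +ᶻ + t)
      compare le (inj₁ (_ , e)) (inj₁ (_ , f)) = lin (block w y ∷ block w (y +ᶻ + 1) ∷ block (Θ w) (y +ᶻ + t) ∷ block (Θ w) (y +ᶻ + 1 +ᶻ + t) ∷ [])
        ((β ≼ α) ∷ (γ ≐ α ⊞ # 1) ∷ (ζ ≐ β ⊞ # 1) ∷ []) (ζ ≼ γ) le e f
      compare le (inj₁ (_ , e)) (inj₂ (_ , f)) = lin (block w y ∷ block w (y +ᶻ + 1) ∷ block (Θ w) (y +ᶻ + t) ∷ block (Θ w) (y +ᶻ + 1 +ᶻ + t) ∷ [])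
        ((β ≼ α) ∷ (γ ≐ α ⊞ # 1) ∷ (ζ ≐ β) ∷ []) (ζ ≼ γ) le e f
      compare le (inj₂ (_ , e)) (inj₂ (_ , f)) = subst₂ _≤ᶻ_ (sym f) (sym e) le
      compare le (inj₂ (lt , e)) (inj₁ (le′ , f)) with ℤP.<-cmp (block w (y +ᶻ + 1)) (block w y)
      ... | tri< b _ _ = lin (block w y ∷ block w (y +ᶻ + 1) ∷ block (Θ w) (y +ᶻ + t) ∷ block (Θ w) (y +ᶻ + 1 +ᶻ + t) ∷ [])
        ((β ≺ α) ∷ (γ ≐ α) ∷ (ζ ≐ β ⊞ # 1) ∷ []) (ζ ≼ γ) b e f
      ... | tri> _ _ g = ⊥-elim (ℤP.<⇒≱ g le)
      ... | tri≈ _ b _ = ⊥-elim (lin (pos p ∷ pos q ∷ + t ∷ p ∷ q ∷ blk p ∙N ∷ blk q ∙N ∷ []) ((γ ≺ α) ∷ (β ≼ γ) ∷ (ζ ≐ α ⊞ θ) ∷ (η ≐ β ⊞ ξ) ∷ (ξ ≐ θ) ∷ (η ≐ ζ ⊞ # 1) ∷ []) ff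
              lt le′ (pos+blk p) (pos+blk q) (cong _∙N b) (adjacent {w} inc y (sym b)))
        where
        p = inv w y
        q = inv w (y +ᶻ + 1)

    D-Θ : ∀ i {w} → Incr w → D (fin (ι i +ᶻ + t)) (Θ w) ≡ Θ (D i w)
    D-Θ i {w} inc = decide (Up? (ι i) w)
      where
      same : ι (fin (ι i +ᶻ + t)) ∼ ι i +ᶻ + t
      same = ι-fin (ι i +ᶻ + t)
      decide : Dec (Up (ι i) w) → D (fin (ι i +ᶻ + t)) (Θ w) ≡ Θ (D i w)
      decide (yes u) = trans (D-yes {fin (ι i +ᶻ + t)} {Θ w} (Up-class (Θ w) (∼-sym same) (Up-Θ {w} inc (ι i) u))) (cong Θ (sym (D-yes {i} {w} u)))
      decide (no n)  = trans (D-no {fin (ι i +ᶻ + t)} {Θ w} (λ u → n (Up-Θ⁻¹ {w} inc (ι i) (Up-class (Θ w) same u)))) (cong Θ (sym (D-no {i} {w} n)))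

    δ-Θ : ∀ r₀ → δ r₀ ≈W r → ∀ u → δ (rotate t u ++ r₀) ≈W Θ (δ u)
    δ-Θ r₀ e []      = e
    δ-Θ r₀ e (i ∷ u) x = trans (D-cong (fin (ι i +ᶻ + t)) {δ (rotate t u ++ r₀)} {Θ (δ u)} (δ-Θ r₀ e u) x)
      (cong (λ w → act w x) (D-Θ i {δ u} (δ-Incr u)))

  -- Triangularity of the Pieri rule

  Ds : Word k → Word k → Word k
  Ds a v = foldr D v a

  δ-++ : ∀ a u → δ (a ++ u) ≡ Ds a (δ u)
  δ-++ a u = ListP.foldr-++ D [] a u

  Ds-cong : ∀ a {v w} → v ≈W w → Ds a v ≈W Ds a w
  Ds-cong []      e = e
  Ds-cong (i ∷ a) {v} {w} e = D-cong i {Ds a v} {Ds a w} (Ds-cong a {v} {w} e)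

  ℓ-D : ∀ i v → ℓ (D i v) ≤ suc (ℓ v)
  ℓ-D i v = decide (Up? (ι i) v)
    where
    decide : Dec (Up (ι i) v) → ℓ (D i v) ≤ suc (ℓ v)
    decide (yes u) = ℕP.≤-trans (ℕP.≤-reflexive (cong ℓ (D-yes {i} {v} u))) (ℓ-∷ i v)
    decide (no n)  = ℕP.≤-trans (ℕP.≤-reflexive (cong ℓ (D-no {i} {v} n))) (ℕP.n≤1+n (ℓ v))

  ℓ-Ds : ∀ a v → ℓ (Ds a v) ≤ length a ℕ.+ ℓ v
  ℓ-Ds []      v = ℕP.≤-refl
  ℓ-Ds (i ∷ a) v = ℕP.≤-trans (ℓ-D i (Ds a v)) (s≤s (ℓ-Ds a v))

  -- Every subword other than `a` itself is shorter, so only one term of the alternating sum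
  -- survives, with sign +.
  ∇-leading : ∀ a Ψ u → (∀ b → length b < length a → Ψ (b ++ u) ≡ + 0) → ∇ a Ψ u ≡ Ψ (a ++ u)
  ∇-leading []      Ψ u z = refl
  ∇-leading (i ∷ a) Ψ u z = trans
    (∇-leading a (step i Ψ) u (λ b lt → cong₂ _-ᶻ_ (z (i ∷ b) (s≤s lt)) (z b (ℕP.m≤n⇒m≤1+n lt))))
    (trans (cong (λ t → Ψ (i ∷ a ++ u) -ᶻ t) (z a ℕP.≤-refl)) (ℤP.+-identityʳ _))

  sum-single : ∀ m (F : Vec Bool m → ℤ) B → (∀ A → A ≢ B → F A ≡ + 0) → sum F (allVecs m) ≡ F B
  sum-single zero    F []      z = ℤP.+-identityʳ (F [])
  sum-single (suc m) F (b ∷ B) z = trans (trans (sum-concatMap F (λ b → map (b ∷_) (allVecs m)) (true ∷ false ∷ []))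
    (cong₂ (λ x y → x +ᶻ (y +ᶻ + 0)) (sum-map F (true ∷_) (allVecs m)) (sum-map F (false ∷_) (allVecs m)))) (halves b z)
    where
    none : ∀ c b → c ≢ b → (∀ A → A ≢ b ∷ B → F A ≡ + 0) → sum (F ∘ (c ∷_)) (allVecs m) ≡ + 0
    none c b ne z = trans (sum-cong′ (allVecs m) (λ A → z (c ∷ A) (ne ∘ cong Vec.head))) (sum-zero (allVecs m))
    half : ∀ b → (∀ A → A ≢ b ∷ B → F A ≡ + 0) → sum (F ∘ (b ∷_)) (allVecs m) ≡ F (b ∷ B)
    half b z = sum-single m (F ∘ (b ∷_)) B (λ A ne → z (b ∷ A) (ne ∘ VecP.∷-injectiveʳ))
    halves : ∀ b → (∀ A → A ≢ b ∷ B → F A ≡ + 0) → sum (F ∘ (true ∷_)) (allVecs m) +ᶻ (sum (F ∘ (false ∷_)) (allVecs m) +ᶻ + 0) ≡ F (b ∷ B)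
    halves true  z = trans (cong₂ _+ᶻ_ (half true z) (cong (_+ᶻ + 0) (none false true (λ ()) z))) (ℤP.+-identityʳ _)
    halves false z = trans (cong₂ _+ᶻ_ (none true false (λ ()) z) (cong (_+ᶻ + 0) (half false z))) (trans (ℤP.+-identityˡ _) (ℤP.+-identityʳ _))

  equal-or-extra : ∀ {m} (A B : Vec Bool m) → card B ≤ card A → A ≡ B ⊎ ∃[ j ] Vec.lookup A j ≡ true × Vec.lookup B j ≡ false
  equal-or-extra []          []          _ = inj₁ refl
  equal-or-extra (true ∷ A)  (false ∷ B) _ = inj₂ (Fin.zero , refl , refl)
  equal-or-extra (true ∷ A)  (true ∷ B)  (s≤s le) with equal-or-extra A B le
  ... | inj₁ e           = inj₁ (cong (true ∷_) e)
  ... | inj₂ (j , p , q) = inj₂ (Fin.suc j , p , q)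
  equal-or-extra (false ∷ A) (false ∷ B) le with equal-or-extra A B le
  ... | inj₁ e           = inj₁ (cong (false ∷_) e)
  ... | inj₂ (j , p , q) = inj₂ (Fin.suc j , p , q)
  equal-or-extra (false ∷ A) (true ∷ B)  lt with equal-or-extra A B (ℕP.<⇒≤ lt)
  ... | inj₁ refl        = ⊥-elim (ℕP.<-irrefl refl lt)
  ... | inj₂ (j , p , q) = inj₂ (Fin.suc j , p , q)

  far : ∀ {z x} → z ≢ x → z <ᶻ x +ᶻ N → x <ᶻ z +ᶻ N → ¬ (z ∼ x)
  far {z} {x} ne hi lo c with ℤP.<-cmp z x
  ... | tri< l _ _ = between {x} {z} l lo (∼-sym c)
  ... | tri≈ _ e _ = ne e
  ... | tri> _ _ g = between {z} {x} g hi c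

  top : Word k → ℤ
  top w = act w N

  -- The largest value of a block stands at its last position, and for block l this value is
  -- `top w + l n`.
  value≤top : ∀ {w} → Incr w → ∀ x → x ≤ᶻ top w +ᶻ block w x ∙N
  value≤top {w} inc x = decide (ℤP.<-cmp p e)
    where
    p = inv w x
    e = N +ᶻ blk p ∙N
    at-e : act w e ≡ top w +ᶻ blk p ∙N
    at-e = act-shift w N (blk p)
    blk-e : blk e ≡ blk p
    blk-e = blk-unique N (blk p) (ℤP.<⇒≤ 1<N) ℤP.≤-refl refl
    decide : _ → x ≤ᶻ top w +ᶻ blk p ∙N
    decide (tri< l _ _) = ℤP.<⇒≤ (subst₂ _<ᶻ_ (act-inv w x) at-e (raise inc (sym blk-e) l))
    decide (tri≈ _ q _) = ℤP.≤-reflexive (trans (sym (act-inv w x)) (trans (cong (act w) q) at-e))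
    decide (tri> _ _ g) = ⊥-elim (lin (p ∷ N ∷ blk p ∙N ∷ pos p ∷ []) ((β ⊞ γ ≺ α) ∷ (α ≐ ζ ⊞ γ) ∷ (ζ ≼ β) ∷ []) ff g (pos+blk p) (pos≤N p))

  act-≤ : ∀ (u : Word k) x → act u x ≤ᶻ x +ᶻ + length u
  act-≤ []      x = ℤP.≤-reflexive (sym (ℤP.+-identityʳ x))
  act-≤ (i ∷ u) x = lin (act (i ∷ u) x ∷ s (ι i) (act u x) ∷ act u x ∷ x ∷ + length u ∷ []) ((α ≐ β) ∷ (β ≼ γ ⊞ # 1) ∷ (γ ≼ ζ ⊞ η) ∷ []) (α ≼ ζ ⊞ (# 1 ⊞ η))
    (act-∷ i u x) (s-≤ (ι i) (act u x)) (act-≤ u x)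

  top≤ : ∀ w → top w ≤ᶻ N +ᶻ + ℓ w
  top≤ w with ℓ-reduced w
  ... | v , e , lv = subst₂ (λ a b → a ≤ᶻ N +ᶻ + b) (e N) lv (act-≤ v N)

  -- A form of `h < top v` (see `Large⇒top`) that is visibly stable under `D`: a letter that acts
  -- hands the smaller of two blocks to the larger of two neighbouring values.
  Large : ℤ → Word k → Set
  Large h v = ∃[ y ] h <ᶻ y × block v y ≤ᶻ + 0

  private
    Large-∷ : ∀ {h v} i → Up (ι i) v → Large h v → Large h (i ∷ v)
    Large-∷ {h} {v} i u (y , h<y , le) = decide (view (ι i) y)
      where
      b : ∀ z {z′} → s (ι i) z ≡ z′ → block (i ∷ v) z ≡ block v z′
      b z e = trans (block-∷ i v z) (cong (block v) e)
      decide : View (ι i) y → Large h (i ∷ v)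
      decide (stay _ _ e) = y , h<y , subst (_≤ᶻ + 0) (sym (b y e)) le
      decide (up l e q) = y +ᶻ + 1 , lin (h ∷ y ∷ []) ((α ≺ β) ∷ []) (α ≺ β ⊞ # 1) h<y
        , subst (_≤ᶻ + 0) (sym (b (y +ᶻ + 1) (trans (s-down _ _ (∼-+ {ι i} {y} (+ 1) (l , e))) (lin (y ∷ []) [] (α ⊞ # 1 ⊟ # 1 ≐ α))))) le
      decide (down l e q) = y , h<y , subst (_≤ᶻ + 0) (sym (b y q)) (ℤP.≤-trans (ℤP.<⇒≤ smaller) le)
        where
        near : y -ᶻ + 1 ∼ ι i
        near = ∼-+-cancel (+ 1) (l , lin (ι i ∷ y ∷ l ∙N ∷ []) ((β ≐ α ⊞ # 1 ⊞ γ) ∷ []) (β ⊟ # 1 ⊞ # 1 ≐ α ⊞ # 1 ⊞ γ) e)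
        smaller : block v (y -ᶻ + 1) <ᶻ block v y
        smaller = subst (λ z → block v (y -ᶻ + 1) <ᶻ block v z) (lin (y ∷ []) [] (α ⊟ # 1 ⊞ # 1 ≐ α)) (Up-class v (∼-sym near) u)

  Large-Ds : ∀ {h v} a → Large h v → Large h (Ds a v)
  Large-Ds []      lg = lg
  Large-Ds {h} {v} (i ∷ a) lg = decide (Up? (ι i) (Ds a v))
    where
    decide : Dec (Up (ι i) (Ds a v)) → Large h (D i (Ds a v))
    decide (yes u) = subst (Large h) (sym (D-yes {i} {Ds a v} u)) (Large-∷ {h} {Ds a v} i u (Large-Ds {h} {v} a lg))
    decide (no n)  = subst (Large h) (sym (D-no {i} {Ds a v} n)) (Large-Ds {h} {v} a lg)

  Ds-Incr : ∀ a {v} → Incr v → Incr (Ds a v)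
  Ds-Incr []      inc = inc
  Ds-Incr (i ∷ a) {v} inc = D-Incr i {Ds a v} (Ds-Incr a {v} inc)

  Large⇒top : ∀ {h v} → Incr v → Large h v → h <ᶻ top v
  Large⇒top {h} {v} inc (y , h<y , le) = lin (h ∷ y ∷ top v ∷ block v y ∙N ∷ + 0 ∙N ∷ []) ((α ≺ β) ∷ (β ≼ γ ⊞ ζ) ∷ (ζ ≼ η) ∷ (η ≐ # 0) ∷ []) (α ≺ γ)
    h<y (value≤top {v} inc y) (N-mono le) N-zero

  -- The last letter of a nonempty reduced word would be a right descent. The letter s_0 is included
  -- here, in contrast to the Grassmannian condition.
  no-descent : ∀ w → (∀ i → act w (ι i) <ᶻ act w (ι i +ᶻ + 1)) → w ≈W []
  no-descent w asc = decide (ℓ-reduced w)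
    where
    decide : ∃[ v ] v ≈W w × length v ≡ ℓ w → w ≈W []
    decide (v , e , lv) with List.initLast v
    ... | []         = ≈W-sym {[]} {w} e
    ... | v′ List.∷ʳ′ i = ⊥-elim (ℕP.<⇒≱ (right-up i w (asc i)) (ℕP.≤-trans (ℓ-≤ (w ++ i ∷ []) v′ cancel)
            (ℕP.≤-trans (ℕP.≤-trans (ℕP.n≤1+n (length v′)) (ℕP.≤-reflexive (trans (ℕP.+-comm 1 (length v′)) (sym (ListP.length-++ v′))))) (ℕP.≤-reflexive lv))))
      where
      cancel : v′ ≈W w ++ i ∷ []
      cancel x = trans (sym (∷ʳ-involutive i v′ x)) (++-congˡ (i ∷ []) {v′ ++ i ∷ []} {w} e x)

  -- Every element other than the identity is d_B μ for the set B of those classes x in the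
  -- window (top − N, top] whose block is positive, with all the letters of d_B acting effectively:
  -- going down through the window, each positive block is exchanged with a block 0 above it.
  module Descent (w : Word k) (inc : Incr w) where

    M Top : ℤ
    Top = top w
    M = Top -ᶻ N

    private
      -- The member of the class of y in the window `(M, Top]`.
      representative : ℤ → ℤ
      representative y = Top -ᶻ + rem (Top -ᶻ y)

      positive? : ∀ x → Dec (+ 1 ≤ᶻ block w x)
      positive? x = + 1 ℤP.≤? block w x

    B : Subset k
    B = Vec.tabulate (λ i → ⌊ positive? (representative (ι i)) ⌋)

    private
      representative-window : ∀ x → M <ᶻ x → x ≤ᶻ Top → representative (ι (fin x)) ≡ x
      representative-window x lo hi = lin (Top ∷ x ∷ + rem (Top -ᶻ x) ∷ + rem (Top -ᶻ ι (fin x)) ∷ []) ((γ ≐ α ⊟ β) ∷ (ζ ≐ γ) ∷ []) (α ⊟ ζ ≐ β)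
          small (cong +_ (∼⇒rem congruent))
        where
        congruent : Top -ᶻ ι (fin x) ∼ Top -ᶻ x
        congruent with ∼-sym (ι-fin x)
        ... | l , e = l , lin (Top ∷ x ∷ ι (fin x) ∷ l ∙N ∷ []) ((β ≐ γ ⊞ ζ) ∷ []) (α ⊟ γ ≐ α ⊟ β ⊞ ζ) e
        small : + rem (Top -ᶻ x) ≡ Top -ᶻ x
        small = lin (Top ∷ x ∷ + rem (Top -ᶻ x) ∷ quo (Top -ᶻ x) ∙N ∷ []) ((α ⊟ β ≐ γ ⊞ ζ) ∷ (ζ ≐ # 0) ∷ []) (γ ≐ α ⊟ β)
          (rem-quo (Top -ᶻ x)) (trans (cong _∙N zero-turns) N-zero)
          where
          zero-turns : quo (Top -ᶻ x) ≡ + 0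
          zero-turns = division-unique {+ rem (Top -ᶻ x)} {Top -ᶻ x} (0≤+ _) (rem<N _)
            (lin (Top ∷ x ∷ []) ((β ≼ α) ∷ []) (# 0 ≼ α ⊟ β) hi)
            (lin (Top ∷ x ∷ N ∷ []) ((α ⊟ γ ≺ β) ∷ []) (α ⊟ β ≺ γ) lo)
            (lin (Top ∷ x ∷ + rem (Top -ᶻ x) ∷ quo (Top -ᶻ x) ∙N ∷ + 0 ∙N ∷ []) ((α ⊟ β ≐ γ ⊞ ζ) ∷ (η ≐ # 0) ∷ []) (γ ⊞ ζ ≐ α ⊟ β ⊞ η) (rem-quo (Top -ᶻ x)) N-zero)

    lookup-B : ∀ x → M <ᶻ x → x ≤ᶻ Top → Vec.lookup B (fin x) ≡ ⌊ positive? x ⌋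
    lookup-B x lo hi = trans (VecP.lookup∘tabulate (λ i → ⌊ positive? (representative (ι i)) ⌋) (fin x))
      (cong (λ y → ⌊ positive? y ⌋) (representative-window x lo hi))

    window-class : ∀ j → ∃[ x ] M <ᶻ x × x ≤ᶻ Top × fin x ≡ j
    window-class j = representative (ι j)
      , lin (Top ∷ N ∷ + rem (Top -ᶻ ι j) ∷ []) ((γ ≺ β) ∷ []) (α ⊟ β ≺ α ⊟ γ) (rem<N (Top -ᶻ ι j))
      , lin (Top ∷ + rem (Top -ᶻ ι j) ∷ []) ((# 0 ≼ β) ∷ []) (α ⊟ β ≼ α) (0≤+ _)
      , trans (fin-cong {representative (ι j)} {ι j} (quo (Top -ᶻ ι j) , lin (Top ∷ ι j ∷ + rem (Top -ᶻ ι j) ∷ quo (Top -ᶻ ι j) ∙N ∷ []) ((α ⊟ β ≐ γ ⊞ ζ) ∷ []) (α ⊟ γ ≐ β ⊞ ζ) (rem-quo (Top -ᶻ ι j)))) (fin-ι j)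

    block-Top : block w Top ≡ + 0
    block-Top = trans (cong blk (inv-act w N)) (blk-zero (ℤP.<⇒≤ 1<N) ℤP.≤-refl)

    0≤block : ∀ x → M <ᶻ x → + 0 ≤ᶻ block w x
    0≤block x lo = ℤP.≮⇒≥ λ neg → lin (Top ∷ x ∷ N ∷ block w x ∙N ∷ + 0 ∙N ∷ []) ((α ⊟ γ ≺ β) ∷ (β ≼ α ⊞ ζ) ∷ (ζ ⊞ γ ≼ η) ∷ (η ≐ # 0) ∷ []) ff
      lo (value≤top {w} inc x) (N-gap neg) N-zero

    ⌊positive⌋ : ∀ x → M <ᶻ x → (⌊ positive? x ⌋ ≡ true × + 1 ≤ᶻ block w x) ⊎ (⌊ positive? x ⌋ ≡ false × block w x ≡ + 0)
    ⌊positive⌋ x lo with + 1 ℤP.≤? block w x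
    ... | yes p = inj₁ (refl , p)
    ... | no n  = inj₂ (refl , lin (block w x ∷ []) ((α ≺ # 1) ∷ (# 0 ≼ α) ∷ []) (α ≐ # 0) (ℤP.≰⇒> n) (0≤block x lo))

    private
      M<Top : M <ᶻ Top
      M<Top = lin (Top ∷ N ∷ []) ((# 1 ≺ β) ∷ []) (α ⊟ β ≺ α) 1<N

    Top∉B : Vec.lookup B (fin Top) ≡ false
    Top∉B = trans (lookup-B Top M<Top ℤP.≤-refl) (decide (⌊positive⌋ Top M<Top))
      where
      decide : _ → ⌊ positive? Top ⌋ ≡ false
      decide (inj₁ (_ , p)) = ⊥-elim (lin (block w Top ∷ []) ((# 1 ≼ α) ∷ (α ≐ # 0) ∷ []) ff p block-Top)
      decide (inj₂ (e , _)) = e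

    letters : ℕ → Word k
    letters j = List.filterᵇ (Vec.lookup B) (descending Top j)

    -- The invariant of the descent: a block 0 has been carried from `Top` down to `Top - j`, and
    -- each block it passed has moved up by one value. Where it meets another block 0 no letter is
    -- spent, the two being interchangeable. `size` records that every letter spent has lowered the
    -- length.
    record State (j : ℕ) : Set where
      field
        v      : Word k
        incr-v : Incr v
        link   : Ds (letters j) v ≈W w
        size   : ℓ w ≡ length (letters j) ℕ.+ ℓ v
        low    : ∀ x → M <ᶻ x → x <ᶻ Top -ᶻ + j → block v x ≡ block w x
        here₀  : block v (Top -ᶻ + j) ≡ + 0
        high   : ∀ x → Top -ᶻ + j <ᶻ x → x ≤ᶻ Top → block v x ≡ block w (x -ᶻ + 1)

    private
      initial : State 0
      initial = record
        { v = w ; incr-v = inc ; link = λ _ → refl ; size = refl ; low = λ _ _ _ → refl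
        ; here₀ = trans (cong (block w) (ℤP.+-identityʳ Top)) block-Top
        ; high = λ x lo hi → ⊥-elim (lin (Top ∷ x ∷ []) ((α ⊟ # 0 ≺ β) ∷ (β ≼ α) ∷ []) ff lo hi) }

      next : ∀ j → j < k → State j → State (suc j)
      next j j<k st = decide (⌊positive⌋ x M<x)
        where
        open State st
        x = Top -ᶻ + suc j
        x+1 : x +ᶻ + 1 ≡ Top -ᶻ + j
        x+1 = lin (Top ∷ + j ∷ []) [] (α ⊟ (# 1 ⊞ β) ⊞ # 1 ≐ α ⊟ β)
        M<x : M <ᶻ x
        M<x = lin (Top ∷ + suc j ∷ + k ∷ []) ((β ≼ γ) ∷ []) (α ⊟ (# 1 ⊞ γ) ≺ α ⊟ β) (+≤+ j<k)
        x<Top : x <ᶻ Top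
        x<Top = lin (Top ∷ + j ∷ []) ((# 0 ≼ β) ∷ []) (α ⊟ (# 1 ⊞ β) ≺ α) (0≤+ j)
        block-x : block v x ≡ block w x
        block-x = low x M<x (lin (Top ∷ + j ∷ []) [] (α ⊟ (# 1 ⊞ β) ≺ α ⊟ β))
        block-x+1 : block v (x +ᶻ + 1) ≡ + 0
        block-x+1 = trans (cong (block v) x+1) here₀
        split : letters (suc j) ≡ letters j ++ List.filterᵇ (Vec.lookup B) (fin x ∷ [])
        split = trans (cong (λ t → List.filterᵇ (Vec.lookup B) (descending Top t)) (ℕP.+-comm 1 j))
          (trans (cong (List.filterᵇ (Vec.lookup B)) (trans (descending-++ Top j 1) (cong (λ t → descending Top j ++ fin t ∷ []) (lin (Top ∷ + j ∷ []) [] (α ⊟ β ⊟ # 1 ≐ α ⊟ (# 1 ⊞ β))))))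
            (filterᵇ-++ (Vec.lookup B) (descending Top j) (fin x ∷ [])))
        tail : ∀ b → Vec.lookup B (fin x) ≡ b → List.filterᵇ (Vec.lookup B) (fin x ∷ []) ≡ (if b then fin x ∷ [] else [])
        tail true  e rewrite e = refl
        tail false e rewrite e = refl
        high-or-x+1 : ∀ z → x <ᶻ z → z ≡ x +ᶻ + 1 ⊎ Top -ᶻ + j <ᶻ z
        high-or-x+1 z lt with ℤP.<-cmp z (x +ᶻ + 1)
        ... | tri≈ _ e _ = inj₁ e
        ... | tri< l _ _ = ⊥-elim (lin (x ∷ z ∷ []) ((α ≺ β) ∷ (β ≺ α ⊞ # 1) ∷ []) ff lt l)
        ... | tri> _ _ g = inj₂ (subst (_<ᶻ z) x+1 g)
        decide : _ → State (suc j)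
        decide (inj₂ (e , zero-x)) = record
          { v = v ; incr-v = incr-v
          ; link = subst (λ a → Ds a v ≈W w) (sym same) link
          ; size = trans size (cong (λ a → length a ℕ.+ ℓ v) (sym same))
          ; low = λ z lo hi → low z lo (lin (Top ∷ + j ∷ z ∷ []) ((γ ≺ α ⊟ (# 1 ⊞ β)) ∷ []) (γ ≺ α ⊟ β) hi)
          ; here₀ = trans block-x zero-x
          ; high = λ z lo hi → [ (λ q → trans (cong (block v) q) (trans block-x+1 (trans (sym zero-x) (cong (block w) (lin (x ∷ z ∷ []) ((β ≐ α ⊞ # 1) ∷ []) (α ≐ β ⊟ # 1) q)))))
                               , (λ l → high z l hi) ]′ (high-or-x+1 z lo) }
          where
          same : letters (suc j) ≡ letters j
          same = trans split (trans (cong (letters j ++_) (tail false (trans (lookup-B x M<x (ℤP.<⇒≤ x<Top)) e))) (ListP.++-identityʳ (letters j)))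
        decide (inj₁ (e , pos-x)) = record
          { v = v′ ; incr-v = incr-v′
          ; link = subst (λ a → Ds a v′ ≈W w) (sym same) (λ y → trans (cong (λ u → act u y) (ListP.foldr-++ D v′ (letters j) (fin x ∷ [])))
                     (trans (Ds-cong (letters j) {D (fin x) v′} {v} back y) (link y)))
          ; size = trans size (trans (cong (length (letters j) ℕ.+_) size-v) (trans (ℕP.+-suc (length (letters j)) (ℓ v′))
                     (cong (ℕ._+ ℓ v′) (trans (ℕP.+-comm 1 (length (letters j))) (sym (trans (cong length same) (ListP.length-++ (letters j))))))))
          ; low = λ z lo hi → trans (away z (λ q → ℤP.<-irrefl q hi) (λ q → lin (x ∷ z ∷ []) ((β ≺ α) ∷ (β ≐ α ⊞ # 1) ∷ []) ff hi q) lo (ℤP.<⇒≤ (ℤP.<-trans hi x<Top)))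
                     (low z lo (lin (Top ∷ + j ∷ z ∷ []) ((γ ≺ α ⊟ (# 1 ⊞ β)) ∷ []) (γ ≺ α ⊟ β) hi))
          ; here₀ = block-v′-x
          ; high = λ z lo hi → [ (λ q → trans (cong (block v′) q) (trans block-v′-x+1 (cong (block w) (lin (x ∷ z ∷ []) ((β ≐ α ⊞ # 1) ∷ []) (α ≐ β ⊟ # 1) q))))
                               , (λ l → trans (away z (λ q → ℤP.<-irrefl (sym q) lo) (λ q → ℤP.<-irrefl (sym (trans q x+1)) l) (ℤP.<-trans M<x lo) hi) (high z l hi)) ]′ (high-or-x+1 z lo) }
          where
          v′ = fin x ∷ v
          same : letters (suc j) ≡ letters j ++ fin x ∷ []
          same = trans split (cong (letters j ++_) (tail true (trans (lookup-B x M<x (ℤP.<⇒≤ x<Top)) e)))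
          descent : block v (x +ᶻ + 1) <ᶻ block v x
          descent = lin (block v (x +ᶻ + 1) ∷ block v x ∷ block w x ∷ []) ((α ≐ # 0) ∷ (β ≐ γ) ∷ (# 1 ≼ γ) ∷ []) (α ≺ β) block-x+1 block-x pos-x
          incr-v′ : Incr v′
          incr-v′ = Incr-∷ {v} incr-v x (λ q → ℤP.<-irrefl (sym q) descent)
          block-v′-x : block v′ x ≡ + 0
          block-v′-x = trans (block-fin x v x) (trans (cong (block v) (s-self x)) block-x+1)
          block-v′-x+1 : block v′ (x +ᶻ + 1) ≡ block w x
          block-v′-x+1 = trans (block-fin x v _) (trans (cong (block v) (s-next x)) block-x)
          up-v′ : Up x v′
          up-v′ = subst₂ _<ᶻ_ (sym (trans (block-fin x v x) (cong (block v) (s-self x)))) (sym (trans (block-fin x v _) (cong (block v) (s-next x)))) descent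
          back : D (fin x) v′ ≈W v
          back y = trans (cong (λ u → act u y) (D-yes {fin x} {v′} (Up-class v′ (∼-sym (ι-fin x)) up-v′))) (∷∷-cancel (fin x) v y)
          size-v : ℓ v ≡ suc (ℓ v′)
          size-v = ℕP.≤-antisym (subst (_≤ suc (ℓ v′)) (ℓ-cong {fin x ∷ v′} {v} (∷∷-cancel (fin x) v)) (ℓ-∷ (fin x) v′)) (left-down x v (blk-< descent))
          away : ∀ z → z ≢ x → z ≢ x +ᶻ + 1 → M <ᶻ z → z ≤ᶻ Top → block v′ z ≡ block v z
          away z n₁ n₂ lo hi = trans (block-fin x v z) (cong (block v) (s-stay x z
            (far n₁ (lin (Top ∷ x ∷ z ∷ N ∷ []) ((γ ≼ α) ∷ (α ⊟ ζ ≺ β) ∷ []) (γ ≺ β ⊞ ζ) hi M<x) (lin (Top ∷ x ∷ z ∷ N ∷ []) ((β ≺ α) ∷ (α ⊟ ζ ≺ γ) ∷ []) (β ≺ γ ⊞ ζ) x<Top lo))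
            (far n₂ (lin (Top ∷ x ∷ z ∷ N ∷ []) ((γ ≼ α) ∷ (α ⊟ ζ ≺ β) ∷ []) (γ ≺ β ⊞ # 1 ⊞ ζ) hi M<x) (lin (Top ∷ x ∷ z ∷ N ∷ []) ((β ≺ α) ∷ (α ⊟ ζ ≺ γ) ∷ []) (β ⊞ # 1 ≺ γ ⊞ ζ) x<Top lo))))

      states : ∀ j → j ≤ k → State j
      states zero    _   = initial
      states (suc j) j<k = next j j<k (states j (ℕP.<⇒≤ j<k))

    final : State k
    final = states k ℕP.≤-refl

    open State final public using () renaming (v to μ; incr-v to incr-μ; link to d-μ; size to size-μ)

    block-μ : ∀ x → M <ᶻ x → x <ᶻ Top → block μ (x +ᶻ + 1) ≡ block w x
    block-μ x lo hi = trans (State.high final (x +ᶻ + 1) (lin (Top ∷ + k ∷ x ∷ []) ((α ⊟ (# 1 ⊞ β) ≺ γ) ∷ []) (α ⊟ β ≺ γ ⊞ # 1) lo)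
        (lin (Top ∷ x ∷ []) ((β ≺ α) ∷ []) (β ⊞ # 1 ≼ α) hi))
      (cong (block w) (lin (x ∷ []) [] (α ⊞ # 1 ⊟ # 1 ≐ α)))

    -- `Top + 1` is one turn above `Top - k`, where the carried block 0 has ended.
    block-μ-Top : block μ (Top +ᶻ + 1) ≡ + 1
    block-μ-Top = trans (cong (block μ) (lin (Top ∷ + k ∷ + 1 ∙N ∷ []) ((γ ≐ # 1 ⊞ β) ∷ []) (α ⊞ # 1 ≐ α ⊟ β ⊞ γ) N-one))
      (trans (block-shift μ (Top -ᶻ + k) (+ 1)) (cong (_+ᶻ + 1) (State.here₀ final)))

    c : ℕ
    c = card B

    length-letters : length (letters k) ≡ c
    length-letters = length-descendingWord Top B Top∉B

    c≤k : c ≤ k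
    c≤k = subst (_≤ k) length-letters (ℕP.≤-trans (ListP.length-filter _ (descending Top k)) (ℕP.≤-reflexive (length-descending Top k)))
      where
      length-descending : ∀ m c → length (descending m c) ≡ c
      length-descending m zero    = refl
      length-descending m (suc c) = cong suc (length-descending (m -ᶻ + 1) c)

    -- If no block in `(M, Top]` is positive, all are 0, so block 0 holds no value below M = w(0).
    -- Then w(0) < w(1), and no descent is left.
    c≡0⇒[] : c ≡ 0 → w ≈W []
    c≡0⇒[] c≡0 = no-descent w ascent
      where
      empty : ∀ {m} (A : Vec Bool m) → card A ≡ 0 → ∀ j → Vec.lookup A j ≡ false
      empty (false ∷ A) e Fin.zero    = refl
      empty (false ∷ A) e (Fin.suc j) = empty A e j
      empty (true ∷ A)  ()
      zeros : ∀ x → M <ᶻ x → x ≤ᶻ Top → block w x ≡ + 0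
      zeros x lo hi = decide (⌊positive⌋ x lo)
        where
        decide : _ → block w x ≡ + 0
        decide (inj₂ (_ , z)) = z
        decide (inj₁ (t , _)) = contradiction (trans (sym t) (trans (sym (lookup-B x lo hi)) (empty B c≡0 (fin x)))) (λ ())
      y = act w (+ 1)
      block-y : block w y ≡ + 0
      block-y = trans (cong blk (inv-act w (+ 1))) (blk-zero ℤP.≤-refl (ℤP.<⇒≤ 1<N))
      -- The translate of w(1) lying in `(M, Top]`. Its block is 0, as is that of w(1), so the
      -- number of turns between them is 0.
      x = y +ᶻ (-ᶻ blk (y -ᶻ M)) ∙N
      x-pos : x ≡ M +ᶻ pos (y -ᶻ M)
      x-pos = lin (y ∷ M ∷ pos (y -ᶻ M) ∷ blk (y -ᶻ M) ∙N ∷ (-ᶻ blk (y -ᶻ M)) ∙N ∷ + 0 ∙N ∷ ((+ 0) -ᶻ blk (y -ᶻ M)) ∙N ∷ [])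
        ((α ⊟ β ≐ γ ⊞ ζ) ∷ (η ≐ ξ) ∷ (ξ ≐ θ ⊟ ζ) ∷ (θ ≐ # 0) ∷ []) (α ⊞ η ≐ β ⊞ γ)
        (pos+blk (y -ᶻ M)) (cong _∙N (sym (ℤP.+-identityˡ _))) (N-sub (+ 0) (blk (y -ᶻ M))) N-zero
      turns : blk (y -ᶻ M) ≡ + 0
      turns = lin (blk (y -ᶻ M) ∷ block w x ∷ block w y ∷ -ᶻ blk (y -ᶻ M) ∷ []) ((β ≐ # 0) ∷ (γ ≐ # 0) ∷ (β ≐ γ ⊞ ζ) ∷ (α ⊞ ζ ≐ # 0) ∷ []) (α ≐ # 0)
        (zeros x (lin (x ∷ M ∷ pos (y -ᶻ M) ∷ []) ((α ≐ β ⊞ γ) ∷ (# 1 ≼ γ) ∷ []) (β ≺ α) x-pos (1≤pos _))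
                 (lin (x ∷ Top ∷ N ∷ pos (y -ᶻ M) ∷ []) ((α ≐ β ⊟ γ ⊞ ζ) ∷ (ζ ≼ γ) ∷ []) (α ≼ β) x-pos (pos≤N _)))
        block-y (block-shift w y _) (ℤP.+-inverseʳ (blk (y -ᶻ M)))
      at-0 : act w (+ 0) ≡ M
      at-0 = lin (act w (+ 0) ∷ Top ∷ N ∷ + 1 ∙N ∷ []) ((β ≐ α ⊞ ζ) ∷ (ζ ≐ γ) ∷ []) (α ≐ β ⊟ γ)
        (trans (cong (act w) (trans (sym N-one) (sym (ℤP.+-identityˡ _)))) (act-shift w (+ 0) (+ 1))) N-one
      first : act w (+ 0) <ᶻ act w (+ 1)
      first = lin (act w (+ 0) ∷ y ∷ M ∷ pos (y -ᶻ M) ∷ blk (y -ᶻ M) ∙N ∷ []) ((α ≐ γ) ∷ (β ⊟ γ ≐ ζ ⊞ η) ∷ (# 1 ≼ ζ) ∷ (η ≐ # 0) ∷ []) (α ≺ β)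
        at-0 (pos+blk (y -ᶻ M)) (1≤pos _) (trans (cong _∙N turns) N-zero)
      ascent : ∀ i → act w (ι i) <ᶻ act w (ι i +ᶻ + 1)
      ascent Fin.zero    = first
      ascent (Fin.suc i) = right-up⁻¹ (Fin.suc i) w (Incr-rises {w} inc i)

  private
    Ds-untouched : ∀ Q v {y} → All (λ i → ¬ (y ∼ ι i) × ¬ (y ∼ ι i +ᶻ + 1)) Q → block (Ds Q v) y ≡ block v y
    Ds-untouched []      v []              = refl
    Ds-untouched (i ∷ Q) v {y} ((n₁ , n₂) ∷ ns) = trans (decide (Up? (ι i) (Ds Q v))) (Ds-untouched Q v ns)
      where
      decide : Dec (Up (ι i) (Ds Q v)) → block (D i (Ds Q v)) y ≡ block (Ds Q v) y
      decide (yes u) = trans (cong (λ w → block w y) (D-yes {i} {Ds Q v} u)) (trans (block-∷ i (Ds Q v) y) (cong (block (Ds Q v)) (s-stay (ι i) y n₁ n₂)))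
      decide (no n)  = cong (λ w → block w y) (D-no {i} {Ds Q v} n)

    -- Each letter adds at most one to the length, so a word whose length is fully realised has no
    -- idle letter.
    effective : ∀ P i Q v → ℓ (Ds (P ++ i ∷ Q) v) ≡ length (P ++ i ∷ Q) ℕ.+ ℓ v → Up (ι i) (Ds Q v)
    effective P i Q v full = decide (Up? (ι i) (Ds Q v))
      where
      decide : Dec (Up (ι i) (Ds Q v)) → Up (ι i) (Ds Q v)
      decide (yes u) = u
      decide (no n)  = ⊥-elim (ℕP.<-irrefl refl (ℕP.≤-trans
        (ℕP.≤-reflexive (trans (sym (ℕP.+-suc (length P) (length Q ℕ.+ ℓ v))) (trans (sym (ℕP.+-assoc (length P) (suc (length Q)) (ℓ v)))
          (trans (cong (ℕ._+ ℓ v) (sym (ListP.length-++ P))) (sym full)))))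
        (ℕP.≤-trans (ℕP.≤-reflexive (cong ℓ (trans (ListP.foldr-++ D v P (i ∷ Q)) (cong (Ds P) (D-no {i} {Ds Q v} n)))))
          (ℕP.≤-trans (ℓ-Ds P (Ds Q v)) (ℕP.+-monoʳ-≤ (length P) (ℓ-Ds Q v))))))

  module Triangularity (w : Word k) (inc : Incr w) where
    open Descent w inc

    private
      -- The letter of x is the one exchanging the class of x with that of x + 1, whose block in μ is
      -- the block of x in w.
      raised : ∀ {x v} → M <ᶻ x → x ≤ᶻ Top → block w x ≡ + 0 → block v (x +ᶻ + 1) ≡ block μ (x +ᶻ + 1) → Up (ι (fin x)) v → Large Top (fin x ∷ v)
      raised {x} {v} lo hi zero-x same u = decide (ℤP.<-cmp x Top)
        where
        below : block (fin x ∷ v) (x +ᶻ + 1) <ᶻ block μ (x +ᶻ + 1)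
        below = subst₂ _<ᶻ_ (sym (trans (block-fin x v _) (cong (block v) (s-next x)))) same (Up-class v (ι-fin x) u)
        decide : _ → Large Top (fin x ∷ v)
        decide (tri> _ _ g) = ⊥-elim (ℤP.<⇒≱ g hi)
        decide (tri≈ _ refl _) = x +ᶻ + 1 , y<y+1 x , lin (block (fin x ∷ v) (x +ᶻ + 1) ∷ block μ (x +ᶻ + 1) ∷ []) ((α ≺ β) ∷ (β ≐ # 1) ∷ []) (α ≼ # 0) below block-μ-Top
        decide (tri< l _ _) = x +ᶻ + 1 +ᶻ + 1 ∙N
          , lin (x ∷ Top ∷ N ∷ + 1 ∙N ∷ []) ((β ⊟ γ ≺ α) ∷ (ζ ≐ γ) ∷ []) (β ≺ α ⊞ # 1 ⊞ ζ) lo N-one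
          , lin (block (fin x ∷ v) (x +ᶻ + 1 +ᶻ + 1 ∙N) ∷ block (fin x ∷ v) (x +ᶻ + 1) ∷ block μ (x +ᶻ + 1) ∷ block w x ∷ [])
              ((α ≐ β ⊞ # 1) ∷ (β ≺ γ) ∷ (γ ≐ ζ) ∷ (ζ ≐ # 0) ∷ []) (α ≼ # 0) (block-shift (fin x ∷ v) _ (+ 1)) below (block-μ x lo l) zero-x

    -- Some x of the window belongs to `A` but not to `B`, so its block in `w` is 0. Full length
    -- forces the letter of x to act; the letters to its right leave the class of x + 1 alone, so
    -- the block of x + 1 drops strictly below its value in `μ`. By `raised` this makes the result
    -- `Large Top`, which the remaining letters preserve.
    larger-top : ∀ A → card A ≡ c → A ≢ B → ℓ (Ds (dA A) μ) ≡ c ℕ.+ ℓ μ → Top <ᶻ top (Ds (dA A) μ)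
    larger-top A |A|≡c A≢B full = find-x (equal-or-extra A B (ℕP.≤-reflexive (sym |A|≡c)))
      where
      m = ι (missing A)
      |A|<n : card A < suc k
      |A|<n = s≤s (subst (_≤ k) (sym |A|≡c) c≤k)
      m∉A : Vec.lookup A (fin m) ≡ false
      m∉A = trans (cong (Vec.lookup A) (fin-ι (missing A))) (missing∉ A |A|<n)
      at-x : ∀ x → M <ᶻ x → x ≤ᶻ Top → Vec.lookup A (fin x) ≡ true → Vec.lookup B (fin x) ≡ false → Top <ᶻ top (Ds (dA A) μ)
      at-x x lo hi x∈A x∉B = Large⇒top {Top} {Ds (dA A) μ} (Ds-Incr (dA A) {μ} incr-μ)
          (subst (Large Top) (sym (trans (cong (λ a → Ds a μ) split) (trans (ListP.foldr-++ D μ P (fin x ∷ Q)) (cong (Ds P) (D-yes {fin x} {Ds Q μ} up-x)))))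
            (Large-Ds {Top} {fin x ∷ Ds Q μ} P (raised {x} {Ds Q μ} lo hi block-x untouched up-x)))
        where
        block-x : block w x ≡ + 0
        block-x = decide (⌊positive⌋ x lo)
          where
          decide : _ → block w x ≡ + 0
          decide (inj₂ (_ , z)) = z
          decide (inj₁ (t , _)) = contradiction (trans (sym t) (trans (sym (lookup-B x lo hi)) x∉B)) (λ ())
        -- The number of classes listed before that of x in m - 1, m - 2, .... The value k would
        -- belong to the class of m, which is not in `A`.
        e = rem (m -ᶻ + 1 -ᶻ x)
        x′ = m -ᶻ + e -ᶻ + 1
        x′∼x : x′ ∼ x
        x′∼x = quo (m -ᶻ + 1 -ᶻ x) , lin (m ∷ x ∷ + e ∷ quo (m -ᶻ + 1 -ᶻ x) ∙N ∷ []) ((α ⊟ # 1 ⊟ β ≐ γ ⊞ ζ) ∷ []) (α ⊟ γ ⊟ # 1 ≐ β ⊞ ζ) (rem-quo (m -ᶻ + 1 -ᶻ x))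
        e<k : e < k
        e<k = ℕP.≤∧≢⇒< (ℕP.≤-pred (rem<n (m -ᶻ + 1 -ᶻ x))) λ e≡k → contradiction (trans (sym x∈A) (trans (cong (Vec.lookup A) (fin-cong {x} {m}
            (∼-trans (∼-sym x′∼x) (-ᶻ (+ 1) , lin (m ∷ + e ∷ + k ∷ (-ᶻ (+ 1)) ∙N ∷ + 0 ∙N ∷ + 1 ∙N ∷ []) ((β ≐ γ) ∷ (ζ ≐ η ⊟ θ) ∷ (η ≐ # 0) ∷ (θ ≐ # 1 ⊞ γ) ∷ []) (α ⊟ β ⊟ # 1 ≐ α ⊞ ζ)
              (cong +_ e≡k) (N-sub (+ 0) (+ 1)) N-zero N-one)))) m∉A)) (λ ())
        d = k ∸ suc e
        k≡ : k ≡ e ℕ.+ suc d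
        k≡ = trans (sym (ℕP.m+[n∸m]≡n e<k)) (sym (ℕP.+-suc e d))
        P = List.filterᵇ (Vec.lookup A) (descending m e)
        Q = List.filterᵇ (Vec.lookup A) (descending x′ d)
        keep : List.filterᵇ (Vec.lookup A) (fin x ∷ descending x′ d) ≡ fin x ∷ Q
        keep rewrite x∈A = refl
        split : dA A ≡ P ++ fin x ∷ Q
        split = begin
          dA A                                                                      ≡⟨ dword≡ A ⟩
          List.filterᵇ (Vec.lookup A) (descending m k)                              ≡⟨ cong (λ t → List.filterᵇ (Vec.lookup A) (descending m t)) k≡ ⟩
          List.filterᵇ (Vec.lookup A) (descending m (e ℕ.+ suc d))                  ≡⟨ cong (List.filterᵇ (Vec.lookup A)) (descending-++ m e (suc d)) ⟩
          List.filterᵇ (Vec.lookup A) (descending m e ++ fin x′ ∷ descending x′ d)  ≡⟨ filterᵇ-++ (Vec.lookup A) (descending m e) _ ⟩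
          P ++ List.filterᵇ (Vec.lookup A) (fin x′ ∷ descending x′ d)               ≡⟨ cong (λ i → P ++ List.filterᵇ (Vec.lookup A) (i ∷ descending x′ d)) (fin-cong x′∼x) ⟩
          P ++ List.filterᵇ (Vec.lookup A) (fin x ∷ descending x′ d)                ≡⟨ cong (P ++_) keep ⟩
          P ++ fin x ∷ Q                                                            ∎
          where open ≡-Reasoning
        up-x : Up (ι (fin x)) (Ds Q μ)
        up-x = effective P (fin x) Q μ (trans (cong (λ a → ℓ (Ds a μ)) (sym split)) (trans full (cong (ℕ._+ ℓ μ) (trans (sym |A|≡c) (trans (sym (length-dA A |A|<n)) (cong length split))))))
        d<k : + d <ᶻ + k
        d<k = lin (+ d ∷ + e ∷ + k ∷ []) ((γ ≐ β ⊞ (# 1 ⊞ α)) ∷ (# 0 ≼ β) ∷ []) (α ≺ γ) (cong +_ k≡) (0≤+ e)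
        untouched′ : block (Ds Q μ) (x′ +ᶻ + 1) ≡ block μ (x′ +ᶻ + 1)
        untouched′ = Ds-untouched Q μ (filterᵇ-All (Vec.lookup A) (descending-All x′ d (λ z z₁ z₂ →
            (λ c → between {x′ +ᶻ + 1} {z} (lin (x′ ∷ z ∷ []) ((β ≺ α) ∷ []) (β ≺ α ⊞ # 1) z₂)
                     (lin (x′ ∷ z ∷ + d ∷ + k ∷ []) ((α ⊟ γ ≼ β) ∷ (γ ≺ ζ) ∷ []) (α ⊞ # 1 ≺ β ⊞ (# 1 ⊞ ζ)) z₁ d<k) (∼-trans c (ι-fin z)))
          , (λ c → between {x′ +ᶻ + 1} {z +ᶻ + 1} (lin (x′ ∷ z ∷ []) ((β ≺ α) ∷ []) (β ⊞ # 1 ≺ α ⊞ # 1) z₂)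
                     (lin (x′ ∷ z ∷ + d ∷ + k ∷ []) ((α ⊟ γ ≼ β) ∷ (γ ≺ ζ) ∷ []) (α ⊞ # 1 ≺ β ⊞ # 1 ⊞ (# 1 ⊞ ζ)) z₁ d<k) (∼-trans c (∼-+ (+ 1) (ι-fin z)))))))
        untouched : block (Ds Q μ) (x +ᶻ + 1) ≡ block μ (x +ᶻ + 1)
        untouched = transfer (∼-+ (+ 1) x′∼x)
          where
          transfer : x′ +ᶻ + 1 ∼ x +ᶻ + 1 → block (Ds Q μ) (x +ᶻ + 1) ≡ block μ (x +ᶻ + 1)
          transfer (l , q) = lin (block (Ds Q μ) (x +ᶻ + 1) ∷ block μ (x +ᶻ + 1) ∷ l ∷ block (Ds Q μ) (x′ +ᶻ + 1) ∷ block μ (x′ +ᶻ + 1) ∷ [])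
            ((ζ ≐ α ⊞ γ) ∷ (η ≐ β ⊞ γ) ∷ (ζ ≐ η) ∷ []) (α ≐ β)
            (trans (cong (block (Ds Q μ)) q) (block-shift (Ds Q μ) _ l)) (trans (cong (block μ) q) (block-shift μ _ l)) untouched′
      find-x : _ → Top <ᶻ top (Ds (dA A) μ)
      find-x (inj₁ A≡B) = contradiction A≡B A≢B
      find-x (inj₂ (j , j∈A , j∉B)) = located (window-class j)
        where
        located : ∃[ x ] M <ᶻ x × x ≤ᶻ Top × fin x ≡ j → Top <ᶻ top (Ds (dA A) μ)
        located (x , lo , hi , e) = at-x x lo hi (trans (cong (Vec.lookup A) e) j∈A) (trans (cong (Vec.lookup B) e) j∉B)

  i≤∣i∣ : ∀ i → i ≤ᶻ + ℤ.∣ i ∣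
  i≤∣i∣ (+ n)      = ℤP.≤-refl
  i≤∣i∣ (-[1+ n ]) = ℤ.-≤+

  -- A family satisfying the Pieri rule for the ideal sums is determined by its value at the identity:
  -- induction on the length, and for fixed length downwards on the largest window entry.
  module Uniqueness
    (X : (Mono k → ℤ) → Word k → ℤ)
    (X-Resp : ∀ φ → Resp (X φ))
    (X-[] : ∀ φ → X φ [] ≡ + 0)
    (X-pieri : ∀ r → 1 ≤ r → r ≤ k → ∀ φ u → X (translate r φ) u ≡ sum (λ A → ∇ (dA A) (X φ) u) (subsets r))
    where

    private
      Shorter : ℕ → Set
      Shorter L = ∀ φ u → ℓ (δ u) < L → X φ u ≡ + 0

      -- `d` bounds the distance of `top` from its maximum `N + L` given by `top≤`; every competing
      -- term of full length has a larger `top`, so `d` decreases.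
      same-length : ∀ L → Shorter L → ∀ d φ u → ℓ (δ u) ≡ L → N +ᶻ + L <ᶻ top (δ u) +ᶻ + d → X φ u ≡ + 0
      same-length L shorter zero    φ u size lt = ⊥-elim (lin (top (δ u) ∷ N ∷ + L ∷ + ℓ (δ u) ∷ []) ((β ⊞ γ ≺ α ⊞ # 0) ∷ (α ≼ β ⊞ ζ) ∷ (ζ ≐ γ) ∷ []) ff lt (top≤ (δ u)) (cong +_ size))
      same-length L shorter (suc d) φ u size lt = decide (c ℕ.≟ 0)
        where
        open Descent (δ u) (δ-Incr u)
        open Triangularity (δ u) (δ-Incr u)
        extend : ∃[ u′ ] δ u′ ≈W μ → 1 ≤ c → X φ u ≡ + 0
        -- In the Pieri sum at `u′` the term of `B` is `X φ u` and the others vanish; the sum itself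
        -- is the value of `X` at the shorter `u′` for the translated functional. This is why
        -- `Shorter` ranges over all functionals.
        extend (u′ , e) 1≤c = trans (sym value-B) (trans (sym (sum-single (suc k) F B others)) (trans (sym (sum-filter _ (λ A → card A ≡ᵇ c) (allVecs (suc k))))
            (trans (sym (X-pieri c 1≤c c≤k φ u′)) (shorter (translate c φ) u′ (subst (ℓ (δ u′) <_) size-u (ℕP.m<n+m (ℓ (δ u′)) 1≤c))))))
          where
          size-u : c ℕ.+ ℓ (δ u′) ≡ L
          size-u = trans (cong₂ ℕ._+_ (sym length-letters) (ℓ-cong {δ u′} {μ} e)) (trans (sym size-μ) size)
          F : Subset k → ℤ
          F A = if card A ≡ᵇ c then ∇ (dA A) (X φ) u′ else + 0
          short-prefix : ∀ a → length a ≡ c → ∀ b → length b < length a → X φ (b ++ u′) ≡ + 0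
          short-prefix a la b lt = shorter φ (b ++ u′) (ℕP.≤-<-trans (ℕP.≤-trans (ℕP.≤-reflexive (cong ℓ (δ-++ b u′))) (ℓ-Ds b (δ u′)))
            (subst (length b ℕ.+ ℓ (δ u′) <_) size-u (ℕP.+-monoˡ-< (ℓ (δ u′)) (subst (length b <_) la lt))))
          F-value : ∀ A → card A ≡ c → F A ≡ ∇ (dA A) (X φ) u′
          F-value A |A| = cong (λ b → if b then ∇ (dA A) (X φ) u′ else + 0) (≡ᵇ-true |A|)
          value-B : F B ≡ X φ u
          value-B = begin
            F B                                                   ≡⟨ F-value B refl ⟩
            ∇ (dA B) (X φ) u′                                     ≡⟨ cong (λ a → ∇ a (X φ) u′) (dword≡ B) ⟩
            ∇ (descendingWord (ι (missing B)) B) (X φ) u′         ≡⟨ ∇-start (ι (missing B)) Top B (trans (cong (Vec.lookup B) (fin-ι (missing B))) (missing∉ B (s≤s c≤k))) Top∉B {X φ} (λ {u} {v} → X-Resp φ {u} {v}) u′ ⟩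
            ∇ (letters k) (X φ) u′                                ≡⟨ ∇-leading (letters k) (X φ) u′ (short-prefix (letters k) length-letters) ⟩
            X φ (letters k ++ u′)                                 ≡⟨ X-Resp φ {letters k ++ u′} {u} (λ x → trans (cong (λ v → act v x) (δ-++ (letters k) u′)) (trans (Ds-cong (letters k) {δ u′} {μ} e x) (d-μ x))) ⟩
            X φ u                                                 ∎
            where open ≡-Reasoning
          others : ∀ A → A ≢ B → F A ≡ + 0
          others A A≢B = sized (card A ℕ.≟ c)
            where
            sized : Dec (card A ≡ c) → F A ≡ + 0
            sized (no n)    = cong (λ b → if b then ∇ (dA A) (X φ) u′ else + 0) (≡ᵇ-false n)
            sized (yes |A|) = trans (F-value A |A|) (trans (∇-leading (dA A) (X φ) u′ (short-prefix (dA A) len-A)) (vanish (ℕP.m≤n⇒m<n∨m≡n bound)))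
              where
              len-A : length (dA A) ≡ c
              len-A = trans (length-dA A (s≤s (subst (_≤ k) (sym |A|) c≤k))) |A|
              v = dA A ++ u′
              v≈ : δ v ≈W Ds (dA A) μ
              v≈ x = trans (cong (λ v → act v x) (δ-++ (dA A) u′)) (Ds-cong (dA A) {δ u′} {μ} e x)
              bound : ℓ (δ v) ≤ L
              bound = ℕP.≤-trans (ℕP.≤-reflexive (cong ℓ (δ-++ (dA A) u′))) (ℕP.≤-trans (ℓ-Ds (dA A) (δ u′)) (ℕP.≤-reflexive (trans (cong (ℕ._+ ℓ (δ u′)) len-A) size-u)))
              vanish : ℓ (δ v) < L ⊎ ℓ (δ v) ≡ L → X φ v ≡ + 0
              vanish (inj₁ lt′)  = shorter φ v lt′
              vanish (inj₂ full) = same-length L shorter d φ v full (lin (Top ∷ top (δ v) ∷ N ∷ + L ∷ + d ∷ top (Ds (dA A) μ) ∷ [])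
                ((γ ⊞ ζ ≺ α ⊞ (# 1 ⊞ η)) ∷ (α ≺ θ) ∷ (β ≐ θ) ∷ []) (γ ⊞ ζ ≺ β ⊞ η) lt
                (larger-top A |A| A≢B (trans (sym (ℓ-cong {δ v} {Ds (dA A) μ} v≈)) (trans full (trans (sym size-u) (cong (c ℕ.+_) (ℓ-cong {δ u′} {μ} e))))))
                (v≈ N))
        decide : Dec (c ≡ 0) → X φ u ≡ + 0
        decide (yes z) = trans (X-Resp φ {u} {[]} (c≡0⇒[] z)) (X-[] φ)
        decide (no nz) = extend (δ-surjective {μ} incr-μ) (ℕP.n≢0⇒n>0 nz)

      all : ∀ L → Shorter L
      all zero    φ u ()
      all (suc L) φ u lt = split (ℕP.m≤n⇒m<n∨m≡n (ℕP.≤-pred lt))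
        where
        gap = N +ᶻ + L -ᶻ top (δ u)
        split : ℓ (δ u) < L ⊎ ℓ (δ u) ≡ L → X φ u ≡ + 0
        split (inj₁ lt′) = all L φ u lt′
        split (inj₂ e)   = same-length L (all L) (suc ℤ.∣ gap ∣) φ u e
          (lin (N ∷ + L ∷ top (δ u) ∷ + ℤ.∣ gap ∣ ∷ []) ((α ⊞ β ⊟ γ ≼ ζ) ∷ []) (α ⊞ β ≺ γ ⊞ (# 1 ⊞ ζ)) (i≤∣i∣ gap))

    unique : ∀ φ u → X φ u ≡ + 0
    unique φ u = all (suc (ℓ (δ u))) φ u ℕP.≤-refl

  -- Partitions

  pos-unique : ∀ {p} a l → + 1 ≤ᶻ a → a ≤ᶻ N → p ≡ a +ᶻ l ∙N → pos p ≡ a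
  pos-unique {p} a l a₁ a₂ e = lin (p ∷ pos p ∷ blk p ∙N ∷ a ∷ l ∙N ∷ []) ((α ≐ β ⊞ γ) ∷ (α ≐ ζ ⊞ η) ∷ (γ ≐ η) ∷ []) (β ≐ ζ)
    (pos+blk p) e (cong _∙N (blk-unique {p} a l a₁ a₂ e))

  pos-window : ∀ {a} → + 1 ≤ᶻ a → a ≤ᶻ N → pos a ≡ a
  pos-window {a} a₁ a₂ = pos-unique a (+ 0) a₁ a₂ (lin (a ∷ + 0 ∙N ∷ []) ((β ≐ # 0) ∷ []) (α ≐ α ⊞ β) N-zero)

  pos-+1 : ∀ {p} → pos p <ᶻ N → pos (p +ᶻ + 1) ≡ pos p +ᶻ + 1
  pos-+1 {p} lt = pos-unique (pos p +ᶻ + 1) (blk p) (lin (pos p ∷ []) ((# 1 ≼ α) ∷ []) (# 1 ≼ α ⊞ # 1) (1≤pos p))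
    (lin (pos p ∷ N ∷ []) ((α ≺ β) ∷ []) (α ⊞ # 1 ≼ β) lt)
    (lin (p ∷ pos p ∷ blk p ∙N ∷ []) ((α ≐ β ⊞ γ) ∷ []) (α ⊞ # 1 ≐ β ⊞ # 1 ⊞ γ) (pos+blk p))

  pos-wrap : ∀ {p} j → j < suc k → pos p ≡ N → pos (p +ᶻ + suc j) ≡ + suc j
  pos-wrap {p} j (s≤s j≤k) e = pos-unique (+ suc j) (blk p +ᶻ + 1) (+≤+ (s≤s z≤n)) (+≤+ (s≤s j≤k))
    (lin (p ∷ pos p ∷ blk p ∙N ∷ N ∷ (blk p +ᶻ + 1) ∙N ∷ + suc j ∷ []) ((α ≐ β ⊞ γ) ∷ (β ≐ ζ) ∷ (η ≐ γ ⊞ ζ) ∷ []) (α ⊞ θ ≐ θ ⊞ η)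
      (pos+blk p) e (N-suc (blk p)))

  ∼pos : ∀ p → p ∼ pos p
  ∼pos p = blk p , pos+blk p

  pos-zero : pos (+ 0) ≡ N
  pos-zero = pos-unique N (-ᶻ (+ 1)) (ℤP.<⇒≤ 1<N) ℤP.≤-refl
    (lin (N ∷ (-ᶻ (+ 1)) ∙N ∷ + 0 ∙N ∷ + 1 ∙N ∷ []) ((β ≐ γ ⊟ ζ) ∷ (γ ≐ # 0) ∷ (ζ ≐ α) ∷ []) (# 0 ≐ α ⊞ β) (N-sub (+ 0) (+ 1)) N-zero N-one)

  -- Up to a shift, the action of a row of length c: the positions 1, …, c modulo n are fixed and each
  -- of the others moves to the next one.
  κ : ℕ → ℤ → ℤ
  κ c p with pos p ℤP.≤? + c | pos p ℤP.<? N
  ... | yes _ | _     = p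
  ... | no _  | yes _ = p +ᶻ + 1
  ... | no _  | no _  = p +ᶻ + suc c

  data κ-Cases (c : ℕ) (p : ℤ) : Set where
    fixed  : pos p ≤ᶻ + c → κ c p ≡ p → κ-Cases c p
    middle : + c <ᶻ pos p → pos p <ᶻ N → κ c p ≡ p +ᶻ + 1 → κ-Cases c p
    last   : + c <ᶻ pos p → pos p ≡ N → κ c p ≡ p +ᶻ + suc c → κ-Cases c p

  κ-cases : ∀ c p → κ-Cases c p
  κ-cases c p = decide (pos p ℤP.≤? + c) (pos p ℤP.<? N)
    where
    decide : Dec (pos p ≤ᶻ + c) → Dec (pos p <ᶻ N) → κ-Cases c p
    decide (yes a) _ = fixed a value₁
      where
      value₁ : κ c p ≡ p
      value₁ with pos p ℤP.≤? + c | pos p ℤP.<? N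
      ... | yes _ | _ = refl
      ... | no n  | _ = contradiction a n
    decide (no n) (yes b) = middle (ℤP.≰⇒> n) b value₂
      where
      value₂ : κ c p ≡ p +ᶻ + 1
      value₂ with pos p ℤP.≤? + c | pos p ℤP.<? N
      ... | yes a | _     = contradiction a n
      ... | no _  | yes _ = refl
      ... | no _  | no m  = contradiction b m
    decide (no n) (no m) = last (ℤP.≰⇒> n) (ℤP.≤-antisym (pos≤N p) (ℤP.≮⇒≥ m)) value₃
      where
      value₃ : κ c p ≡ p +ᶻ + suc c
      value₃ with pos p ℤP.≤? + c | pos p ℤP.<? N
      ... | yes a | _     = contradiction a n
      ... | no _  | yes b = contradiction b m
      ... | no _  | no _  = refl

  κ-fixed : ∀ {c p} → pos p ≤ᶻ + c → κ c p ≡ p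
  κ-fixed {c} {p} a with κ-cases c p
  ... | fixed _ e    = e
  ... | middle b _ _ = contradiction a (ℤP.<⇒≱ b)
  ... | last b _ _   = contradiction a (ℤP.<⇒≱ b)

  κ-middle : ∀ {c p} → + c <ᶻ pos p → pos p <ᶻ N → κ c p ≡ p +ᶻ + 1
  κ-middle {c} {p} a b with κ-cases c p
  ... | fixed d _    = contradiction d (ℤP.<⇒≱ a)
  ... | middle _ _ e = e
  ... | last _ d _   = contradiction b (ℤP.<-irrefl d)

  κ-last : ∀ {c p} → c ≤ k → pos p ≡ N → κ c p ≡ p +ᶻ + suc c
  κ-last {c} {p} c≤k b with κ-cases c p
  ... | fixed d _    = contradiction (subst (_≤ᶻ + c) b d) (ℤP.<⇒≱ (ℤ.+<+ (s≤s c≤k)))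
  ... | middle _ d _ = contradiction d (ℤP.<-irrefl b)
  ... | last _ _ e   = e

  κ-shift : ∀ {c} → c ≤ k → ∀ p l → κ c (p +ᶻ l ∙N) ≡ κ c p +ᶻ l ∙N
  κ-shift {c} c≤k p l with κ-cases c p
  ... | fixed a e    = trans (κ-fixed (subst (_≤ᶻ + c) (sym (pos-shift p l)) a)) (cong (_+ᶻ l ∙N) (sym e))
  ... | middle a b e = trans (κ-middle (subst (+ c <ᶻ_) (sym (pos-shift p l)) a) (subst (_<ᶻ N) (sym (pos-shift p l)) b))
          (lin (p ∷ l ∙N ∷ κ c p ∷ []) ((γ ≐ α ⊞ # 1) ∷ []) (α ⊞ β ⊞ # 1 ≐ γ ⊞ β) e)
  ... | last a b e   = trans (κ-last c≤k (trans (pos-shift p l) b))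
          (lin (p ∷ l ∙N ∷ κ c p ∷ + suc c ∷ []) ((γ ≐ α ⊞ ζ) ∷ []) (α ⊞ β ⊞ ζ ≐ γ ⊞ β) e)

  private
    κ-zero : ∀ p → κ 0 p ≡ p +ᶻ + 1
    κ-zero p with κ-cases 0 p
    ... | fixed a _    = contradiction a (ℤP.<⇒≱ (ℤP.<-≤-trans (ℤ.+<+ (s≤s z≤n)) (1≤pos p)))
    ... | middle _ _ e = e
    ... | last _ _ e   = e

    separate : ∀ {p a} → + 1 ≤ᶻ a → a ≤ᶻ N → pos p ≢ a → ¬ (p ∼ a)
    separate {p} {a} a₁ a₂ ne (l , e) = ne (pos-unique a l a₁ a₂ e)

    -- `κ c` sends position c + 1 to c + 2 and a multiple of n to the class of c + 1. The letter
    -- s_{c+1} returns the former to its place and pushes the latter on to c + 2.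
    κ-suc : ∀ c → suc c ≤ k → ∀ p → s (+ suc c) (κ c p) ≡ κ (suc c) p
    κ-suc c sc≤k p with κ-cases c p
    ... | fixed a e = trans (cong (s (+ suc c)) e) (trans (s-stay _ _
          (separate {p} (+≤+ (s≤s z≤n)) (+≤+ (ℕP.m≤n⇒m≤1+n sc≤k)) (λ q → ℤP.<⇒≱ (ℤ.+<+ (ℕP.n<1+n c)) (subst (_≤ᶻ + c) q a)))
          (separate {p} (+≤+ (s≤s z≤n)) (+≤+ (subst (_≤ suc k) (ℕP.+-comm 1 (suc c)) (s≤s sc≤k)))
            (λ q → lin (pos p ∷ + c ∷ []) ((α ≐ # 1 ⊞ β ⊞ # 1) ∷ (α ≼ β) ∷ []) ff q a)))
        (sym (κ-fixed (ℤP.≤-trans a (+≤+ (ℕP.n≤1+n c))))))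
    ... | last a b e = trans (cong (s (+ suc c)) e) (trans (s-up _ _ (subst (p +ᶻ + suc c ∼_) (pos-wrap {p} c (ℕP.m≤n⇒m≤1+n sc≤k) b) (∼pos (p +ᶻ + suc c))))
        (trans (lin (p ∷ + c ∷ []) [] (α ⊞ (# 1 ⊞ β) ⊞ # 1 ≐ α ⊞ (# 2 ⊞ β))) (sym (κ-last sc≤k b))))
    ... | middle a b e with ℤP.<-cmp (pos p) (+ suc c)
    ...   | tri< l _ _ = ⊥-elim (lin (pos p ∷ + c ∷ []) ((β ≺ α) ∷ (α ≺ # 1 ⊞ β) ∷ []) ff a l)
    ...   | tri≈ _ q _ = trans (cong (s (+ suc c)) e) (trans (s-down _ _ (∼-+ (+ 1) (subst (p ∼_) q (∼pos p))))
            (trans (lin (p ∷ []) [] (α ⊞ # 1 ⊟ # 1 ≐ α)) (sym (κ-fixed (ℤP.≤-reflexive q)))))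
    ...   | tri> _ _ g = trans (cong (s (+ suc c)) e) (trans (s-stay _ _
            (separate {p +ᶻ + 1} (+≤+ (s≤s z≤n)) (+≤+ (ℕP.m≤n⇒m≤1+n sc≤k))
              (λ q → lin (pos p ∷ pos (p +ᶻ + 1) ∷ + c ∷ []) ((β ≐ α ⊞ # 1) ∷ (β ≐ # 1 ⊞ γ) ∷ (# 1 ⊞ γ ≺ α) ∷ []) ff (pos-+1 {p} b) q g))
            (λ d → separate {p} (+≤+ (s≤s z≤n)) (+≤+ (ℕP.m≤n⇒m≤1+n sc≤k)) (λ q → ℤP.<-irrefl (sym q) g) (∼-+-cancel (+ 1) d)))
          (sym (κ-middle g b)))

  -- Moving down a row lowers the residues by one, that is, conjugates by a translation. The shifts
  -- by `i` and `suc i` are such that consecutive rows telescope: the rows together act as the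
  -- composite `K` followed by a shift by the number of rows.
  act-row : ∀ i c → c ≤ k → ∀ x → act (rowWord k (suc i) c) x ≡ κ c (x +ᶻ + i) -ᶻ + suc i
  act-row i zero    _    x = lin (x ∷ + i ∷ κ 0 (x +ᶻ + i) ∷ []) ((γ ≐ α ⊞ β ⊞ # 1) ∷ []) (α ≐ γ ⊟ (# 1 ⊞ β)) (κ-zero (x +ᶻ + i))
  act-row i (suc c) sc≤k x = begin
    act (rowWord k (suc i) (suc c)) x                         ≡⟨ act-fin (+ suc c -ᶻ + suc i) (rowWord k (suc i) c) x ⟩
    s (+ suc c -ᶻ + suc i) (act (rowWord k (suc i) c) x)      ≡⟨ cong (s (+ suc c -ᶻ + suc i)) (act-row i c (ℕP.<⇒≤ sc≤k) x) ⟩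
    s (+ suc c -ᶻ + suc i) (κ c (x +ᶻ + i) -ᶻ + suc i)        ≡⟨ s-translate (+ suc c) (-ᶻ (+ suc i)) (κ c (x +ᶻ + i)) ⟩
    s (+ suc c) (κ c (x +ᶻ + i)) -ᶻ + suc i                   ≡⟨ cong (_-ᶻ + suc i) (κ-suc c sc≤k (x +ᶻ + i)) ⟩
    κ (suc c) (x +ᶻ + i) -ᶻ + suc i                           ∎
    where open ≡-Reasoning

  K : List ℕ → ℤ → ℤ
  K []       p = p
  K (c ∷ cs) p = K cs (κ c p)

  private
    act-wordFrom : ∀ i {cs} → All (_≤ k) cs → ∀ x → act (wordFrom k (suc i) cs) x ≡ K cs (x +ᶻ + i) -ᶻ (+ i +ᶻ + length cs)
    act-wordFrom i {[]}     []       x = lin (x ∷ + i ∷ []) [] (α ≐ α ⊞ β ⊟ (β ⊞ # 0))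
    act-wordFrom i {c ∷ cs} (b ∷ bs) x = begin
      act (wordFrom k (suc (suc i)) cs ++ rowWord k (suc i) c) x     ≡⟨ act-++ (wordFrom k (suc (suc i)) cs) (rowWord k (suc i) c) x ⟩
      act (wordFrom k (suc (suc i)) cs) (act (rowWord k (suc i) c) x) ≡⟨ cong (act (wordFrom k (suc (suc i)) cs)) (act-row i c b x) ⟩
      act (wordFrom k (suc (suc i)) cs) (κ c (x +ᶻ + i) -ᶻ + suc i)  ≡⟨ act-wordFrom (suc i) bs _ ⟩
      K cs (κ c (x +ᶻ + i) -ᶻ + suc i +ᶻ + suc i) -ᶻ (+ suc i +ᶻ + length cs) ≡⟨ cong₂ _-ᶻ_
          (cong (K cs) (lin (κ c (x +ᶻ + i) ∷ + suc i ∷ []) [] (α ⊟ β ⊞ β ≐ α)))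
          (lin (+ i ∷ + length cs ∷ []) [] (# 1 ⊞ α ⊞ β ≐ α ⊞ (# 1 ⊞ β))) ⟩
      K cs (κ c (x +ᶻ + i)) -ᶻ (+ i +ᶻ + suc (length cs))            ∎
      where open ≡-Reasoning

  act-wλ : ∀ {cs} → All (_≤ k) cs → ∀ x → act (wλ k cs) x ≡ K cs x -ᶻ + length cs
  act-wλ {cs} bs x = trans (act-wordFrom 0 bs x) (cong₂ _-ᶻ_ (cong (K cs) (ℤP.+-identityʳ x)) (ℤP.+-identityˡ (+ length cs)))

  K-shift : ∀ {cs} → All (_≤ k) cs → ∀ p l → K cs (p +ᶻ l ∙N) ≡ K cs p +ᶻ l ∙N
  K-shift []                     p l = refl
  K-shift {c ∷ cs} (b ∷ bs) p l = trans (cong (K cs) (κ-shift b p l)) (K-shift bs (κ c p) l)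

  firstPart : List ℕ → ℕ
  firstPart []      = 0
  firstPart (c ∷ _) = c

  bounds : ∀ {cs} → IsPk k cs → All (_≤ k) cs
  bounds (_ , b) = All.map proj₂ b

  IsPk-tail : ∀ {c cs} → IsPk k (c ∷ cs) → IsPk k cs
  IsPk-tail (l , _ ∷ b) = Linked.tail l , b

  first≤ : ∀ {c cs} → IsPk k (c ∷ cs) → firstPart cs ≤ c
  first≤ {c} {[]}     _           = z≤n
  first≤ {c} {d ∷ cs} (l ∷ _ , _) = l

  K-zero-N : ∀ {cs} → All (_≤ k) cs → K cs N ≡ K cs (+ 0) +ᶻ N
  K-zero-N {cs} bs = trans (cong (K cs) (trans (sym N-one) (sym (ℤP.+-identityˡ (+ 1 ∙N))))) (trans (K-shift bs (+ 0) (+ 1)) (cong (K cs (+ 0) +ᶻ_) N-one))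

  WindowIncreasing : (ℤ → ℤ) → Set
  WindowIncreasing f = ∀ {a b} → + 1 ≤ᶻ a → a <ᶻ b → b ≤ᶻ N → f a <ᶻ f b

  weakly : ∀ {f} → WindowIncreasing f → ∀ {a b} → + 1 ≤ᶻ a → a ≤ᶻ b → b ≤ᶻ N → f a ≤ᶻ f b
  weakly {f} mono {a} {b} a₁ le b₂ with ℤP.<-cmp a b
  ... | tri< l _ _    = ℤP.<⇒≤ (mono a₁ l b₂)
  ... | tri≈ _ refl _ = ℤP.≤-refl
  ... | tri> _ _ g    = contradiction le (ℤP.<⇒≱ g)

  -- The first part of λ is the number of window entries below the entry at 0.
  K-shape : ∀ {cs} → IsPk k cs → WindowIncreasing (K cs) × K cs (+ 0) <ᶻ K cs (+ suc (firstPart cs)) × (1 ≤ firstPart cs → K cs (+ firstPart cs) <ᶻ K cs (+ 0))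
  K-shape {[]}     isP = (λ _ l _ → l) , ℤ.+<+ (s≤s z≤n) , (λ ())
  K-shape {c ∷ cs} isP@(_ , (c₁ , c≤k) ∷ _) = mono′ , above , (λ _ → below)
    where
    ih   = K-shape (IsPk-tail isP)
    mono = proj₁ ih
    bs   = bounds (IsPk-tail isP)
    first-above : K cs (+ 0) <ᶻ K cs (+ suc c)
    first-above = ℤP.<-≤-trans (proj₁ (proj₂ ih)) (weakly {K cs} mono (+≤+ (s≤s z≤n)) (+≤+ (s≤s (first≤ isP))) (+≤+ (s≤s c≤k)))
    at-0 : κ c (+ 0) ≡ + suc c
    at-0 = trans (κ-last c≤k pos-zero) refl
    at-N : K cs (κ c N) ≡ K cs (+ suc c) +ᶻ N
    at-N = trans (cong (K cs) (trans (κ-last {c} {N} c≤k (pos-window (ℤP.<⇒≤ 1<N) ℤP.≤-refl)) (lin (N ∷ + suc c ∷ + 1 ∙N ∷ []) ((γ ≐ α) ∷ []) (α ⊞ β ≐ β ⊞ γ) N-one)))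
      (trans (K-shift bs (+ suc c) (+ 1)) (cong (K cs (+ suc c) +ᶻ_) N-one))
    below : K cs (κ c (+ c)) <ᶻ K cs (κ c (+ 0))
    below = subst₂ (λ a b → K cs a <ᶻ K cs b) (sym (κ-fixed {c} {+ c} (ℤP.≤-reflexive (pos-window (+≤+ c₁) (+≤+ (ℕP.m≤n⇒m≤1+n c≤k)))))) (sym at-0)
      (mono (+≤+ c₁) (ℤ.+<+ (ℕP.n<1+n c)) (+≤+ (s≤s c≤k)))
    data Place (a : ℤ) : Set where
      low  : a ≤ᶻ + c → κ c a ≡ a → Place a
      mid  : + c <ᶻ a → a <ᶻ N → κ c a ≡ a +ᶻ + 1 → Place a
      end  : a ≡ N → Place a
    place : ∀ a → + 1 ≤ᶻ a → a ≤ᶻ N → Place a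
    place a a₁ a₂ with κ-cases c a
    ... | fixed x e    = low (subst (_≤ᶻ + c) (pos-window a₁ a₂) x) e
    ... | middle x y e = mid (subst (+ c <ᶻ_) (pos-window a₁ a₂) x) (subst (_<ᶻ N) (pos-window a₁ a₂) y) e
    ... | last _ y _   = end (trans (sym (pos-window a₁ a₂)) y)
    +1≤N : ∀ {a} → a <ᶻ N → a +ᶻ + 1 ≤ᶻ N
    +1≤N {a} l = lin (a ∷ N ∷ []) ((α ≺ β) ∷ []) (α ⊞ # 1 ≼ β) l
    into : ∀ {a b a′ b′} → κ c a ≡ a′ → κ c b ≡ b′ → K cs a′ <ᶻ K cs b′ → K cs (κ c a) <ᶻ K cs (κ c b)
    into e f = subst₂ (λ a b → K cs a <ᶻ K cs b) (sym e) (sym f)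
    mono′ : WindowIncreasing (K (c ∷ cs))
    mono′ {a} {b} a₁ l b₂ = decide (place a a₁ (ℤP.≤-trans (ℤP.<⇒≤ l) b₂)) (place b (ℤP.≤-trans a₁ (ℤP.<⇒≤ l)) b₂)
      where
      decide : Place a → Place b → K cs (κ c a) <ᶻ K cs (κ c b)
      decide (low x e)   (low y f)   = into e f (mono a₁ l b₂)
      decide (low x e)   (mid y z f) = into e f (mono a₁ (ℤP.<-trans l (y<y+1 b)) (+1≤N z))
      decide (mid x y e) (low z f)   = contradiction z (ℤP.<⇒≱ (ℤP.<-trans x l))
      decide (mid x y e) (mid z z′ f) = into e f (mono (ℤP.≤-trans a₁ (ℤP.<⇒≤ (y<y+1 a))) (ℤP.+-monoˡ-< (+ 1) l) (+1≤N z′))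
      decide (end refl)  _           = contradiction b₂ (ℤP.<⇒≱ l)
      decide (low x e)   (end refl)  = subst₂ _<ᶻ_ (cong (K cs) (sym e)) (sym at-N) (lin (K cs a ∷ K cs (+ suc c) ∷ N ∷ []) ((α ≺ β) ∷ (# 1 ≺ γ) ∷ []) (α ≺ β ⊞ γ)
        (mono a₁ (ℤP.≤-<-trans x (ℤ.+<+ (ℕP.n<1+n c))) (+≤+ (s≤s c≤k))) 1<N)
      decide (mid x y e) (end refl)  = subst₂ _<ᶻ_ (cong (K cs) (sym e)) (sym at-N) (lin (K cs (a +ᶻ + 1) ∷ K cs (+ suc c) ∷ N ∷ K cs N ∷ K cs (+ 0) ∷ [])
        ((α ≼ ζ) ∷ (ζ ≐ η ⊞ γ) ∷ (η ≺ β) ∷ []) (α ≺ β ⊞ γ)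
        (weakly {K cs} mono (ℤP.≤-trans a₁ (ℤP.<⇒≤ (y<y+1 a))) (+1≤N y) ℤP.≤-refl) (K-zero-N bs) first-above)
    above : K cs (κ c (+ 0)) <ᶻ K cs (κ c (+ suc c))
    above with place (+ suc c) (+≤+ (s≤s z≤n)) (+≤+ (s≤s c≤k))
    ... | low x _   = contradiction x (ℤP.<⇒≱ (ℤ.+<+ (ℕP.n<1+n c)))
    ... | mid _ y e = into at-0 e (mono (+≤+ (s≤s z≤n)) (y<y+1 (+ suc c)) (+1≤N y))
    ... | end e     = subst₂ _<ᶻ_ (cong (K cs) (sym at-0)) (sym (trans (cong (K cs ∘ κ c) e) at-N)) (lin (K cs (+ suc c) ∷ N ∷ []) ((# 1 ≺ β) ∷ []) (α ≺ α ⊞ β) 1<N)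

  window⇒Incr : ∀ {w} → (∀ {a b} → + 1 ≤ᶻ a → a <ᶻ b → b ≤ᶻ N → act w a <ᶻ act w b) → Incr w
  raise (window⇒Incr {w} mono) {p} {q} e p<q = lin (act w p ∷ act w q ∷ act w (pos p) ∷ act w (pos q) ∷ blk p ∙N ∷ [])
      ((α ≐ γ ⊞ η) ∷ (β ≐ ζ ⊞ η) ∷ (γ ≺ ζ) ∷ []) (α ≺ β)
      (trans (cong (act w) (pos+blk p)) (act-shift w _ _))
      (trans (cong (act w) (trans (pos+blk q) (cong (λ l → pos q +ᶻ l ∙N) (sym e)))) (act-shift w _ _))
      (mono (1≤pos p) (lin (p ∷ q ∷ pos p ∷ pos q ∷ blk p ∙N ∷ blk q ∙N ∷ []) ((α ≺ β) ∷ (α ≐ γ ⊞ η) ∷ (β ≐ ζ ⊞ θ) ∷ (η ≐ θ) ∷ []) (γ ≺ ζ)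
          p<q (pos+blk p) (pos+blk q) (cong _∙N e)) (pos≤N q))

  wλ-Incr : ∀ {cs} → IsPk k cs → Incr (wλ k cs)
  wλ-Incr {cs} isP = window⇒Incr {wλ k cs} λ a₁ l b₂ → subst₂ _<ᶻ_ (sym (act-wλ (bounds isP) _)) (sym (act-wλ (bounds isP) _))
    (ℤP.+-monoˡ-< (-ᶻ (+ length cs)) (proj₁ (K-shape isP) a₁ l b₂))

  private
    -- By `K-shape` the first part can be read off from where the entry at 0 fits into the window;
    -- equal first parts are cancelled because `κ c` is onto.
    K-injective : ∀ {cs ds} → IsPk k cs → IsPk k ds → (∀ x → K cs x -ᶻ + length cs ≡ K ds x -ᶻ + length ds) → cs ≡ ds
    K-injective {[]} {[]} _ _ _ = refl
    K-injective {[]} {d ∷ ds} _ isP@(_ , (d₁ , _) ∷ _) e = ⊥-elim (lin (K (d ∷ ds) (+ d) ∷ K (d ∷ ds) (+ 0) ∷ + length (d ∷ ds) ∷ + d ∷ [])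
      ((α ≺ β) ∷ (ζ ⊟ # 0 ≐ α ⊟ γ) ∷ (# 0 ⊟ # 0 ≐ β ⊟ γ) ∷ (# 0 ≼ ζ) ∷ []) ff (proj₂ (proj₂ (K-shape isP)) d₁) (e (+ d)) (e (+ 0)) (0≤+ d))
    K-injective {c ∷ cs} {[]} isP@(_ , (c₁ , _) ∷ _) _ e = ⊥-elim (lin (K (c ∷ cs) (+ c) ∷ K (c ∷ cs) (+ 0) ∷ + length (c ∷ cs) ∷ + c ∷ [])
      ((α ≺ β) ∷ (α ⊟ γ ≐ ζ ⊟ # 0) ∷ (β ⊟ γ ≐ # 0 ⊟ # 0) ∷ (# 0 ≼ ζ) ∷ []) ff (proj₂ (proj₂ (K-shape isP)) c₁) (e (+ c)) (e (+ 0)) (0≤+ c))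
    K-injective {c ∷ cs} {d ∷ ds} isC@(_ , (c₁ , c≤k) ∷ _) isD@(_ , (d₁ , d≤k) ∷ _) e with ℕP.<-cmp c d
    ... | tri< l _ _ = ⊥-elim (conflict isC isD l e)
      where
      conflict : ∀ {c cs d ds} → IsPk k (c ∷ cs) → IsPk k (d ∷ ds) → c < d → (∀ x → K (c ∷ cs) x -ᶻ + length (c ∷ cs) ≡ K (d ∷ ds) x -ᶻ + length (d ∷ ds)) → ⊥
      conflict {c} {cs} {d} {ds} isC isD@(_ , (d₁ , d≤k) ∷ _) c<d e = lin (f (+ 0) ∷ f (+ suc c) ∷ g (+ 0) ∷ g (+ suc c) ∷ g (+ d) ∷ + length (c ∷ cs) ∷ + length (d ∷ ds) ∷ [])
        ((α ≺ β) ∷ (η ≺ γ) ∷ (ζ ≼ η) ∷ (α ⊟ θ ≐ γ ⊟ ξ) ∷ (β ⊟ θ ≐ ζ ⊟ ξ) ∷ []) ff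
        (proj₁ (proj₂ (K-shape isC))) (proj₂ (proj₂ (K-shape isD)) d₁) (weakly {g} (proj₁ (K-shape isD)) (+≤+ (s≤s z≤n)) (+≤+ c<d) (+≤+ (ℕP.m≤n⇒m≤1+n d≤k)))
        (e (+ 0)) (e (+ suc c))
        where
        f = K (c ∷ cs)
        g = K (d ∷ ds)
    ... | tri> _ _ g = ⊥-elim (lin (K (d ∷ ds) (+ 0) ∷ K (d ∷ ds) (+ suc d) ∷ K (c ∷ cs) (+ 0) ∷ K (c ∷ cs) (+ suc d) ∷ K (c ∷ cs) (+ c) ∷ + length (d ∷ ds) ∷ + length (c ∷ cs) ∷ [])
        ((α ≺ β) ∷ (η ≺ γ) ∷ (ζ ≼ η) ∷ (γ ⊟ ξ ≐ α ⊟ θ) ∷ (ζ ⊟ ξ ≐ β ⊟ θ) ∷ []) ff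
        (proj₁ (proj₂ (K-shape isD))) (proj₂ (proj₂ (K-shape isC)) c₁) (weakly {K (c ∷ cs)} (proj₁ (K-shape isC)) (+≤+ (s≤s z≤n)) (+≤+ g) (+≤+ (ℕP.m≤n⇒m≤1+n c≤k)))
        (e (+ 0)) (e (+ suc d)))
    ... | tri≈ _ refl _ = cong (c ∷_) (K-injective (IsPk-tail isC) (IsPk-tail isD) λ x → lin (K cs x ∷ K ds x ∷ + length cs ∷ + length ds ∷ [])
          ((α ⊟ (# 1 ⊞ γ) ≐ β ⊟ (# 1 ⊞ ζ)) ∷ []) (α ⊟ γ ≐ β ⊟ ζ)
          (subst (λ y → K cs y -ᶻ + suc (length cs) ≡ K ds y -ᶻ + suc (length ds)) (κ-onto x) (e (inv (rowWord k 1 c) (x -ᶻ + 1)))))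
      where
      κ-onto : ∀ x → κ c (inv (rowWord k 1 c) (x -ᶻ + 1)) ≡ x
      κ-onto x = lin (κ c y ∷ x ∷ act (rowWord k 1 c) y ∷ []) ((γ ≐ α ⊟ # 1) ∷ (γ ≐ β ⊟ # 1) ∷ []) (α ≐ β)
        (trans (act-row 0 c c≤k y) (cong (λ z → κ c z -ᶻ + 1) (ℤP.+-identityʳ y))) (act-inv (rowWord k 1 c) (x -ᶻ + 1))
        where y = inv (rowWord k 1 c) (x -ᶻ + 1)

  wλ-injective : ∀ {cs ds} → IsPk k cs → IsPk k ds → wλ k cs ≈W wλ k ds → cs ≡ ds
  wλ-injective {cs} {ds} isC isD e = K-injective isC isD (λ x → trans (sym (act-wλ (bounds isC) x)) (trans (e x) (act-wλ (bounds isD) x)))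

  private
    search : ∀ (f : ℕ → ℤ) z → (∀ m → f m ≢ z) → ∀ d m → f m <ᶻ z → z <ᶻ f (m ℕ.+ d) → ∃[ c ] m ≤ c × c < m ℕ.+ d × f c <ᶻ z × z <ᶻ f (suc c)
    search f z ne zero    m lo hi = ⊥-elim (ℤP.<-asym lo (subst (λ t → z <ᶻ f t) (ℕP.+-identityʳ m) hi))
    search f z ne (suc d) m lo hi with ℤP.<-cmp (f (suc m)) z
    ... | tri> _ _ g = m , ℕP.≤-refl , ℕP.m<m+n m (s≤s z≤n) , lo , g
    ... | tri≈ _ e _ = contradiction e (ne (suc m))
    ... | tri< l _ _ with search f z ne d (suc m) l (subst (λ t → z <ᶻ f t) (ℕP.+-suc m d) hi)
    ...   | c , a , b , x , y = c , ℕP.<⇒≤ a , subst (c <_) (sym (ℕP.+-suc m d)) b , x , y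

    blk-window : ∀ {a b} → + 1 ≤ᶻ a → a <ᶻ b → b ≤ᶻ N → blk a ≡ blk b
    blk-window a₁ l b₂ = trans (blk-zero a₁ (ℤP.≤-trans (ℤP.<⇒≤ l) b₂)) (sym (blk-zero (ℤP.≤-trans a₁ (ℤP.<⇒≤ l)) b₂))

    act-N : ∀ w → act w N ≡ act w (+ 0) +ᶻ N
    act-N w = trans (cong (act w) (trans (sym N-one) (sym (ℤP.+-identityˡ (+ 1 ∙N))))) (trans (act-shift w (+ 0) (+ 1)) (cong (act w (+ 0) +ᶻ_) N-one))

  -- The inverse of prepending a row of length c to a partition.
  module RemoveRow (w : Word k) (inc : Incr w) (c : ℕ) (1≤c : 1 ≤ c) (c≤k : c ≤ k)
    (below : act w (+ c) <ᶻ act w (+ 0)) (above : act w (+ 0) <ᶻ act w (+ suc c)) where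

    private
      row = rowWord k 1 c
      f = act w

      mono : ∀ {a b} → + 1 ≤ᶻ a → a <ᶻ b → b ≤ᶻ N → f a <ᶻ f b
      mono a₁ l b₂ = raise inc (blk-window a₁ l b₂) l

      weak : ∀ {a b} → + 1 ≤ᶻ a → a ≤ᶻ b → b ≤ᶻ N → f a ≤ᶻ f b
      weak {a} {b} a₁ le b₂ with ℤP.<-cmp a b
      ... | tri< l _ _    = ℤP.<⇒≤ (mono a₁ l b₂)
      ... | tri≈ _ refl _ = ℤP.≤-refl
      ... | tri> _ _ g    = contradiction le (ℤP.<⇒≱ g)

    -- After cancellation of the first row on the right, the remaining rows are numbered from 2;
    -- rotation by 1 renumbers them from 1.
    rest : Word k
    rest = rotate 1 (w ++ reverse row)

    act-rest : ∀ p → act rest (κ c p) ≡ f p +ᶻ + 1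
    act-rest p = begin
      act rest (κ c p)                                  ≡⟨ cong (act rest) (lin (κ c p ∷ []) [] (α ≐ α ⊟ # 1 ⊞ # 1)) ⟩
      act rest (κ c p -ᶻ + 1 +ᶻ + 1)                    ≡⟨ act-rotate 1 (w ++ reverse row) (κ c p -ᶻ + 1) ⟩
      act (w ++ reverse row) (κ c p -ᶻ + 1) +ᶻ + 1      ≡⟨ cong (_+ᶻ + 1) (act-++ w (reverse row) _) ⟩
      f (inv row (κ c p -ᶻ + 1)) +ᶻ + 1                 ≡⟨ cong (λ y → f (inv row y) +ᶻ + 1) (trans (act-row 0 c c≤k p) (cong (λ z → κ c z -ᶻ + 1) (ℤP.+-identityʳ p))) ⟨
      f (inv row (act row p)) +ᶻ + 1                    ≡⟨ cong (λ y → f y +ᶻ + 1) (inv-act row p) ⟩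
      f p +ᶻ + 1                                        ∎
      where open ≡-Reasoning

    private
      -- Up to the common shift by 1, the window of `rest` is that of `w` with the last entry w(n) =
      -- w(0) + n replaced by w(0), which fits in directly after the c-th entry.
      data Entry (a : ℤ) : Set where
        low  : a ≤ᶻ + c → act rest a ≡ f a +ᶻ + 1 → Entry a
        mid  : a ≡ + suc c → act rest a ≡ f (+ 0) +ᶻ + 1 → Entry a
        high : + suc c <ᶻ a → act rest a ≡ f (a -ᶻ + 1) +ᶻ + 1 → Entry a

      entry : ∀ a → + 1 ≤ᶻ a → a ≤ᶻ N → Entry a
      entry a a₁ a₂ with ℤP.<-cmp a (+ suc c)
      ... | tri< l _ _ = low a≤c (trans (cong (act rest) (sym (κ-fixed {c} {a} (subst (_≤ᶻ + c) (sym (pos-window a₁ a₂)) a≤c)))) (act-rest a))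
        where
        a≤c : a ≤ᶻ + c
        a≤c = lin (a ∷ + c ∷ []) ((α ≺ # 1 ⊞ β) ∷ []) (α ≼ β) l
      ... | tri≈ _ e _ = mid e (trans (cong (act rest) (trans e (sym (κ-last {c} {+ 0} c≤k pos-zero)))) (act-rest (+ 0)))
      ... | tri> _ _ g = high g (trans (cong (act rest) (sym (trans (κ-middle {c} {a -ᶻ + 1}
              (subst (+ c <ᶻ_) (sym pos-a-1) (lin (a ∷ + c ∷ []) ((# 1 ⊞ β ≺ α) ∷ []) (β ≺ α ⊟ # 1) g)) (subst (_<ᶻ N) (sym pos-a-1) (lin (a ∷ N ∷ []) ((α ≼ β) ∷ []) (α ⊟ # 1 ≺ β) a₂)))
              (lin (a ∷ []) [] (α ⊟ # 1 ⊞ # 1 ≐ α))))) (act-rest (a -ᶻ + 1)))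
        where
        pos-a-1 : pos (a -ᶻ + 1) ≡ a -ᶻ + 1
        pos-a-1 = pos-window (lin (a ∷ + c ∷ []) ((# 1 ⊞ β ≺ α) ∷ (# 0 ≼ β) ∷ []) (# 1 ≼ α ⊟ # 1) g (0≤+ c)) (lin (a ∷ N ∷ []) ((α ≼ β) ∷ []) (α ⊟ # 1 ≼ β) a₂)

      ordered : ∀ {x y a b} → act rest a ≡ x +ᶻ + 1 → act rest b ≡ y +ᶻ + 1 → x <ᶻ y → act rest a <ᶻ act rest b
      ordered e g l = subst₂ _<ᶻ_ (sym e) (sym g) (ℤP.+-monoˡ-< (+ 1) l)

      ascending-window : ∀ {a b} → + 1 ≤ᶻ a → a <ᶻ b → b ≤ᶻ N → act rest a <ᶻ act rest b
      ascending-window {a} {b} a₁ l b₂ = decide (entry a a₁ (ℤP.≤-trans (ℤP.<⇒≤ l) b₂)) (entry b (ℤP.≤-trans a₁ (ℤP.<⇒≤ l)) b₂)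
        where
        low<0 : ∀ {a} → + 1 ≤ᶻ a → a ≤ᶻ + c → f a <ᶻ f (+ 0)
        low<0 a₁ le = ℤP.≤-<-trans (weak a₁ le (+≤+ (ℕP.m≤n⇒m≤1+n c≤k))) below
        0<high : ∀ {b} → + suc c <ᶻ b → b ≤ᶻ N → f (+ 0) <ᶻ f (b -ᶻ + 1)
        0<high {b} g b₂ = ℤP.<-≤-trans above (weak (+≤+ (s≤s z≤n)) (lin (b ∷ + c ∷ []) ((# 1 ⊞ β ≺ α) ∷ []) (# 1 ⊞ β ≼ α ⊟ # 1) g) (lin (b ∷ N ∷ []) ((α ≼ β) ∷ []) (α ⊟ # 1 ≼ β) b₂))
        decide : Entry a → Entry b → act rest a <ᶻ act rest b
        decide (low x e)  (low y g)  = ordered e g (mono a₁ l b₂)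
        decide (low x e)  (mid y g)  = ordered e g (low<0 a₁ x)
        decide (low x e)  (high y g) = ordered e g (ℤP.<-trans (low<0 a₁ x) (0<high y b₂))
        decide (mid x e)  (low y g)  = ⊥-elim (lin (a ∷ b ∷ + c ∷ []) ((α ≐ # 1 ⊞ γ) ∷ (α ≺ β) ∷ (β ≼ γ) ∷ []) ff x l y)
        decide (mid x e)  (mid y g)  = ⊥-elim (ℤP.<-irrefl (trans x (sym y)) l)
        decide (mid x e)  (high y g) = ordered e g (0<high y b₂)
        decide (high x e) (low y g)  = ⊥-elim (lin (a ∷ b ∷ + c ∷ []) ((# 1 ⊞ γ ≺ α) ∷ (α ≺ β) ∷ (β ≼ γ) ∷ []) ff x l y)
        decide (high x e) (mid y g)  = ⊥-elim (ℤP.<-asym l (subst (_<ᶻ a) (sym y) x))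
        decide (high x e) (high y g) = ordered e g (mono (lin (a ∷ + c ∷ []) ((# 1 ⊞ β ≺ α) ∷ (# 0 ≼ β) ∷ []) (# 1 ≼ α ⊟ # 1) x (0≤+ c)) (ℤP.+-monoˡ-< (-ᶻ (+ 1)) l)
                                                (lin (b ∷ N ∷ []) ((α ≼ β) ∷ []) (α ⊟ # 1 ≼ β) b₂))

    Incr-rest : Incr rest
    Incr-rest = window⇒Incr {rest} ascending-window

    rest-first : act rest (+ 1) ≡ f (+ 1) +ᶻ + 1
    rest-first with entry (+ 1) ℤP.≤-refl (ℤP.<⇒≤ 1<N)
    ... | low _ e  = e
    ... | mid e _  = ⊥-elim (lin (+ c ∷ []) ((# 1 ≐ # 1 ⊞ α) ∷ (# 1 ≼ α) ∷ []) ff e (+≤+ 1≤c))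
    ... | high g _ = ⊥-elim (lin (+ c ∷ []) ((# 1 ⊞ α ≺ # 1) ∷ (# 1 ≼ α) ∷ []) ff g (+≤+ 1≤c))

    rest-last : act rest N ≤ᶻ f N
    rest-last with entry N (ℤP.<⇒≤ 1<N) ℤP.≤-refl
    ... | low a _  = ⊥-elim (ℤP.<⇒≱ (ℤ.+<+ (s≤s c≤k)) a)
    ... | mid _ e  = lin (act rest N ∷ f (+ 0) ∷ f N ∷ N ∷ []) ((α ≐ β ⊞ # 1) ∷ (γ ≐ β ⊞ ζ) ∷ (# 1 ≺ ζ) ∷ []) (α ≼ γ) e (act-N w) 1<N
    ... | high g e = lin (act rest N ∷ f (N -ᶻ + 1) ∷ f N ∷ []) ((α ≐ β ⊞ # 1) ∷ (β ≺ γ) ∷ []) (α ≼ γ) e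
          (mono (lin (N ∷ + c ∷ []) ((# 1 ⊞ β ≺ α) ∷ (# 0 ≼ β) ∷ []) (# 1 ≼ α ⊟ # 1) g (0≤+ c)) (lin (N ∷ []) [] (α ⊟ # 1 ≺ α)) ℤP.≤-refl)

    prepend : ∀ {cs} → IsPk k cs → wλ k cs ≈W rest → IsPk k (c ∷ cs) × wλ k (c ∷ cs) ≈W w
    prepend {cs} isP e = isP′ , λ x → lin (act (wλ k (c ∷ cs)) x ∷ K cs (κ c x) ∷ + length cs ∷ act (wλ k cs) (κ c x) ∷ f x ∷ [])
        ((α ≐ β ⊟ (# 1 ⊞ γ)) ∷ (ζ ≐ β ⊟ γ) ∷ (ζ ≐ η ⊞ # 1) ∷ []) (α ≐ η)
        (act-wλ (c≤k ∷ bounds isP) x) (act-wλ (bounds isP) (κ c x)) (trans (e (κ c x)) (act-rest x))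
      where
      at-c+1 : act rest (+ suc c) ≡ f (+ 0) +ᶻ + 1
      at-c+1 = trans (cong (act rest) (sym (κ-last {c} {+ 0} c≤k pos-zero))) (act-rest (+ 0))
      link : ∀ {cs} → Linked ℕ._≥_ cs → firstPart cs ≤ c → Linked ℕ._≥_ (c ∷ cs)
      link []      _  = [-]
      link [-]     le = le ∷ [-]
      link (g ∷ l) le = le ∷ (g ∷ l)
      first≤k : ∀ {cs} → IsPk k cs → firstPart cs ≤ k
      first≤k {[]}     _                  = z≤n
      first≤k {_ ∷ _} (_ , (_ , b) ∷ _) = b
      first≤c : firstPart cs ≤ c
      -- A larger first part d would give the cycle rest(c+1) ≤ rest(d) < rest(0) = rest(n) - n ≤
      -- w(n) - n = w(0) < rest(c+1).
      first≤c = ℕP.≮⇒≥ λ c<d → lin (act rest (+ suc c) ∷ act rest (+ d) ∷ act rest (+ 0) ∷ act rest N ∷ N ∷ f (+ 0) ∷ f N ∷ [])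
          ((α ≼ β) ∷ (β ≺ γ) ∷ (ζ ≐ γ ⊞ η) ∷ (ζ ≼ ξ) ∷ (α ≐ θ ⊞ # 1) ∷ (ξ ≐ θ ⊞ η) ∷ []) ff
          (rest-weak c<d) (rest-below c<d) (act-N rest) rest-last at-c+1 (act-N w)
        where
        d = firstPart cs
        d≤N : + d ≤ᶻ N
        d≤N = +≤+ (ℕP.m≤n⇒m≤1+n (first≤k isP))
        rest-weak : c < d → act rest (+ suc c) ≤ᶻ act rest (+ d)
        rest-weak c<d with ℤP.<-cmp (+ suc c) (+ d)
        ... | tri< l _ _ = ℤP.<⇒≤ (ascending-window (+≤+ (s≤s z≤n)) l d≤N)
        ... | tri≈ _ q _ = ℤP.≤-reflexive (cong (act rest) q)
        ... | tri> _ _ g = contradiction (+≤+ c<d) (ℤP.<⇒≱ g)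
        rest-below : c < d → act rest (+ d) <ᶻ act rest (+ 0)
        rest-below c<d = subst₂ _<ᶻ_ (trans (sym (act-wλ (bounds isP) _)) (e _)) (trans (sym (act-wλ (bounds isP) _)) (e _))
          (ℤP.+-monoˡ-< (-ᶻ (+ length cs)) (proj₂ (proj₂ (K-shape isP)) (ℕP.≤-trans (s≤s z≤n) c<d)))
      isP′ : IsPk k (c ∷ cs)
      isP′ = link (proj₁ isP) first≤c , ((1≤c , c≤k) ∷ proj₂ isP)

  private
    -- `d` bounds the spread of the window: removing a row raises its first entry and does not raise
    -- its last. A row can be removed unless w(0) < w(1), since w(1) < w(0) < w(0) + n = w(n) forces
    -- w(0) to fit between two consecutive entries.
    wλ-onto : ∀ d w → Incr w → act w N <ᶻ act w (+ 1) +ᶻ + d → ∃[ cs ] IsPk k cs × wλ k cs ≈W w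
    wλ-onto zero    w inc lt = ⊥-elim (lin (act w N ∷ act w (+ 1) ∷ []) ((α ≺ β ⊞ # 0) ∷ (β ≺ α) ∷ []) ff lt (raise inc (blk-window ℤP.≤-refl 1<N ℤP.≤-refl) 1<N))
    wλ-onto (suc d) w inc lt = decide (ℤP.<-cmp (act w (+ 0)) (act w (+ 1)))
      where
      decide : _ → ∃[ cs ] IsPk k cs × wλ k cs ≈W w
      decide (tri< l _ _) = [] , ([] , []) , ≈W-sym {w} {[]} (no-descent w ascent)
        where
        ascent : ∀ i → act w (ι i) <ᶻ act w (ι i +ᶻ + 1)
        ascent Fin.zero    = l
        ascent (Fin.suc i) = right-up⁻¹ (Fin.suc i) w (Incr-rises {w} inc i)
      decide (tri≈ _ e _) = contradiction (act-injective w e) (λ ())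
      decide (tri> _ _ g) = remove (search (act w ∘ suc-index) (act w (+ 0)) distinct k 0 g
          (subst (act w (+ 0) <ᶻ_) (sym (act-N w)) (lin (act w (+ 0) ∷ N ∷ []) ((# 1 ≺ β) ∷ []) (α ≺ α ⊞ β) 1<N)))
        where
        suc-index : ℕ → ℤ
        suc-index m = + suc m
        distinct : ∀ m → act w (+ suc m) ≢ act w (+ 0)
        distinct m e = contradiction (act-injective w e) (λ ())
        remove : ∃[ c ] 0 ≤ c × c < k × act w (+ suc c) <ᶻ act w (+ 0) × act w (+ 0) <ᶻ act w (+ suc (suc c)) → ∃[ cs ] IsPk k cs × wλ k cs ≈W w
        remove (c , _ , c<k , lo , hi) = extend (wλ-onto d rest Incr-rest (lin (act rest N ∷ act rest (+ 1) ∷ act w N ∷ act w (+ 1) ∷ + d ∷ [])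
            ((γ ≺ ζ ⊞ (# 1 ⊞ η)) ∷ (α ≼ γ) ∷ (β ≐ ζ ⊞ # 1) ∷ []) (α ≺ β ⊞ η) lt rest-last rest-first))
          where
          open RemoveRow w inc (suc c) (s≤s z≤n) c<k lo hi
          extend : ∃[ cs ] IsPk k cs × wλ k cs ≈W rest → ∃[ cs ] IsPk k cs × wλ k cs ≈W w
          extend (cs , isP , e) = suc c ∷ cs , prepend isP e

  wλ-surjective : ∀ w → Incr w → ∃[ cs ] IsPk k cs × wλ k cs ≈W w
  wλ-surjective w inc = wλ-onto (suc ℤ.∣ gap ∣) w inc (lin (act w N ∷ act w (+ 1) ∷ + ℤ.∣ gap ∣ ∷ []) ((α ⊟ β ≼ γ) ∷ []) (α ≺ β ⊞ (# 1 ⊞ γ)) (i≤∣i∣ gap))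
    where
    gap = act w N -ᶻ act w (+ 1)

  -- Rectangles and their union with a partition

  iterate : ℕ → ℕ → ℤ → ℤ
  iterate t zero    p = p
  iterate t (suc m) p = iterate t m (κ t p)

  K-replicate : ∀ t m cs p → K (List.replicate m t ++ cs) p ≡ K cs (iterate t m p)
  K-replicate t zero    cs p = refl
  K-replicate t (suc m) cs p = K-replicate t m cs (κ t p)

  module Rect (t : ℕ) (1≤t : 1 ≤ t) (t≤k : t ≤ k) where

    height : ℕ
    height = suc k ∸ t

    height+t : + height +ᶻ + t ≡ N
    height+t = cong +_ (ℕP.m∸n+n≡m (ℕP.m≤n⇒m≤1+n t≤k))

    private
      iterate-+ : ∀ a b p → iterate t (a ℕ.+ b) p ≡ iterate t b (iterate t a p)
      iterate-+ zero    b p = refl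
      iterate-+ (suc a) b p = iterate-+ a b (κ t p)

      iterate-fixed : ∀ m p → pos p ≤ᶻ + t → iterate t m p ≡ p
      iterate-fixed zero    p le = refl
      iterate-fixed (suc m) p le = trans (cong (iterate t m) (κ-fixed {t} {p} le)) (iterate-fixed m p le)

      climb : ∀ m p → + t <ᶻ pos p → pos p +ᶻ + m ≤ᶻ N → iterate t m p ≡ p +ᶻ + m
      climb zero    p lt le = sym (ℤP.+-identityʳ p)
      climb (suc m) p lt le = trans (cong (iterate t m) (κ-middle {t} {p} lt inside))
          (trans (climb m (p +ᶻ + 1) (subst (+ t <ᶻ_) (sym (pos-+1 {p} inside)) (ℤP.<-trans lt (y<y+1 (pos p))))
              (lin (pos (p +ᶻ + 1) ∷ pos p ∷ + m ∷ N ∷ []) ((α ≐ β ⊞ # 1) ∷ (β ⊞ (# 1 ⊞ γ) ≼ ζ) ∷ []) (α ⊞ γ ≼ ζ) (pos-+1 {p} inside) le))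
            (ℤP.+-assoc p (+ 1) (+ m)))
        where
        inside : pos p <ᶻ N
        inside = lin (pos p ∷ + m ∷ N ∷ []) ((α ⊞ (# 1 ⊞ β) ≼ γ) ∷ (# 0 ≼ β) ∷ []) (α ≺ γ) le (0≤+ m)

      natural : ∀ i → + 0 ≤ᶻ i → ∃[ n ] i ≡ + n
      natural (+ n) _ = n , refl

      -- κ moves each of the suc k ∸ t positions above t through all of them.
      iterate-moved : ∀ p → + t <ᶻ pos p → iterate t height p ≡ p +ᶻ N
      iterate-moved p lt = go (natural (N -ᶻ pos p) (lin (N ∷ pos p ∷ []) ((β ≼ α) ∷ []) (# 0 ≼ α ⊟ β) (pos≤N p)))
                              (natural (pos p -ᶻ + suc t) (lin (pos p ∷ + t ∷ []) ((β ≺ α) ∷ []) (# 0 ≼ α ⊟ (# 1 ⊞ β)) lt))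
        where
        -- `a` steps climb from p to a multiple of n, one more wraps round to position t + 1 of the
        -- next block, and `b` steps climb to the position of p there; a + 1 + b = n - t.
        go : ∃[ a ] N -ᶻ pos p ≡ + a → ∃[ b ] pos p -ᶻ + suc t ≡ + b → iterate t height p ≡ p +ᶻ N
        go (a , ea) (b , eb) = begin
          iterate t height p                                ≡⟨ cong (λ m → iterate t m p) split ⟩
          iterate t (a ℕ.+ suc b) p                         ≡⟨ iterate-+ a (suc b) p ⟩
          iterate t b (κ t (iterate t a p))                 ≡⟨ cong (iterate t b ∘ κ t) (climb a p lt (ℤP.≤-reflexive top-a)) ⟩
          iterate t b (κ t (p +ᶻ + a))                      ≡⟨ cong (iterate t b) (κ-last {t} {p +ᶻ + a} t≤k pos-top) ⟩
          iterate t b (p +ᶻ + a +ᶻ + suc t)                 ≡⟨ climb b _ (subst (+ t <ᶻ_) (sym pos-bottom) (ℤ.+<+ (ℕP.n<1+n t)))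
                                                                 (lin (pos (p +ᶻ + a +ᶻ + suc t) ∷ + t ∷ + b ∷ pos p ∷ N ∷ []) ((α ≐ # 1 ⊞ β) ∷ (ζ ⊟ (# 1 ⊞ β) ≐ γ) ∷ (ζ ≼ η) ∷ []) (α ⊞ γ ≼ η) pos-bottom eb (pos≤N p)) ⟩
          p +ᶻ + a +ᶻ + suc t +ᶻ + b                        ≡⟨ lin (p ∷ + a ∷ + t ∷ + b ∷ pos p ∷ N ∷ []) ((θ ⊟ η ≐ β) ∷ (η ⊟ (# 1 ⊞ γ) ≐ ζ) ∷ []) (α ⊞ β ⊞ (# 1 ⊞ γ) ⊞ ζ ≐ α ⊞ θ) ea eb ⟩
          p +ᶻ N                                            ∎
          where
          open ≡-Reasoning
          split : height ≡ a ℕ.+ suc b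
          split = ℤP.+-injective (lin (+ height ∷ + a ∷ + b ∷ pos p ∷ N ∷ + t ∷ []) ((η ⊟ ζ ≐ β) ∷ (ζ ⊟ (# 1 ⊞ θ) ≐ γ) ∷ (α ⊞ θ ≐ η) ∷ []) (α ≐ β ⊞ (# 1 ⊞ γ)) ea eb height+t)
          top-a : pos p +ᶻ + a ≡ N
          top-a = lin (pos p ∷ + a ∷ N ∷ []) ((γ ⊟ α ≐ β) ∷ []) (α ⊞ β ≐ γ) ea
          pos-top : pos (p +ᶻ + a) ≡ N
          pos-top = pos-unique N (blk p) (ℤP.<⇒≤ 1<N) ℤP.≤-refl (lin (p ∷ + a ∷ N ∷ pos p ∷ blk p ∙N ∷ []) ((α ≐ ζ ⊞ η) ∷ (ζ ⊞ β ≐ γ) ∷ []) (α ⊞ β ≐ γ ⊞ η) (pos+blk p) top-a)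
          pos-bottom : pos (p +ᶻ + a +ᶻ + suc t) ≡ + suc t
          pos-bottom = pos-wrap {p +ᶻ + a} t (s≤s t≤k) pos-top

    iterate-height : ∀ p → (pos p ≤ᶻ + t × iterate t height p ≡ p) ⊎ (+ t <ᶻ pos p × iterate t height p ≡ p +ᶻ + 1 ∙N)
    iterate-height p with pos p ℤP.≤? + t
    ... | yes le = inj₁ (le , iterate-fixed height p le)
    ... | no n   = inj₂ (ℤP.≰⇒> n , trans (iterate-moved p (ℤP.≰⇒> n)) (cong (p +ᶻ_) (sym N-one)))

    private
      replicate-bounds : ∀ m → All (λ x → 1 ≤ x × x ≤ k) (List.replicate m t)
      replicate-bounds zero    = []
      replicate-bounds (suc m) = (1≤t , t≤k) ∷ replicate-bounds m

      replicate-linked : ∀ m → Linked ℕ._≥_ (List.replicate m t)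
      replicate-linked zero          = []
      replicate-linked (suc zero)    = [-]
      replicate-linked (suc (suc m)) = ℕP.≤-refl ∷ replicate-linked (suc m)

    rect-IsPk : IsPk k (rect k t)
    rect-IsPk = replicate-linked height , replicate-bounds height

    r : Word k
    r = wλ k (rect k t)

    act-r : ∀ x → act r x ≡ iterate t height x -ᶻ + height
    act-r x = trans (act-wλ (bounds rect-IsPk) x) (cong₂ (λ a b → a -ᶻ + b)
      (trans (cong (λ cs → K cs x) (sym (ListP.++-identityʳ (rect k t)))) (K-replicate t height [] x)) (ListP.length-replicate height))

    isRectangle : IsRectangle t r
    isRectangle x = (λ le → lin (act r x ∷ x ∷ + t ∷ N ∷ + height ∷ []) ((α ≐ β ⊟ η) ∷ (η ⊞ γ ≐ ζ) ∷ []) (α ≐ β ⊞ γ ⊟ ζ)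
                        (trans (act-r x) (cong (_-ᶻ + height) (iterate-fixed height x le))) height+t)
                  , (λ lt → lin (act r x ∷ x ∷ + t ∷ N ∷ + height ∷ []) ((α ≐ β ⊞ ζ ⊟ η) ∷ (η ⊞ γ ≐ ζ) ∷ []) (α ≐ β ⊞ γ)
                        (trans (act-r x) (cong (_-ᶻ + height) (iterate-moved x lt))) height+t)

    private
      inserts : ℕ → List ℕ → List ℕ
      inserts zero    cs = cs
      inserts (suc m) cs = insertDesc t (inserts m cs)

      insert-less : ∀ {x y ys} → y < x → insertDesc x (y ∷ ys) ≡ x ∷ y ∷ ys
      insert-less {x} {y} lt with y <ᵇ x | ℕP.<⇒<ᵇ lt
      ... | true | _ = refl

      insert-more : ∀ {x y ys} → x ≤ y → insertDesc x (y ∷ ys) ≡ y ∷ insertDesc x ys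
      insert-more {x} {y} le with y <ᵇ x in e
      ... | false = refl
      ... | true  = contradiction (ℕP.<ᵇ⇒< y x (subst T (sym e) tt)) (ℕP.≤⇒≯ le)

      insert-head : ∀ {x ys} → Linked ℕ._≥_ (x ∷ ys) → insertDesc x ys ≡ x ∷ ys
      insert-head [-] = refl
      insert-head {x} {y ∷ ys} (g ∷ l) with ℕP.m≤n⇒m<n∨m≡n g
      ... | inj₁ lt   = insert-less lt
      ... | inj₂ refl = trans (insert-more {y} {y} ℕP.≤-refl) (cong (y ∷_) (insert-head l))

      sorted : ∀ {cs} → Linked ℕ._≥_ cs → sortDesc cs ≡ cs
      sorted []      = refl
      sorted [-]     = refl
      sorted {c ∷ _} (g ∷ l) = trans (cong (insertDesc c) (sorted l)) (insert-head (g ∷ l))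

      union : ∀ m {cs} → Linked ℕ._≥_ cs → List.replicate m t ∪P cs ≡ inserts m cs
      union zero    l = sorted l
      union (suc m) l = cong (insertDesc t) (union m l)

      inserts-small : ∀ m {cs} → insertDesc t cs ≡ t ∷ cs → inserts m cs ≡ List.replicate m t ++ cs
      inserts-small zero    e = refl
      inserts-small (suc m) {cs} e = trans (cong (insertDesc t) (inserts-small m e)) (front m)
        where
        front : ∀ m → insertDesc t (List.replicate m t ++ cs) ≡ t ∷ List.replicate m t ++ cs
        front zero    = e
        front (suc m) = trans (insert-more {t} {t} ℕP.≤-refl) (cong (t ∷_) (front m))

      inserts-large : ∀ m {c cs} → t ≤ c → inserts m (c ∷ cs) ≡ c ∷ inserts m cs
      inserts-large zero    le = refl
      inserts-large (suc m) le = trans (cong (insertDesc t) (inserts-large m le)) (insert-more le)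

      -- For t ≤ c, `κ c` fixes the positions up to t and keeps the others above t; the rectangle is
      -- the identity on the former and the translation by n on the latter.
      κ-iterate : ∀ {c} → t ≤ c → c ≤ k → ∀ p → iterate t height (κ c p) ≡ κ c (iterate t height p)
      κ-iterate {c} t≤c c≤k p with iterate-height p
      ... | inj₁ (le , e) = trans (cong (iterate t height) same) (trans e (trans (sym same) (cong (κ c) (sym e))))
        where
        same : κ c p ≡ p
        same = κ-fixed {c} {p} (ℤP.≤-trans le (+≤+ t≤c))
      ... | inj₂ (lt , e) = trans (trans (iterate-moved (κ c p) (stays-above (κ-cases c p))) (cong (κ c p +ᶻ_) (sym N-one))) (trans (sym (κ-shift c≤k p (+ 1))) (cong (κ c) (sym e)))
        where
        stays-above : κ-Cases c p → + t <ᶻ pos (κ c p)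
        stays-above (fixed _ q)    = subst (λ z → + t <ᶻ pos z) (sym q) lt
        stays-above (middle _ b q) = subst (λ z → + t <ᶻ z) (sym (trans (cong pos q) (pos-+1 {p} b))) (ℤP.<-trans lt (y<y+1 (pos p)))
        stays-above (last _ b q)   = subst (λ z → + t <ᶻ z) (sym (trans (cong pos q) (pos-wrap {p} c (s≤s c≤k) b))) (ℤ.+<+ (s≤s t≤c))

      -- In the sorted union the parts ≥ t precede the rectangle and act before it. They commute
      -- with it, so the rectangle can be made to act first, which is the factorisation defining
      -- `Θ`.
      K-inserts : ∀ {cs} → All (_≤ k) cs → ∀ p → K (inserts height cs) p ≡ K cs (iterate t height p)
      K-inserts {[]}     []       p = trans (cong (λ l → K l p) (inserts-small height refl)) (K-replicate t height [] p)
      K-inserts {c ∷ cs} (b ∷ bs) p = split (ℕP.≤-<-connex t c)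
        where
        split : t ≤ c ⊎ c < t → K (inserts height (c ∷ cs)) p ≡ K cs (κ c (iterate t height p))
        split (inj₂ lt) = trans (cong (λ l → K l p) (inserts-small height (insert-less lt))) (K-replicate t height (c ∷ cs) p)
        split (inj₁ le) = trans (cong (λ l → K l p) (inserts-large height le)) (trans (K-inserts bs (κ c p)) (cong (K cs) (κ-iterate le b p)))

      inserts-All : ∀ m {cs} → All (_≤ k) cs → All (_≤ k) (inserts m cs)
      inserts-All zero    bs = bs
      inserts-All (suc m) bs = insert-All (inserts-All m bs)
        where
        insert-All : ∀ {cs} → All (_≤ k) cs → All (_≤ k) (insertDesc t cs)
        insert-All []                 = t≤k ∷ []
        insert-All {c ∷ cs} (b ∷ bs) with c <ᵇ t
        ... | true  = t≤k ∷ b ∷ bs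
        ... | false = b ∷ insert-All bs

      inserts-length : ∀ m cs → length (inserts m cs) ≡ m ℕ.+ length cs
      inserts-length zero    cs = refl
      inserts-length (suc m) cs = trans (insert-length (inserts m cs)) (cong suc (inserts-length m cs))
        where
        insert-length : ∀ cs → length (insertDesc t cs) ≡ suc (length cs)
        insert-length []       = refl
        insert-length (c ∷ cs) with c <ᵇ t
        ... | true  = refl
        ... | false = cong suc (insert-length cs)

    open Rectangle t r isRectangle using (Θ; δ-Θ) public

    wλ-union : ∀ {cs} → IsPk k cs → wλ k (rect k t ∪P cs) ≈W Θ (wλ k cs)
    wλ-union {cs} isP x = begin
      act (wλ k (rect k t ∪P cs)) x                          ≡⟨ cong (λ l → act (wλ k l) x) (union height (proj₁ isP)) ⟩
      act (wλ k (inserts height cs)) x                       ≡⟨ act-wλ (inserts-All height (bounds isP)) x ⟩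
      K (inserts height cs) x -ᶻ + length (inserts height cs) ≡⟨ cong₂ (λ a b → a -ᶻ + b) (K-inserts (bounds isP) x) (inserts-length height cs) ⟩
      K cs y -ᶻ (+ height +ᶻ + length cs)                    ≡⟨ lin (K cs y ∷ + height ∷ + length cs ∷ K cs (y -ᶻ N) ∷ + t ∷ N ∷ []) ((ζ ≐ α ⊟ θ) ∷ (β ⊞ η ≐ θ) ∷ []) (α ⊟ (β ⊞ γ) ≐ ζ ⊟ γ ⊞ η) back height+t ⟩
      K cs (y -ᶻ N) -ᶻ + length cs +ᶻ + t                    ≡⟨ cong (_+ᶻ + t) (act-wλ (bounds isP) (y -ᶻ N)) ⟨
      act (wλ k cs) (y -ᶻ N) +ᶻ + t                          ≡⟨ act-rotate t (wλ k cs) (y -ᶻ N) ⟨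
      act (rotate t (wλ k cs)) (y -ᶻ N +ᶻ + t)               ≡⟨ cong (act (rotate t (wλ k cs))) (lin (y ∷ N ∷ + t ∷ + height ∷ act r x ∷ []) ((η ≐ α ⊟ ζ) ∷ (ζ ⊞ γ ≐ β) ∷ []) (α ⊟ β ⊞ γ ≐ η) (act-r x) height+t) ⟩
      act (rotate t (wλ k cs)) (act r x)                     ≡⟨ act-++ (rotate t (wλ k cs)) r x ⟨
      act (Θ (wλ k cs)) x                                    ∎
      where
      open ≡-Reasoning
      y = iterate t height x
      back : K cs (y -ᶻ N) ≡ K cs y -ᶻ N
      back = lin (K cs (y -ᶻ N) ∷ K cs y ∷ N ∷ + 1 ∙N ∷ []) ((β ≐ α ⊞ ζ) ∷ (ζ ≐ γ) ∷ []) (α ≐ β ⊟ γ)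
        (trans (cong (K cs) (lin (y ∷ N ∷ + 1 ∙N ∷ []) ((γ ≐ β) ∷ []) (α ≐ α ⊟ β ⊞ γ) N-one)) (K-shift (bounds isP) (y -ᶻ N) (+ 1))) N-one

  -- The factorisation

  LowerEnum⇒Enumerates : ∀ {cs L} → IsLowerEnum k cs L → Enumerates (wλ k cs) (map (wλ k) L)
  LowerEnum⇒Enumerates {cs} {L} (uniq , spec) = record
    { all-Incr     = AllP.map⁺ (All.map (λ {ds} p → wλ-Incr {ds} (proj₁ p)) members)
    ; all-≤    = AllP.map⁺ (All.map proj₂ members)
    ; all-≉ = separated uniq (All.map proj₁ members)
    ; covers = found
    }
    where
    members : All (λ ds → IsPk k ds × wλ k ds ≤B wλ k cs) L
    members = All.tabulate (λ {ds} ds∈ → proj₁ (spec ds) ds∈)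
    separated : ∀ {L} → AllPairs _≢_ L → All (IsPk k) L → AllPairs _≉W_ (map (wλ k) L)
    separated []       []       = []
    separated (n ∷ ns) (p ∷ ps) = AllP.map⁺ (All.map (λ { (ne , q) e → ne (wλ-injective p q e) }) (All.zipWith id (n , ps))) ∷ separated ns ps
    found : ∀ x → Incr x → x ≤B wλ k cs → Any (x ≈W_) (map (wλ k) L)
    found x inc le = locate (wλ-surjective x inc)
      where
      locate : ∃[ ds ] IsPk k ds × wλ k ds ≈W x → Any (x ≈W_) (map (wλ k) L)
      locate (ds , isP , e) = lose (MemP.∈-map⁺ (wλ k) (proj₂ (spec ds) (isP , ≤B-congˡ e le))) (≈W-sym {wλ k ds} {x} e)

  -- The transpose of multiplication by the monomial with exponent a.
  shiftBy : Mono k → (Mono k → ℤ) → Mono k → ℤ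
  shiftBy a φ b = φ (Vec.zipWith ℕ._+_ a b)

  private
    pair-sum : ∀ {A : Set} p (F : Mono k → A → ℤ) xs → pair p (λ a → sum (F a) xs) ≡ sum (λ x → pair p (λ a → F a x)) xs
    pair-sum p F xs = trans (sum-cong′ p (λ t → sym (sum-* (proj₁ t) (F (proj₂ t)) xs))) (sum-swap (λ t x → proj₁ t *ᶻ F (proj₂ t) x) p xs)

    pair-- : ∀ p φ ψ → pair p (λ a → φ a -ᶻ ψ a) ≡ pair p φ -ᶻ pair p ψ
    pair-- p φ ψ = trans (sum-cong′ p (λ t → trans (ℤP.*-distribˡ-+ (proj₁ t) (φ (proj₂ t)) (-ᶻ ψ (proj₂ t)))
      (cong (proj₁ t *ᶻ φ (proj₂ t) +ᶻ_) (sym (ℤP.neg-distribʳ-* (proj₁ t) (ψ (proj₂ t))))))) (sum-- (evaluate φ) (evaluate ψ) p)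

    ∇-pair : ∀ a p (Φ : Mono k → Word k → ℤ) u → pair p (λ m → ∇ a (Φ m) u) ≡ ∇ a (λ v → pair p (λ m → Φ m v)) u
    ∇-pair []      p Φ u = refl
    ∇-pair (i ∷ a) p Φ u = trans (∇-pair a p (λ m → step i (Φ m)) u) (∇-cong a (λ v → pair-- p (λ m → Φ m (i ∷ v)) (λ m → Φ m v)) u)

    ∇-- : ∀ a (Φ Ξ : Word k → ℤ) u → ∇ a (λ v → Φ v -ᶻ Ξ v) u ≡ ∇ a Φ u -ᶻ ∇ a Ξ u
    ∇-- []      Φ Ξ u = refl
    ∇-- (i ∷ a) Φ Ξ u = trans (∇-cong a (λ v → lin (Φ (i ∷ v) ∷ Ξ (i ∷ v) ∷ Φ v ∷ Ξ v ∷ []) [] (α ⊟ β ⊟ (γ ⊟ ζ) ≐ α ⊟ γ ⊟ (β ⊟ ζ))) u) (∇-- a (step i Φ) (step i Ξ) u)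

    zipWith-shuffle : ∀ {n} (a b c : Vec ℕ n) → Vec.zipWith ℕ._+_ a (Vec.zipWith ℕ._+_ b c) ≡ Vec.zipWith ℕ._+_ b (Vec.zipWith ℕ._+_ a c)
    zipWith-shuffle []      []      []      = refl
    zipWith-shuffle (x ∷ a) (y ∷ b) (z ∷ c) = cong₂ _∷_ (trans (sym (ℕP.+-assoc x y z)) (trans (cong (ℕ._+ z) (ℕP.+-comm x y)) (ℕP.+-assoc y x z))) (zipWith-shuffle a b c)

    zipWith-zero : ∀ {n} (a : Vec ℕ n) → Vec.zipWith ℕ._+_ a (Vec.replicate n 0) ≡ a
    zipWith-zero []      = refl
    zipWith-zero (x ∷ a) = cong₂ _∷_ (ℕP.+-identityʳ x) (zipWith-zero a)

  rectangle-factor : (g : Word k → Poly k) → IsKkSchur k g → (λ′ : List ℕ) → IsPk k λ′ → (t : ℕ) → 1 ≤ t → t ≤ k →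
    (L₁ L₂ L₃ : List (List ℕ)) → IsLowerEnum k (rect k t ∪P λ′) L₁ → IsLowerEnum k (rect k t) L₂ → IsLowerEnum k λ′ L₃ →
    gsum g L₁ ≈ gsum g L₂ ⊗ gsum g L₃
  rectangle-factor g isK λ′ isP t 1≤t t≤k L₁ L₂ L₃ e₁ e₂ e₃ =
    compare (δ-surjective {r} (wλ-Incr {rect k t} rect-IsPk)) (δ-surjective {wλ k λ′} (wλ-Incr {λ′} isP))
    where
    open Rect t 1≤t t≤k
    open KkSchur g isK

    pair-gsum : ∀ {cs L} → IsLowerEnum k cs L → ∀ u → δ u ≈W wλ k cs → ∀ φ → pair (gsum g L) φ ≡ Ψ (G φ) u
    pair-gsum {cs} {L} en u e φ = trans (pair-Σ (λ μ → g (wλ k μ)) L φ) (trans (sym (sum-map (G φ) (wλ k) L))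
      (Enumerates-sum (G φ) (G-cong φ) (LowerEnum⇒Enumerates {cs} {L} en) (Enumerates-cong {δ u} {wλ k cs} e (ideal-enumerates u))))

    Θ-cong : ∀ {v w} → v ≈W w → Θ v ≈W Θ w
    Θ-cong {v} {w} e x = trans (act-++ (rotate t v) r x) (trans (rotated (act r x)) (sym (act-++ (rotate t w) r x)))
      where
      rotated : ∀ y → act (rotate t v) y ≡ act (rotate t w) y
      rotated y = trans (cong (act (rotate t v)) back) (trans (act-rotate t v (y -ᶻ + t)) (trans (cong (_+ᶻ + t) (e (y -ᶻ + t)))
        (trans (sym (act-rotate t w (y -ᶻ + t))) (cong (act (rotate t w)) (sym back)))))
        where
        back : y ≡ y -ᶻ + t +ᶻ + t
        back = lin (y ∷ + t ∷ []) [] (α ≐ α ⊟ β ⊞ β)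

    compare : ∃[ r₀ ] δ r₀ ≈W r → ∃[ u ] δ u ≈W wλ k λ′ → gsum g L₁ ≈ gsum g L₂ ⊗ gsum g L₃
    compare (r₀ , er) (u₀ , eu) = pair⇒≈ (gsum g L₁) (gsum g L₂ ⊗ gsum g L₃) λ φ → begin
      pair (gsum g L₁) φ                                   ≡⟨ pair-gsum {rect k t ∪P λ′} {L₁} e₁ (rotate t u₀ ++ r₀) union-word φ ⟩
      Left′ φ u₀                                           ≡⟨ lin (Left′ φ u₀ ∷ Right′ φ u₀ ∷ []) ((α ⊟ β ≐ # 0) ∷ []) (α ≐ β) (Uniqueness.unique X (λ φ {u} {v} → X-Resp φ {u} {v}) X-[] X-pieri φ u₀) ⟩
      pair P (λ a → Ψ (G (shiftBy a φ)) u₀)                ≡⟨ pair-cong P (λ a → pair-gsum {λ′} {L₃} e₃ u₀ eu (shiftBy a φ)) ⟨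
      pair P (λ a → pair (gsum g L₃) (shiftBy a φ))        ≡⟨ pair-⊗ P (gsum g L₃) φ ⟨
      pair (P ⊗ gsum g L₃) φ                               ∎
      where
      open ≡-Reasoning
      P : Poly k
      P = gsum g L₂
      -- `Right′ φ u` pairs φ with `P` times the ideal sum of u, and `X` is the defect of the
      -- product formula tested on φ.
      Left′ Right′ X : (Mono k → ℤ) → Word k → ℤ
      Left′ φ u  = Ψ (G φ) (rotate t u ++ r₀)
      Right′ φ u = pair P (λ a → Ψ (G (shiftBy a φ)) u)
      X φ u      = Left′ φ u -ᶻ Right′ φ u
      δ-left : ∀ {u v} → δ u ≈W v → δ (rotate t u ++ r₀) ≈W Θ v
      δ-left {u} {v} e = ≈W-trans {δ (rotate t u ++ r₀)} {Θ (δ u)} {Θ v} (δ-Θ r₀ er u) (Θ-cong {δ u} {v} e)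
      union-word : δ (rotate t u₀ ++ r₀) ≈W wλ k (rect k t ∪P λ′)
      union-word = ≈W-trans {δ (rotate t u₀ ++ r₀)} {Θ (wλ k λ′)} {wλ k (rect k t ∪P λ′)} (δ-left {u₀} {wλ k λ′} eu)
        (≈W-sym {wλ k (rect k t ∪P λ′)} {Θ (wλ k λ′)} (wλ-union isP))
      X-Resp : ∀ φ → Resp (X φ)
      X-Resp φ {u} {v} e = cong₂ _-ᶻ_
        (Ψ-cong φ {rotate t u ++ r₀} {rotate t v ++ r₀} (≈W-trans {δ (rotate t u ++ r₀)} {Θ (δ v)} {δ (rotate t v ++ r₀)} (δ-left {u} {δ v} e) (≈W-sym {δ (rotate t v ++ r₀)} {Θ (δ v)} (δ-Θ r₀ er v))))
        (pair-cong P (λ a → Ψ-cong (shiftBy a φ) {u} {v} e))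
      X-[] : ∀ φ → X φ [] ≡ + 0
      X-[] φ = ℤP.i≡j⇒i-j≡0 (trans (sym (pair-gsum {rect k t} {L₂} e₂ r₀ er φ)) (sym (pair-cong P (λ a → trans (ℤP.+-identityʳ _)
        (trans (≈⇒pair (g []) one (IsKkSchur.unit isK) (shiftBy a φ)) (trans (ℤP.+-identityʳ _) (trans (ℤP.*-identityˡ _) (cong φ (zipWith-zero a)))))))))
      -- Multiplication by `P` commutes with multiplication by h_c and, being linear, with `∇`; so
      -- it carries one solution of the rule to another.
      right-pieri : ∀ c → 1 ≤ c → c ≤ k → ∀ φ u → Right′ (translate c φ) u ≡ sum (λ A → ∇ (dA A) (Right′ φ) u) (subsets c)
      right-pieri c c₁ c₂ φ u = begin
        pair P (λ a → Ψ (G (shiftBy a (translate c φ))) u)                        ≡⟨ pair-cong P (λ a → sum-cong′ (ideal u) (λ v → pair-cong (g v) (λ b → cong φ (zipWith-shuffle (eʳ c) a b)))) ⟩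
        pair P (λ a → Ψ (G (translate c (shiftBy a φ))) u)                        ≡⟨ pair-cong P (λ a → Ψ-pieri c c₁ c₂ (shiftBy a φ) u) ⟩
        pair P (λ a → sum (λ A → ∇ (dA A) (Ψ (G (shiftBy a φ))) u) (subsets c))   ≡⟨ pair-sum P (λ a A → ∇ (dA A) (Ψ (G (shiftBy a φ))) u) (subsets c) ⟩
        sum (λ A → pair P (λ a → ∇ (dA A) (Ψ (G (shiftBy a φ))) u)) (subsets c)   ≡⟨ sum-cong′ (subsets c) (λ A → ∇-pair (dA A) P (λ a → Ψ (G (shiftBy a φ))) u) ⟩
        sum (λ A → ∇ (dA A) (Right′ φ) u) (subsets c)                             ∎
      X-pieri : ∀ c → 1 ≤ c → c ≤ k → ∀ φ u → X (translate c φ) u ≡ sum (λ A → ∇ (dA A) (X φ) u) (subsets c)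
      X-pieri c c₁ c₂ φ u = begin
        Left′ (translate c φ) u -ᶻ Right′ (translate c φ) u
          ≡⟨ cong₂ _-ᶻ_ (trans (Ψ-pieri c c₁ c₂ φ (rotate t u ++ r₀)) (∇-sum-rotate t r₀ c c₂ {Ψ (G φ)} (λ {u} {v} → Ψ-cong φ {u} {v}) u)) (right-pieri c c₁ c₂ φ u) ⟩
        sum (λ A → ∇ (dA A) (Left′ φ) u) (subsets c) -ᶻ sum (λ A → ∇ (dA A) (Right′ φ) u) (subsets c)
          ≡⟨ sum-- (λ A → ∇ (dA A) (Left′ φ) u) (λ A → ∇ (dA A) (Right′ φ) u) (subsets c) ⟨
        sum (λ A → ∇ (dA A) (Left′ φ) u -ᶻ ∇ (dA A) (Right′ φ) u) (subsets c)
          ≡⟨ sum-cong′ (subsets c) (λ A → ∇-- (dA A) (Left′ φ) (Right′ φ) u) ⟨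
        sum (λ A → ∇ (dA A) (X φ) u) (subsets c) ∎

theorem1p4 : (k : ℕ) → 1 ≤ k →
    (g : Word k → Poly k) → IsKkSchur k g →
    (λ′ : List ℕ) → IsPk k λ′ →
    (t : ℕ) → 1 ≤ t → t ≤ k →
    (L₁ L₂ L₃ : List (List ℕ)) →
    IsLowerEnum k (rect k t ∪P λ′) L₁ →
    IsLowerEnum k (rect k t) L₂ →
    IsLowerEnum k λ′ L₃ →
    gsum g L₁ ≈ gsum g L₂ ⊗ gsum g L₃
theorem1p4 = rectangle-factor
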